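{- Let $K$ be a global function field of characteristic $p$ with constant field $\mathbb{F}_q$, let $v$ be a normalized nontrivial valuation on $K$, let $K_v$ be the completion of $K$ at $v$ and $A_v$ its valuation ring. Let $\pi\in K_v$ with $v(\pi)$ a positive integer, and let $\Gamma\subset A_v$ be a complete set of representatives of $A_v/\pi A_v$. Then $(\Gamma,\pi)$ has property A if and only if the following two conditions hold: (i) $\pi$ and all elements of $\Gamma$ are rational, i.e. $\pi\in K$ and $\Gamma\subset K$; (ii) $[K:\mathbb{F}_q(\pi)]=[K_v:\mathbb{F}_q((\pi))]$.
   Context: A global function field of characteristic $p$ is a field $K\supset\mathbb{F}_p$ containing an element $x$ transcendental over $\mathbb{F}_p$ with $[K:\mathbb{F}_p(x)]<\infty$; its constant field is the algebraic closure of $\mathbb{F}_p$ in $K$. A valuation on $K$ is a map $v:K^*\to\mathbb{Z}$ with $v(ab)=v(a)+v(b)$ and $v(a+b)\ge\min\{v(a),v(b)\}$, with $v(0)=+\infty$; it is normalized if $v(K^*)=\mathbb{Z}$. The valuation extends to the completion $K_v$, with valuation ring $A_v$. $\mathbb{F}_q(\pi)$ is the field generated by $\pi$ over $\mathbb{F}_q$, and $\mathbb{F}_q((\pi))$ is the completion (closure) of $\mathbb{F}_q(\pi)$ in $K_v$. Condition (ii) is considered together with (i), so that $\mathbb{F}_q(\pi)\subset K$. A complete set of representatives of $A_v/\pi A_v$ is a subset $\Gamma\subset A_v$ containing exactly one element of each residue class modulo $\pi A_v$ (it is finite). An expansion of $x\in K_v$ with respect to $(\Gamma,\pi)$ is a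 representation $x=\sum_{n\ge m}a_n\pi^n$ with $m\in\mathbb{Z}$ and $a_n\in\Gamma$ for all $n\ge m$; for each $m$ with $x\in\pi^mA_v$ there is exactly one such expansion starting at $m$. Its sequence of coefficients is $\{a_n\}_{n\ge m}$. A sequence $\{a_n\}_{n\ge m}$ is ultimately periodic if there are integers $N\ge m$ and $L>0$ with $a_{n+L}=a_n$ for all $n\ge N$. $(\Gamma,\pi)$ has property A if for every $x\in K_v$ and every expansion $x=\sum_{n\ge m}a_n\pi^n$ with respect to $(\Gamma,\pi)$: $x\in K$ if and only if $\{a_n\}_{n\ge m}$ is ultimately periodic. -}

module Defs where

open import Algebra.Bundles using (CommutativeRing; Semiring)
open import Algebra.Core using (Op₁)
import Algebra.Definitions.RawSemiring as RawSemiringDefs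
open import Algebra.Morphism.Structures using (IsRingHomomorphism)
open import Data.Fin.Base using (Fin; toℕ)
open import Data.Integer.Base as ℤ using (ℤ; +_; -[1+_])
open import Data.List.Base using (List; foldr)
open import Data.List.Relation.Unary.All using (All)
open import Data.List.Relation.Unary.Any using (Any)
open import Data.Nat.Base as ℕ using (ℕ; suc)
open import Data.Nat.Primality using (Prime)
open import Data.Product using (Σ-syntax; ∃; ∃-syntax; ∃!; _×_)
open import Data.Sum.Base using (_⊎_)
open import Function.Bundles using (_⇔_)
open import Level using (Level; _⊔_) renaming (suc to lsuc)
import Relation.Binary.Construct.Add.Supremum.NonStrict as AddSupremum
open import Relation.Binary.Core using (_Preserves_⟶_)
open import Relation.Binary.Definitions using (_Respects_)
open import Relation.Binary.PropositionalEquality.Core using (_≡_; _≢_)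
open import Relation.Nullary.Construct.Add.Supremum using (_⁺; [_]; ⊤⁺)
open import Relation.Nullary.Negation.Core using (¬_)
open import Relation.Unary using (Pred; _∈_; _⊆_; U)

-- _⁻¹ is a total operation; its value at 0# is unspecified.
record Field c ℓ : Set (lsuc (c ⊔ ℓ)) where
  infix 9 _⁻¹
  field
    commutativeRing : CommutativeRing c ℓ
  open CommutativeRing commutativeRing public
  field
    _⁻¹        : Op₁ Carrier
    ⁻¹-cong    : _⁻¹ Preserves _≈_ ⟶ _≈_
    1≉0        : 1# ≉ 0#
    *-inverseʳ : ∀ x → x ≉ 0# → x * x ⁻¹ ≈ 1#

  open RawSemiringDefs (Semiring.rawSemiring semiring) public
    using (sum; _^_) renaming (_×_ to _·_)

  infixr 8 _^ℤ_
  -- Meaningful for negative exponents only when the base is nonzero.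
  _^ℤ_ : Carrier → ℤ → Carrier
  x ^ℤ (+ n)    = x ^ n
  x ^ℤ -[1+ n ] = (x ⁻¹) ^ suc n

module _ {c ℓ} (K : Field c ℓ) where
  open Field K

  HasCardinality : ∀ {s} → Pred Carrier s → ℕ → Set _
  HasCardinality S q = Σ[ e ∈ (Fin q → Carrier) ]
    ((∀ i → e i ∈ S)
    × (∀ i j → e i ≈ e j → i ≡ j)
    × (∀ x → x ∈ S → ∃[ i ] e i ≈ x))

  data Generated {s} (S : Pred Carrier s) : Pred Carrier (c ⊔ ℓ ⊔ s) where
    gen        : ∀ {x} → x ∈ S → Generated S x
    resp       : ∀ {x y} → x ≈ y → Generated S x → Generated S y
    0-closed   : Generated S 0#
    1-closed   : Generated S 1#
    +-closed   : ∀ {x y} → Generated S x → Generated S y → Generated S (x + y)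
    neg-closed : ∀ {x} → Generated S x → Generated S (- x)
    *-closed   : ∀ {x y} → Generated S x → Generated S y → Generated S (x * y)
    ⁻¹-closed  : ∀ {x} → x ≉ 0# → Generated S x → Generated S (x ⁻¹)

  -- F(a), the subfield generated by F ∪ {a}.
  Adjoin : ∀ {s} → Pred Carrier s → Carrier → Pred Carrier (c ⊔ ℓ ⊔ s)
  Adjoin F a = Generated (λ x → x ∈ F ⊎ x ≈ a)

  -- Polynomials are lists of coefficients, constant term first.
  eval : List Carrier → Carrier → Carrier
  eval f x = foldr (λ a r → a + x * r) 0# f

  Algebraic : ∀ {s} → Pred Carrier s → Pred Carrier _
  Algebraic F x = ∃[ f ] All F f × Any (_≉ 0#) f × eval f x ≈ 0#

  Transcendental : ∀ {s} → Pred Carrier s → Pred Carrier _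
  Transcendental F x = ¬ Algebraic F x

  -- The copy of 𝔽ₚ in a field of characteristic p.
  PrimeField : Pred Carrier ℓ
  PrimeField x = ∃[ n ] x ≈ n · 1#

  ConstantField : Pred Carrier _
  ConstantField = Algebraic PrimeField

  IsBasis : ∀ {e f n} → Pred Carrier e → Pred Carrier f → (Fin n → Carrier) → Set _
  IsBasis {n = n} E F b =
    (∀ i → b i ∈ E)
    × (∀ (k : Fin n → Carrier) → (∀ i → k i ∈ F) →
         sum (λ i → k i * b i) ≈ 0# → ∀ i → k i ≈ 0#)
    × (∀ x → x ∈ E →
         Σ[ k ∈ (Fin n → Carrier) ] ((∀ i → k i ∈ F) × x ≈ sum (λ i → k i * b i)))

  -- [E : F] = d in ℕ ∪ {∞}, for subfields F ⊆ E of K.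
  HasDegree : ∀ {e f} → Pred Carrier e → Pred Carrier f → ℕ ⁺ → Set _
  HasDegree E F [ n ] = Σ[ b ∈ (Fin n → Carrier) ] IsBasis E F b
  HasDegree E F ⊤⁺    = ∀ n → ¬ HasDegree E F [ n ]

  record IsGlobalFunctionField (p : ℕ) : Set (c ⊔ ℓ) where
    field
      p-prime              : Prime p
      characteristic       : p · 1# ≈ 0#
      finite-over-rational : ∃[ x ] Transcendental PrimeField x
                               × (∃[ n ] HasDegree U (Adjoin PrimeField x) [ n ])

open AddSupremum ℤ._≤_ public using (_≤⁺_)

infixl 6 _+⁺_
_+⁺_ : ℤ ⁺ → ℤ ⁺ → ℤ ⁺
[ m ] +⁺ [ n ] = [ m ℤ.+ n ]
[ m ] +⁺ ⊤⁺    = ⊤⁺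
⊤⁺    +⁺ n     = ⊤⁺

infixl 7 _⊓⁺_
_⊓⁺_ : ℤ ⁺ → ℤ ⁺ → ℤ ⁺
[ m ] ⊓⁺ [ n ] = [ m ℤ.⊓ n ]
[ m ] ⊓⁺ ⊤⁺    = [ m ]
⊤⁺    ⊓⁺ n     = n

record Valuation {c ℓ} (K : Field c ℓ) : Set (c ⊔ ℓ) where
  open Field K
  field
    val        : Carrier → ℤ ⁺
    val-cong   : val Preserves _≈_ ⟶ _≡_
    val-∞      : ∀ x → val x ≡ ⊤⁺ ⇔ x ≈ 0#
    val-*      : ∀ x y → val (x * y) ≡ val x +⁺ val y
    val-+      : ∀ x y → val x ⊓⁺ val y ≤⁺ val (x + y)

  Normalized : Set c
  Normalized = ∀ n → ∃[ x ] val x ≡ [ n ]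

  Nontrivial : Set (c ⊔ ℓ)
  Nontrivial = ∃[ x ] x ≉ 0# × val x ≢ [ + 0 ]

  ValuationRing : Pred Carrier _
  ValuationRing x = [ + 0 ] ≤⁺ val x

  Converges : (ℕ → Carrier) → Carrier → Set
  Converges s x = ∀ (M : ℤ) → ∃[ N ] ∀ n → N ℕ.≤ n → [ M ] ≤⁺ val (s n - x)

  Cauchy : (ℕ → Carrier) → Set
  Cauchy s = ∀ (M : ℤ) → ∃[ N ] ∀ m n → N ℕ.≤ m → N ℕ.≤ n → [ M ] ≤⁺ val (s m - s n)

  Closure : ∀ {s} → Pred Carrier s → Pred Carrier _
  Closure S x = ∀ (M : ℤ) → ∃[ y ] y ∈ S × [ M ] ≤⁺ val (x - y)

  CongruentMod : Carrier → Carrier → Carrier → Set _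
  CongruentMod π x y = ∃[ z ] z ∈ ValuationRing × x - y ≈ π * z

  record IsCompleteRepresentatives {g} (Γ : Pred Carrier g) (π : Carrier) : Set (c ⊔ ℓ ⊔ g) where
    field
      respects       : Γ Respects _≈_
      integral       : Γ ⊆ ValuationRing
      representative : ∀ x → x ∈ ValuationRing →
                       ∃! _≈_ (λ γ → γ ∈ Γ × CongruentMod π x γ)

  -- x = Σ_{n ≥ m} aₙ πⁿ with all aₙ ∈ Γ; the values of a below m are ignored.
  IsExpansion : ∀ {g} → Pred Carrier g → Carrier → Carrier → ℤ → (ℤ → Carrier) → Set _
  IsExpansion Γ π x m a =
    (∀ n → m ℤ.≤ n → a n ∈ Γ)
    × Converges (λ k → sum {k} (λ i → term (m ℤ.+ + toℕ i))) x
    where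
    term : ℤ → Carrier
    term n = a n * π ^ℤ n

  UltimatelyPeriodic : ℤ → (ℤ → Carrier) → Set _
  UltimatelyPeriodic m a = ∃[ N ] ∃[ L ]
    m ℤ.≤ N × + 0 ℤ.< L × (∀ n → N ℤ.≤ n → a (n ℤ.+ L) ≈ a n)

-- Completions are characterised rather than constructed: a complete valued
-- field in which K embeds densely and isometrically.
record Completion {c ℓ} {K : Field c ℓ} (v : Valuation K) c′ ℓ′ :
                  Set (c ⊔ ℓ ⊔ lsuc (c′ ⊔ ℓ′)) where
  private module K = Field K
  field
    K̂ : Field c′ ℓ′
    v̂ : Valuation K̂
  open Field K̂
  open Valuation v̂
  field
    ι              : K.Carrier → Carrier
    ι-homomorphism : IsRingHomomorphism K.rawRing rawRing ι
    ι-val          : ∀ x → val (ι x) ≡ Valuation.val v x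

  Image : ∀ {s} → Pred K.Carrier s → Pred Carrier _
  Image S y = ∃[ x ] x ∈ S × ι x ≈ y

  field
    dense    : ∀ y → y ∈ Closure (Image U)
    complete : ∀ s → Cauchy s → ∃[ y ] Converges s y

  -- K as a subfield of its completion.
  Rational : Pred Carrier _
  Rational = Image U

  -- 𝔽_q(π) and 𝔽_q((π)), where 𝔽_q is the constant field of K.
  𝔽q⟨_⟩ : Carrier → Pred Carrier _
  𝔽q⟨ π ⟩ = Adjoin K̂ (Image (ConstantField K)) π

  𝔽q⟪_⟫ : Carrier → Pred Carrier _
  𝔽q⟪ π ⟫ = Closure 𝔽q⟨ π ⟩

  PropertyA : ∀ {g} → Pred Carrier g → Carrier → Set _
  PropertyA Γ π = ∀ x m a → IsExpansion Γ π x m a →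
                  x ∈ Rational ⇔ UltimatelyPeriodic m a

{-# OPTIONS --safe #-}

-- Write 𝔸 for the valuation ring of K_v, k = 𝔽_q, F = k(π) and F̂ for the closure of F.
-- K is finite over F: π is transcendental over k but algebraic over k(x), so x is
-- algebraic over F by exchange.  Choose ω₁, …, ω_r ∈ K ∩ 𝔸 that reduce to a k-basis of
-- 𝔸/π𝔸.  They are a basis of K_v over F̂, by completeness and because v(Σ cᵢ ωᵢ) bounds
-- every v(cᵢ) from below.
--
-- Property A gives K: the digit sequences (γ, γ, …) and (γ, γ′, γ′, …) yield γ/(1 - π),
-- γ - γ′ ∈ K, hence π and Γ lie in K.  Let b be a basis of K over F.  An element of
-- K ∩ 𝔸 with periodic digits is a combination of digits over F ∩ 𝔸, so its coordinates
-- with respect to b are bounded in terms of those of the finite set Γ.  Coordinates are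
-- thus continuous and b stays a basis of K_v over F̂.
--
-- Conversely, equal degrees force K = Σ F ωᵢ.  Then for some u ∈ k[π] with v(u) = 0 all
-- tails rₙ of the expansion of an element of K satisfy u rₙ ∈ Σ k[π] ωᵢ, with bounded
-- degrees because u rₙ₊₁ = (u rₙ - u aₙ)/π.  So two tails agree and the digits repeat.

module Submission where

open import Defs
open import Algebra.Bundles using (CommutativeRing; module AbelianGroup)
open import Algebra.Morphism.Structures using (IsRingHomomorphism)
import Algebra.Properties.CommutativeSemiring.Exp as Exp
import Algebra.Properties.Group as GroupProps
import Algebra.Properties.Ring as RingProps
import Algebra.Properties.Semiring.Mult as SemiringMult
import Algebra.Properties.Semiring.Sum as Sum
import Algebra.Solver.Ring
open import Algebra.Solver.Ring.AlmostCommutativeRing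
  using (fromCommutativeRing; _-Raw-AlmostCommutative⟶_)
open import Axiom.ExcludedMiddle using (ExcludedMiddle)
open import Data.Fin.Base as Fin using (Fin; zero; suc; punchIn; toℕ)
import Data.Fin.Properties as Fin
open import Data.Integer.Base as ℤ using (ℤ; +_; -[1+_]; _⊖_; _<_)
import Data.Integer.Properties as ℤ
open import Data.Integer.Solver using (module +-*-Solver)
import Data.List.Base as List
open import Data.List.Relation.Unary.All as All using (All)
open import Data.List.Relation.Unary.Any using (Any; here; there)
open import Data.Maybe.Base using (Maybe; just; nothing)
open import Data.Nat.Base as ℕ using (ℕ; zero; suc; s≤s; z≤n; NonZero)
open import Data.Nat.DivMod using (_%_; _/_; m≡m%n+[m/n]*n; m%n<n)
open import Data.Nat.Primality using (prime⇒nonZero)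
import Data.Nat.Properties as ℕ
open import Data.Product.Base using (Σ-syntax; ∃₂; ∃-syntax; _×_; _,_; proj₁; proj₂)
open import Data.Sum.Base using (_⊎_; inj₁; inj₂; fromInj₁)
open import Data.Vec.Functional using (insertAt; _∷_; []; _++_)
open import Data.Vec.Functional.Properties using (insertAt-lookup; insertAt-punchIn)
open import Function.Base using (_∘_; id)
open import Function.Bundles using (_⇔_; mk⇔; module Equivalence)
open import Level using (_⊔_)
import Relation.Binary.Construct.Add.Supremum.NonStrict as AddSupremum
open import Relation.Binary.Definitions using (tri<; tri≈; tri>)
open import Relation.Binary.PropositionalEquality as ≡ using (_≡_)
open import Relation.Nullary using (¬_; Dec; yes; no)
open import Relation.Nullary.Construct.Add.Supremum using (_⁺; [_]; ⊤⁺)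
open import Relation.Nullary.Negation using (contradiction)
open import Relation.Unary using (Pred; _∈_; _⊆_; U)

-- The number v(π) may exceed 1, so 𝔸/π𝔸 need not be a field and is used only as a vector space over
-- k. Since k is finite, its nonzero elements are roots of unity and have valuation 0. Hence k
-- embeds in 𝔸/π𝔸, elements of F ∩ 𝔸 have residues in k, and π is transcendental over k. Residues
-- also explain why degrees stay bounded: an element of Σ k[π] ωᵢ that is divisible by π in 𝔸 has
-- constant coefficient 0, so dividing it by π only shifts coefficients.
--
-- A family is a basis of K_v over F̂ as soon as its span over F is dense and its coordinates over F
-- are continuous. Both directions use this criterion, one for b and the other for ω. For b the
-- continuity rests on a closed form: a purely periodic tail y satisfies y = h + πˡ y, where h is a
-- combination of digits, and 1 - πˡ is a unit of F ∩ 𝔸. Solving for y therefore introduces no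
-- denominators, and the bound on the coordinates of the digits survives, however long the period
-- is.

-- The library's solver run with integer coefficients, so that it can cancel
-- x - x in a ring without decidable equality.
module IntegerSolver {c ℓ} (R : CommutativeRing c ℓ) where
  open CommutativeRing R
  open SemiringMult semiring renaming (_×_ to _·_)
  open RingProps ring
    using (-0#≈0#; -‿involutive; -‿+-comm; -‿distribˡ-*; -‿distribʳ-*)
  open import Relation.Binary.Reasoning.Setoid setoid

  private
    ⟦_⟧ : ℤ → Carrier
    ⟦ + n ⟧    = n · 1#
    ⟦ -[1+ n ] ⟧ = - (suc n · 1#)

    ⊖-homo : ∀ m n → ⟦ m ⊖ n ⟧ ≈ m · 1# - n · 1#
    ⊖-homo m zero = sym (trans (+-congˡ -0#≈0#) (+-identityʳ _))
    ⊖-homo zero (suc n) = sym (+-identityˡ _)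
    ⊖-homo (suc m) (suc n) = begin
      ⟦ suc m ⊖ suc n ⟧ ≈⟨ reflexive (≡.cong ⟦_⟧ (ℤ.[1+m]⊖[1+n]≡m⊖n m n)) ⟩
      ⟦ m ⊖ n ⟧         ≈⟨ ⊖-homo m n ⟩
      x - y             ≈⟨ +-congʳ (sym (+-identityˡ x)) ⟩
      0# + x - y        ≈⟨ +-congʳ (+-congʳ (sym (-‿inverseʳ 1#))) ⟩
      1# - 1# + x - y   ≈⟨ +-congʳ (trans (+-assoc _ _ _) (trans (+-congˡ (+-comm _ _)) (sym (+-assoc _ _ _)))) ⟩
      1# + x - 1# - y   ≈⟨ +-assoc _ _ _ ⟩
      1# + x + (- 1# - y) ≈⟨ +-congˡ (-‿+-comm 1# y) ⟩
      1# + x - (1# + y) ∎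
      where
      x = m · 1#
      y = n · 1#

    +-homo : ∀ i j → ⟦ i ℤ.+ j ⟧ ≈ ⟦ i ⟧ + ⟦ j ⟧
    +-homo (+ m) (+ n) = ×-homo-+ 1# m n
    +-homo (+ m) -[1+ n ] = ⊖-homo m (suc n)
    +-homo -[1+ m ] (+ n) = trans (⊖-homo n (suc m)) (+-comm _ _)
    +-homo -[1+ m ] -[1+ n ] = begin
      - (suc (suc (m ℕ.+ n)) · 1#)  ≈⟨ -‿cong (×-congˡ (≡.cong suc (≡.sym (ℕ.+-suc m n)))) ⟩
      - ((suc m ℕ.+ suc n) · 1#)    ≈⟨ -‿cong (×-homo-+ 1# (suc m) (suc n)) ⟩
      - (suc m · 1# + suc n · 1#)   ≈⟨ sym (-‿+-comm _ _) ⟩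
      - (suc m · 1#) - suc n · 1#   ∎

    -‿homo : ∀ i → ⟦ ℤ.- i ⟧ ≈ - ⟦ i ⟧
    -‿homo (+ zero)  = sym -0#≈0#
    -‿homo (+ suc n) = refl
    -‿homo -[1+ n ]  = sym (-‿involutive _)

    *-homo-+ : ∀ m n → ⟦ + m ℤ.* + n ⟧ ≈ m · 1# * (n · 1#)
    *-homo-+ m n = trans (reflexive (≡.cong ⟦_⟧ (≡.sym (ℤ.pos-* m n)))) (×1-homo-* m n)

    *-homo : ∀ i j → ⟦ i ℤ.* j ⟧ ≈ ⟦ i ⟧ * ⟦ j ⟧
    *-homo (+ m) (+ n) = *-homo-+ m n
    *-homo (+ m) -[1+ n ] = begin
      ⟦ + m ℤ.* ℤ.- + suc n ⟧   ≈⟨ reflexive (≡.cong ⟦_⟧ (≡.sym (ℤ.neg-distribʳ-* (+ m) (+ suc n)))) ⟩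
      ⟦ ℤ.- (+ m ℤ.* + suc n) ⟧ ≈⟨ -‿homo (+ m ℤ.* + suc n) ⟩
      - ⟦ + m ℤ.* + suc n ⟧     ≈⟨ -‿cong (*-homo-+ m (suc n)) ⟩
      - (m · 1# * (suc n · 1#)) ≈⟨ -‿distribʳ-* _ _ ⟩
      ⟦ + m ⟧ * ⟦ -[1+ n ] ⟧    ∎
    *-homo -[1+ m ] j = begin
      ⟦ ℤ.- + suc m ℤ.* j ⟧   ≈⟨ reflexive (≡.cong ⟦_⟧ (≡.sym (ℤ.neg-distribˡ-* (+ suc m) j))) ⟩
      ⟦ ℤ.- (+ suc m ℤ.* j) ⟧ ≈⟨ -‿homo (+ suc m ℤ.* j) ⟩
      - ⟦ + suc m ℤ.* j ⟧     ≈⟨ -‿cong (pos* j) ⟩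
      - (suc m · 1# * ⟦ j ⟧)  ≈⟨ -‿distribˡ-* _ _ ⟩
      ⟦ -[1+ m ] ⟧ * ⟦ j ⟧    ∎
      where
      pos* : ∀ j → ⟦ + suc m ℤ.* j ⟧ ≈ suc m · 1# * ⟦ j ⟧
      pos* (+ n) = *-homo-+ (suc m) n
      pos* -[1+ n ] = begin
        ⟦ + suc m ℤ.* ℤ.- + suc n ⟧   ≈⟨ reflexive (≡.cong ⟦_⟧ (≡.sym (ℤ.neg-distribʳ-* (+ suc m) (+ suc n)))) ⟩
        ⟦ ℤ.- (+ suc m ℤ.* + suc n) ⟧ ≈⟨ -‿homo (+ suc m ℤ.* + suc n) ⟩
        - ⟦ + suc m ℤ.* + suc n ⟧     ≈⟨ -‿cong (*-homo-+ (suc m) (suc n)) ⟩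
        - (suc m · 1# * (suc n · 1#)) ≈⟨ -‿distribʳ-* _ _ ⟩
        suc m · 1# * ⟦ -[1+ n ] ⟧     ∎

    morphism : ℤ.+-*-rawRing -Raw-AlmostCommutative⟶ fromCommutativeRing R
    morphism = record
      { ⟦_⟧ = ⟦_⟧ ; +-homo = +-homo ; *-homo = *-homo ; -‿homo = -‿homo
      ; 0-homo = refl ; 1-homo = +-identityʳ 1# }

    coeff≟ : ∀ i j → Maybe (⟦ i ⟧ ≈ ⟦ j ⟧)
    coeff≟ i j with i ℤ.≟ j
    ... | yes i≡j = just (reflexive (≡.cong ⟦_⟧ i≡j))
    ... | no  _   = nothing

  open Algebra.Solver.Ring ℤ.+-*-rawRing (fromCommutativeRing R) morphism coeff≟ public
    using (solve; _:=_; _:+_; _:*_; _:-_; :-_)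

-- Linear algebra over subfields given as predicates

module FieldTheory (em : ∀ {a} → ExcludedMiddle a) {c ℓ} (L : Field c ℓ) where
  open Field L hiding (zero)
  open IntegerSolver commutativeRing public
  open RingProps ring public
    using (-0#≈0#; -‿involutive; -‿distribˡ-*; -‿distribʳ-*)
    renaming (x∙y⁻¹≈ε⇒x≈y to x-y≈0⇒x≈y; x≈y⇒x∙y⁻¹≈ε to x≈y⇒x-y≈0)
  open Exp commutativeSemiring public using (^-homo-*)
  open Sum semiring
    using (sum-remove; ∑-distrib-+; ∑-comm; sum-cong-≋; *-distribˡ-sum)
  open import Relation.Binary.Reasoning.Setoid setoid

  ¬¬-elim : ∀ {a} {A : Set a} → ¬ ¬ A → A
  ¬¬-elim {A = A} ¬¬a with em {P = A}
  ... | yes a = a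
  ... | no ¬a = contradiction ¬a ¬¬a

  x*y≈0⇒y≈0 : ∀ {x y} → x ≉ 0# → x * y ≈ 0# → y ≈ 0#
  x*y≈0⇒y≈0 {x} {y} x≉0 xy≈0 = begin
    y              ≈⟨ sym (*-identityˡ y) ⟩
    1# * y         ≈⟨ *-congʳ (sym (*-inverseʳ x x≉0)) ⟩
    x * x ⁻¹ * y   ≈⟨ solve 3 (λ x i y → x :* i :* y := i :* (x :* y)) refl x (x ⁻¹) y ⟩
    x ⁻¹ * (x * y) ≈⟨ *-congˡ xy≈0 ⟩
    x ⁻¹ * 0#      ≈⟨ zeroʳ _ ⟩
    0#             ∎

  *-≉0 : ∀ {x y} → x ≉ 0# → y ≉ 0# → x * y ≉ 0#
  *-≉0 x≉0 y≉0 xy≈0 = y≉0 (x*y≈0⇒y≈0 x≉0 xy≈0)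

  ⁻¹-≉0 : ∀ {x} → x ≉ 0# → x ⁻¹ ≉ 0#
  ⁻¹-≉0 {x} x≉0 x⁻¹≈0 = 1≉0 (trans (sym (*-inverseʳ x x≉0)) (trans (*-congˡ x⁻¹≈0) (zeroʳ x)))

  ^-≉0 : ∀ {x} n → x ≉ 0# → x ^ n ≉ 0#
  ^-≉0 zero    x≉0 = 1≉0
  ^-≉0 (suc n) x≉0 = *-≉0 x≉0 (^-≉0 n x≉0)

  *-cancelˡ : ∀ {x y z} → x ≉ 0# → x * y ≈ x * z → y ≈ z
  *-cancelˡ {x} {y} {z} x≉0 xy≈xz = x-y≈0⇒x≈y y z (x*y≈0⇒y≈0 x≉0 (begin
    x * (y - z)   ≈⟨ solve 3 (λ x y z → x :* (y :- z) := x :* y :- x :* z) refl x y z ⟩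
    x * y - x * z ≈⟨ x≈y⇒x-y≈0 xy≈xz ⟩
    0#            ∎))

  *-inverseˡ : ∀ {x} → x ≉ 0# → x ⁻¹ * x ≈ 1#
  *-inverseˡ x≉0 = trans (*-comm _ _) (*-inverseʳ _ x≉0)

  ⁻¹-unique : ∀ {x y} → x * y ≈ 1# → x ⁻¹ ≈ y
  ⁻¹-unique {x} {y} xy≈1 = *-cancelˡ x≉0 (trans (*-inverseʳ x x≉0) (sym xy≈1))
    where
    x≉0 : x ≉ 0#
    x≉0 x≈0 = 1≉0 (trans (sym xy≈1) (trans (*-congʳ x≈0) (zeroˡ y)))

  record IsSubfield {f} (F : Pred Carrier f) : Set (c ⊔ ℓ ⊔ f) where
    field
      resp∈  : ∀ {x y} → x ≈ y → x ∈ F → y ∈ F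
      0∈    : 0# ∈ F
      1∈    : 1# ∈ F
      +∈    : ∀ {x y} → x ∈ F → y ∈ F → x + y ∈ F
      neg∈  : ∀ {x} → x ∈ F → - x ∈ F
      *∈    : ∀ {x y} → x ∈ F → y ∈ F → x * y ∈ F
      ⁻¹∈   : ∀ {x} → x ≉ 0# → x ∈ F → x ⁻¹ ∈ F

    -∈ : ∀ {x y} → x ∈ F → y ∈ F → x - y ∈ F
    -∈ x∈F y∈F = +∈ x∈F (neg∈ y∈F)

    ^∈ : ∀ {x} n → x ∈ F → x ^ n ∈ F
    ^∈ zero    x∈F = 1∈
    ^∈ (suc n) x∈F = *∈ x∈F (^∈ n x∈F)

    sum∈ : ∀ {n} {k : Fin n → Carrier} → (∀ i → k i ∈ F) → sum k ∈ F
    sum∈ {zero}  k∈F = 0∈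
    sum∈ {suc n} k∈F = +∈ (k∈F zero) (sum∈ (k∈F ∘ suc))

  generated-isSubfield : ∀ {s} {S : Pred Carrier s} → IsSubfield (Generated L S)
  generated-isSubfield = record
    { resp∈ = resp ; 0∈ = 0-closed ; 1∈ = 1-closed ; +∈ = +-closed
    ; neg∈ = neg-closed ; *∈ = *-closed ; ⁻¹∈ = ⁻¹-closed }

  generated-least : ∀ {s f} {S : Pred Carrier s} {F : Pred Carrier f} →
    IsSubfield F → S ⊆ F → Generated L S ⊆ F
  generated-least {S = S} {F} isF S⊆F = go
    where
    open IsSubfield isF
    go : Generated L S ⊆ F
    go (gen x∈S)        = S⊆F x∈S
    go (resp x≈y g)     = resp∈ x≈y (go g)
    go 0-closed         = 0∈
    go 1-closed         = 1∈
    go (+-closed g h)   = +∈ (go g) (go h)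
    go (neg-closed g)   = neg∈ (go g)
    go (*-closed g h)   = *∈ (go g) (go h)
    go (⁻¹-closed ≉0 g) = ⁻¹∈ ≉0 (go g)

  -- The scalars `F` may be any set. Besides subfields the record is used with the valuation ring of
  -- k(π), where it describes a module over a ring.
  record IsSubspace {f s} (F : Pred Carrier f) (S : Pred Carrier s) : Set (c ⊔ ℓ ⊔ f ⊔ s) where
    field
      resp∈   : ∀ {x y} → x ≈ y → x ∈ S → y ∈ S
      0∈     : 0# ∈ S
      +∈     : ∀ {x y} → x ∈ S → y ∈ S → x + y ∈ S
      scale∈ : ∀ {a x} → a ∈ F → x ∈ S → a * x ∈ S

  subspace-neg : ∀ {f s} {F : Pred Carrier f} {S : Pred Carrier s} → IsSubfield F → IsSubspace F S →
    ∀ {x} → x ∈ S → - x ∈ S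
  subspace-neg isF isS {x} x∈S =
    resp∈ (trans (sym (-‿distribˡ-* 1# x)) (-‿cong (*-identityˡ x)))
      (scale∈ (IsSubfield.neg∈ isF (IsSubfield.1∈ isF)) x∈S)
    where open IsSubspace isS

  subfield⇒subspace : ∀ {f e} {F : Pred Carrier f} {E : Pred Carrier e} →
    F ⊆ E → IsSubfield E → IsSubspace F E
  subfield⇒subspace F⊆E isE = record
    { resp∈ = resp∈ ; 0∈ = 0∈ ; +∈ = +∈ ; scale∈ = λ a∈F x∈E → *∈ (F⊆E a∈F) x∈E }
    where open IsSubfield isE

  -- Linear combinations and linear dependence

  lc : ∀ {n} → (Fin n → Carrier) → (Fin n → Carrier) → Carrier
  lc k b = sum (λ i → k i * b i)

  lc-congˡ : ∀ {n} {k k′ b : Fin n → Carrier} → (∀ i → k i ≈ k′ i) → lc k b ≈ lc k′ b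
  lc-congˡ k≈k′ = sum-cong-≋ (λ i → *-congʳ (k≈k′ i))

  lc-+ : ∀ {n} (k k′ b : Fin n → Carrier) → lc (λ i → k i + k′ i) b ≈ lc k b + lc k′ b
  lc-+ k k′ b = trans (sum-cong-≋ (λ i → distribʳ (b i) (k i) (k′ i)))
    (∑-distrib-+ (λ i → k i * b i) (λ i → k′ i * b i))

  lc-scale : ∀ {n} a (k b : Fin n → Carrier) → lc (λ i → a * k i) b ≈ a * lc k b
  lc-scale a k b = trans (sum-cong-≋ (λ i → *-assoc a (k i) (b i)))
    (sym (*-distribˡ-sum a (λ i → k i * b i)))

  lc-0 : ∀ {n} {k : Fin n → Carrier} b → (∀ i → k i ≈ 0#) → lc k b ≈ 0#
  lc-0 {zero}  b k≈0 = refl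
  lc-0 {suc n} b k≈0 = trans (+-cong (trans (*-congʳ (k≈0 zero)) (zeroˡ _)) (lc-0 (b ∘ suc) (k≈0 ∘ suc)))
    (+-identityˡ 0#)

  lc-- : ∀ {n} (k k′ b : Fin n → Carrier) → lc (λ i → k i - k′ i) b ≈ lc k b - lc k′ b
  lc-- k k′ b = begin
    lc (λ i → k i - k′ i) b          ≈⟨ lc-+ k (λ i → - k′ i) b ⟩
    lc k b + lc (λ i → - k′ i) b     ≈⟨ +-congˡ (lc-congˡ {b = b} (λ i → trans (-‿cong (sym (*-identityˡ (k′ i)))) (-‿distribˡ-* 1# (k′ i)))) ⟩
    lc k b + lc (λ i → - 1# * k′ i) b ≈⟨ +-congˡ (lc-scale (- 1#) k′ b) ⟩
    lc k b + - 1# * lc k′ b          ≈⟨ +-congˡ (trans (sym (-‿distribˡ-* 1# _)) (-‿cong (*-identityˡ _))) ⟩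
    lc k b - lc k′ b                 ∎

  Span : ∀ {f n} → Pred Carrier f → (Fin n → Carrier) → Pred Carrier (c ⊔ ℓ ⊔ f)
  Span {n = n} F b y = Σ[ k ∈ (Fin n → Carrier) ] ((∀ i → k i ∈ F) × y ≈ lc k b)

  span-isSubspace : ∀ {f n} {F : Pred Carrier f} → IsSubfield F → (b : Fin n → Carrier) →
    IsSubspace F (Span F b)
  span-isSubspace isF b = record
    { resp∈   = λ x≈y (k , k∈F , x≈) → k , k∈F , trans (sym x≈y) x≈
    ; 0∈     = (λ _ → 0#) , (λ _ → 0∈) , sym (lc-0 b (λ _ → refl))
    ; +∈     = λ (k , k∈F , x≈) (k′ , k′∈F , y≈) →
        (λ i → k i + k′ i) , (λ i → +∈ (k∈F i) (k′∈F i)) , trans (+-cong x≈ y≈) (sym (lc-+ k k′ b))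
    ; scale∈ = λ {a} a∈F (k , k∈F , x≈) →
        (λ i → a * k i) , (λ i → *∈ a∈F (k∈F i)) , trans (*-congˡ x≈) (sym (lc-scale a k b)) }
    where open IsSubfield isF

  basis∈span : ∀ {f n} {F : Pred Carrier f} → IsSubfield F → {b : Fin n → Carrier} → ∀ i → b i ∈ Span F b
  basis∈span isF {b} zero = (λ { zero → 1# ; (suc _) → 0# }) , (λ { zero → 1∈ ; (suc _) → 0∈ }) ,
    sym (trans (+-cong (*-identityˡ _) (lc-0 (b ∘ suc) (λ _ → refl))) (+-identityʳ _))
    where open IsSubfield isF
  basis∈span isF {b} (suc i) = let a , a∈ , eq = basis∈span isF {b ∘ suc} i in
    (λ { zero → 0# ; (suc j) → a j }) , (λ { zero → 0∈ ; (suc j) → a∈ j }) ,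
    trans eq (sym (trans (+-congʳ (zeroˡ _)) (+-identityˡ _)))
    where open IsSubfield isF

  lc-++ : ∀ {m n} (k u : Fin m → Carrier) (k′ w : Fin n → Carrier) →
    lc (k ++ k′) (u ++ w) ≈ lc k u + lc k′ w
  lc-++ {zero}  k u k′ w = sym (+-identityˡ _)
  lc-++ {suc m} k u k′ w = trans
    (+-congˡ (trans (sum-cong-≋ split) (lc-++ (k ∘ suc) (u ∘ suc) k′ w)))
    (sym (+-assoc _ _ _))
    where
    split : ∀ i → (k ++ k′) (suc i) * (u ++ w) (suc i) ≈
      ((k ∘ suc) ++ k′) i * ((u ∘ suc) ++ w) i
    split i with Fin.splitAt m i
    ... | inj₁ _ = refl
    ... | inj₂ _ = refl

  ++-∈ : ∀ {f m n} {F : Pred Carrier f} {k : Fin m → Carrier} {k′ : Fin n → Carrier} →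
    (∀ i → k i ∈ F) → (∀ i → k′ i ∈ F) → ∀ i → (k ++ k′) i ∈ F
  ++-∈ {m = m} k∈F k′∈F i with Fin.splitAt m i
  ... | inj₁ j = k∈F j
  ... | inj₂ j = k′∈F j

  span-++ : ∀ {f m n} {F : Pred Carrier f} {u : Fin m → Carrier} {w : Fin n → Carrier} {x y} →
    x ∈ Span F u → y ∈ Span F w → x + y ∈ Span F (u ++ w)
  span-++ {F = F} {u} {w} (k , k∈F , x≈) (k′ , k′∈F , y≈) =
    k ++ k′ , ++-∈ {F = F} k∈F k′∈F , trans (+-cong x≈ y≈) (sym (lc-++ k u k′ w))

  span-*ʳ : ∀ {f n} {F : Pred Carrier f} {b : Fin n → Carrier} {x} y →
    x ∈ Span F b → x * y ∈ Span F (λ i → b i * y)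
  span-*ʳ {b = b} {x} y (k , k∈F , x≈) = k , k∈F , (begin
    x * y                       ≈⟨ trans (*-congʳ x≈) (*-comm _ y) ⟩
    y * lc k b                  ≈⟨ *-distribˡ-sum y (λ i → k i * b i) ⟩
    sum (λ i → y * (k i * b i)) ≈⟨ sum-cong-≋ (λ i → solve 3 (λ y k b → y :* (k :* b) := k :* (b :* y)) refl y (k i) (b i)) ⟩
    lc k (λ i → b i * y)        ∎)

  -- The family `u` collects the products of members of `w` and `b`. Only finiteness of extensions
  -- is tracked, so independence plays no part in the statement.
  tower : ∀ {f e m n} {F : Pred Carrier f} {E : Pred Carrier e} {w : Fin m → Carrier} →
    E ⊆ Span F w → (b : Fin n → Carrier) →
    ∃[ r ] Σ[ u ∈ (Fin r → Carrier) ] Span E b ⊆ Span F u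
  tower {n = zero}  E⊆ b = 0 , [] , λ (_ , _ , y≈) → [] , (λ ()) , y≈
  tower {n = suc n} {F = F} {E} E⊆ b =
    let r , u , ⊆u = tower {F = F} {E} E⊆ (b ∘ suc)
    in _ , _ , λ (k , k∈E , y≈) →
      let k′ , k′∈F , eq = span-++ {F = F} (span-*ʳ {F = F} (b zero) (E⊆ (k∈E zero)))
                                   (⊆u (k ∘ suc , k∈E ∘ suc , refl))
      in k′ , k′∈F , trans y≈ eq

  NontrivialIn : ∀ {f n} → Pred Carrier f → (Fin n → Carrier) → Set _
  NontrivialIn F k = (∀ i → k i ∈ F) × ∃[ i ] k i ≉ 0#

  module _ {f} {F : Pred Carrier f} (isF : IsSubfield F) where
    open IsSubfield isF

    -- Gaussian elimination, with `i` indexing unknowns and `j` equations. If equation zero is void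
    -- it is dropped; otherwise it eliminates one unknown `p`, and both numbers fall by one.
    underdetermined : ∀ {n m} (a : Fin m → Fin n → Carrier) → (∀ i j → a i j ∈ F) → n ℕ.< m →
      ∃[ k ] NontrivialIn F k × ∀ j → sum (λ i → k i * a i j) ≈ 0#
    underdetermined {zero} {suc m} a a∈F n<m = (λ _ → 1#) , ((λ _ → 1∈) , zero , 1≉0) , λ ()
    underdetermined {suc n} {suc m} a a∈F (s≤s n<m) with em {P = ∃[ p ] a p zero ≉ 0#}
    ... | no all0 =
      let k , k≢0 , eqs = underdetermined (λ i j → a i (suc j)) (λ i j → a∈F i (suc j)) (ℕ.m<n⇒m<1+n n<m)
      in k , k≢0 , λ where
        zero    → trans (sum-cong-≋ (λ i → *-comm (k i) (a i zero)))
                    (lc-0 k (λ i → ¬¬-elim (λ ≉0 → all0 (i , ≉0))))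
        (suc j) → eqs j
    ... | yes (p , ap≉0) = k , (k∈F , punchIn p (proj₁ (proj₂ k′≢0)) , k≉0) , eqs
      where
      row = a p
      ρ : Fin m → Carrier
      ρ i = a (punchIn p i) zero * row zero ⁻¹
      ρ∈F : ∀ i → ρ i ∈ F
      ρ∈F i = *∈ (a∈F _ _) (⁻¹∈ ap≉0 (a∈F _ _))
      a′ : Fin m → Fin n → Carrier
      a′ i j = a (punchIn p i) (suc j) - ρ i * row (suc j)
      rec = underdetermined a′ (λ i j → -∈ (a∈F _ _) (*∈ (ρ∈F i) (a∈F _ _))) n<m
      k′ = proj₁ rec
      k′≢0 = proj₁ (proj₂ rec)
      eqs′ = proj₂ (proj₂ rec)
      -- Equation zero, divided by the pivot, leaves only this value for the eliminated unknown.
      kp = - lc k′ ρ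
      k : Fin (suc m) → Carrier
      k = insertAt k′ p kp
      kp≡ : k p ≈ kp
      kp≡ = reflexive (insertAt-lookup k′ p kp)
      k≡ : ∀ i → k (punchIn p i) ≈ k′ i
      k≡ i = reflexive (insertAt-punchIn k′ p kp i)
      k∈F : ∀ i → k i ∈ F
      k∈F i with p Fin.≟ i
      ... | yes ≡.refl = resp∈ (sym kp≡) (neg∈ (sum∈ (λ i → *∈ (proj₁ k′≢0 i) (ρ∈F i))))
      ... | no p≢i = ≡.subst (λ i → k i ∈ F) (Fin.punchIn-punchOut p≢i)
                       (resp∈ (sym (k≡ _)) (proj₁ k′≢0 (Fin.punchOut p≢i)))
      k≉0 : k (punchIn p (proj₁ (proj₂ k′≢0))) ≉ 0#
      k≉0 eq = proj₂ (proj₂ k′≢0) (trans (sym (k≡ _)) eq)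
      expand : ∀ j → sum (λ i → k i * a i j) ≈ lc k′ (λ i → a (punchIn p i) j - ρ i * row j)
      expand j = begin
        sum (λ i → k i * a i j)
          ≈⟨ sum-remove {i = p} (λ i → k i * a i j) ⟩
        k p * row j + sum (λ i → k (punchIn p i) * a (punchIn p i) j)
          ≈⟨ +-cong (trans (*-congʳ kp≡) (*-comm _ _)) (sum-cong-≋ (λ i → *-congʳ (k≡ i))) ⟩
        row j * (- lc k′ ρ) + lc k′ (λ i → a (punchIn p i) j)
          ≈⟨ +-congʳ (trans (solve 2 (λ r s → r :* (:- s) := (:- r) :* s) refl (row j) (lc k′ ρ)) (*-distribˡ-sum (- row j) (λ i → k′ i * ρ i))) ⟩
        sum (λ i → - row j * (k′ i * ρ i)) + lc k′ (λ i → a (punchIn p i) j)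
          ≈⟨ sym (∑-distrib-+ (λ i → - row j * (k′ i * ρ i)) (λ i → k′ i * a (punchIn p i) j)) ⟩
        sum (λ i → - row j * (k′ i * ρ i) + k′ i * a (punchIn p i) j)
          ≈⟨ sum-cong-≋ (λ i → solve 4 (λ r k ρ a → (:- r) :* (k :* ρ) :+ k :* a := k :* (a :- ρ :* r)) refl (row j) (k′ i) (ρ i) (a (punchIn p i) j)) ⟩
        lc k′ (λ i → a (punchIn p i) j - ρ i * row j) ∎
      eqs : ∀ j → sum (λ i → k i * a i j) ≈ 0#
      eqs (suc j) = trans (expand (suc j)) (eqs′ j)
      eqs zero    = trans (expand zero) (trans (sum-cong-≋ (λ i → *-comm (k′ i) _))
        (lc-0 k′ (λ i → begin
          a (punchIn p i) zero - ρ i * row zero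
            ≈⟨ solve 3 (λ x i r → x :- x :* i :* r := x :- x :* (i :* r)) refl _ (row zero ⁻¹) (row zero) ⟩
          a (punchIn p i) zero - a (punchIn p i) zero * (row zero ⁻¹ * row zero)
            ≈⟨ +-congˡ (-‿cong (trans (*-congˡ (*-inverseˡ ap≉0)) (*-identityʳ _))) ⟩
          a (punchIn p i) zero - a (punchIn p i) zero
            ≈⟨ -‿inverseʳ _ ⟩
          0# ∎)))

    dependent : ∀ {n m} {b : Fin n → Carrier} {y : Fin m → Carrier} → (∀ i → y i ∈ Span F b) →
      n ℕ.< m → ∃[ k ] NontrivialIn F k × lc k y ≈ 0#
    dependent {b = b} {y} y∈ n<m =
      let a = λ i → proj₁ (y∈ i)
          k , k≢0 , eqs = underdetermined a (λ i → proj₁ (proj₂ (y∈ i))) n<m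
      in k , k≢0 , (begin
        sum (λ i → k i * y i)
          ≈⟨ sum-cong-≋ (λ i → *-congˡ (proj₂ (proj₂ (y∈ i)))) ⟩
        sum (λ i → k i * sum (λ j → a i j * b j))
          ≈⟨ sum-cong-≋ (λ i → *-distribˡ-sum (k i) (λ j → a i j * b j)) ⟩
        sum (λ i → sum (λ j → k i * (a i j * b j)))
          ≈⟨ ∑-comm (λ i j → k i * (a i j * b j)) ⟩
        sum (λ j → sum (λ i → k i * (a i j * b j)))
          ≈⟨ sum-cong-≋ (λ j → trans (sum-cong-≋ (λ i → solve 3 (λ k a b → k :* (a :* b) := b :* (k :* a)) refl (k i) (a i j) (b j)))
                                     (trans (sym (*-distribˡ-sum (b j) (λ i → k i * a i j))) (*-comm _ _))) ⟩
        lc (λ j → sum (λ i → k i * a i j)) b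
          ≈⟨ lc-0 b eqs ⟩
        0# ∎)

    -- Avoids forming quotients: `W` is the zero space for ordinary independence and `Ball e` for
    -- independence of residues in 𝔸/π𝔸.
    IndependentMod : ∀ {w n} → Pred Carrier w → (Fin n → Carrier) → Set _
    IndependentMod {n = n} W b = ∀ (k : Fin n → Carrier) → (∀ i → k i ∈ F) → lc k b ∈ W → ∀ i → k i ≈ 0#

    Independent : ∀ {n} → (Fin n → Carrier) → Set _
    Independent = IndependentMod (_≈ 0#)

    independent⇒≤ : ∀ {n m} {b : Fin n → Carrier} {y : Fin m → Carrier} → Independent y →
      (∀ i → y i ∈ Span F b) → m ℕ.≤ n
    independent⇒≤ {n} {m} ind y∈ with m ℕ.≤? n
    ... | yes m≤n = m≤n
    ... | no  m≰n = let k , (k∈F , i , ki≉0) , eq = dependent y∈ (ℕ.≰⇒> m≰n)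
                    in contradiction (ind k k∈F eq i) ki≉0

    SpanMod : ∀ {w n} → Pred Carrier w → (Fin n → Carrier) → Pred Carrier _
    SpanMod {n = n} W b x = Σ[ k ∈ (Fin n → Carrier) ] ((∀ i → k i ∈ F) × x - lc k b ∈ W)

    -- In a relation modulo `W` that violates independence of the longer family, the coefficient of
    -- `x` is nonzero, so the relation can be solved for `x`.
    span-or-extend : ∀ {w n} {W : Pred Carrier w} → IsSubspace F W → {b : Fin n → Carrier} →
      IndependentMod W b → ∀ x →
      SpanMod W b x ⊎ IndependentMod W (x ∷ b)
    span-or-extend {W = W} isW {b} ind x
      with em {P = SpanMod W b x}
    ... | yes x∈ = inj₁ x∈
    ... | no  x∉ = inj₂ extended
      where
      module W = IsSubspace isW
      extended : IndependentMod W (x ∷ b)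
      extended k k∈F eq with em {P = k zero ≈ 0#}
      ... | yes k₀≈0 = λ where
        zero    → k₀≈0
        (suc i) → ind (k ∘ suc) (k∈F ∘ suc)
          (W.resp∈ (trans (+-congʳ (trans (*-congʳ k₀≈0) (zeroˡ x))) (+-identityˡ _)) eq) i
      ... | no  k₀≉0 = contradiction
        ((λ i → - (k₀ ⁻¹) * k (suc i)) , (λ i → *∈ (neg∈ k₀⁻¹∈) (k∈F (suc i))) ,
         W.resp∈ (begin
           k₀ ⁻¹ * (k₀ * x + s)       ≈⟨ solve 4 (λ i k x s → i :* (k :* x :+ s) := i :* k :* x :- (:- i) :* s) refl (k₀ ⁻¹) k₀ x s ⟩
           k₀ ⁻¹ * k₀ * x - - (k₀ ⁻¹) * s ≈⟨ +-cong (trans (*-congʳ (*-inverseˡ k₀≉0)) (*-identityˡ x)) (-‿cong (sym (lc-scale (- (k₀ ⁻¹)) (k ∘ suc) b))) ⟩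
           x - lc (λ i → - (k₀ ⁻¹) * k (suc i)) b ∎)
           (W.scale∈ k₀⁻¹∈ eq)) x∉
        where
        k₀ = k zero
        k₀⁻¹∈ = ⁻¹∈ k₀≉0 (k∈F zero)
        s = lc (k ∘ suc) b

    0-isSubspace : IsSubspace F (_≈ 0#)
    0-isSubspace = record
      { resp∈ = λ x≈y x≈0 → trans (sym x≈y) x≈0 ; 0∈ = refl
      ; +∈ = λ x≈0 y≈0 → trans (+-cong x≈0 y≈0) (+-identityˡ 0#)
      ; scale∈ = λ _ x≈0 → trans (*-congˡ x≈0) (zeroʳ _) }

    []-independent : ∀ {w} {W : Pred Carrier w} → IndependentMod W []
    []-independent k k∈F eq ()

    -- Greedy extension. The invariant N ≤ fuel + n means that fuel is exhausted only when one more
    -- member would exceed the bound on independent families.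
    maximal-independent : ∀ {w e} {W : Pred Carrier w} {E : Pred Carrier e} → IsSubspace F W →
      ∀ N → (∀ {n} (b : Fin n → Carrier) → (∀ i → b i ∈ E) → IndependentMod W b → n ℕ.≤ N) →
      ∃[ n ] Σ[ b ∈ (Fin n → Carrier) ] ((∀ i → b i ∈ E) × IndependentMod W b ×
        E ⊆ SpanMod W b)
    maximal-independent {W = W} {E} isW N bound = go N [] (λ ()) ([]-independent {W = W}) (ℕ.≤-reflexive (≡.sym (ℕ.+-identityʳ N)))
      where
      go : ∀ fuel {n} (b : Fin n → Carrier) → (∀ i → b i ∈ E) → IndependentMod W b → N ℕ.≤ fuel ℕ.+ n →
        ∃[ d ] Σ[ b ∈ (Fin d → Carrier) ] ((∀ i → b i ∈ E) × IndependentMod W b × E ⊆ SpanMod W b)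
      go fuel {n} b b∈E ind N≤ with em {P = ∃[ x ] x ∈ E × IndependentMod W (x ∷ b)}
      ... | no ¬ext = n , b , b∈E , ind , λ {x} x∈E →
              fromInj₁ (λ ext → contradiction (x , x∈E , ext) ¬ext) (span-or-extend isW ind x)
      go zero b b∈E ind N≤ | yes (x , x∈E , ext) =
        contradiction (bound (x ∷ b) (λ { zero → x∈E ; (suc i) → b∈E i }) ext) (ℕ.<⇒≱ (s≤s N≤))
      go (suc fuel) b b∈E ind N≤ | yes (x , x∈E , ext) =
        go fuel (x ∷ b) (λ { zero → x∈E ; (suc i) → b∈E i }) ext
          (ℕ.≤-trans N≤ (ℕ.≤-reflexive (≡.sym (ℕ.+-suc fuel _))))

    basis-exists : ∀ {e n} {E : Pred Carrier e} {b : Fin n → Carrier} → E ⊆ Span F b →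
      ∃[ d ] Σ[ b ∈ (Fin d → Carrier) ] IsBasis L E F b
    basis-exists {n = n} E⊆ =
      let d , b , b∈E , ind , spans = maximal-independent 0-isSubspace n (λ b b∈E ind → independent⇒≤ ind (λ i → E⊆ (b∈E i)))
      in d , b , b∈E , ind , λ x x∈E → let k , k∈F , eq = spans x∈E in k , k∈F , x-y≈0⇒x≈y _ _ eq

-- Values of polynomials, fractions and algebraic elements

module Polynomials (em : ∀ {a} → ExcludedMiddle a) {c ℓ} (L : Field c ℓ) where
  open Field L hiding (zero)
  open FieldTheory em L
  open Sum semiring using (sum-cong-≋; *-distribˡ-sum)
  open import Relation.Binary.Reasoning.Setoid setoid

  -- These are field elements a₀ + a₁ t + ... of length n in Horner form, not formal polynomials.
  -- `S` is not assumed to be a ring: it is later also a span of ω, or a set of polynomials in a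
  -- second element.
  data Poly {s} (S : Pred Carrier s) (t : Carrier) : ℕ → Pred Carrier (c ⊔ ℓ ⊔ s) where
    nil  : ∀ {p} → p ≈ 0# → Poly S t 0 p
    cons : ∀ {n a p′ p} → a ∈ S → p′ ∈ Poly S t n → p ≈ a + t * p′ → Poly S t (suc n) p

  Polynomial : ∀ {s} → Pred Carrier s → Carrier → Pred Carrier (c ⊔ ℓ ⊔ s)
  Polynomial S t p = ∃[ n ] p ∈ Poly S t n

  poly-resp : ∀ {s} {S : Pred Carrier s} {t n p q} → p ≈ q → p ∈ Poly S t n → q ∈ Poly S t n
  poly-resp p≈q (nil p≈0)     = nil (trans (sym p≈q) p≈0)
  poly-resp p≈q (cons a p′ e) = cons a p′ (trans (sym p≈q) e)

  poly-map : ∀ {s s′} {S : Pred Carrier s} {S′ : Pred Carrier s′} {t n p} q →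
    (∀ {a} → a ∈ S → q * a ∈ S′) → p ∈ Poly S t n → q * p ∈ Poly S′ t n
  poly-map q f (nil p≈0) = nil (trans (*-congˡ p≈0) (zeroʳ q))
  poly-map {t = t} q f (cons {a = a} {p′} a∈S p′∈ e) = cons (f a∈S) (poly-map q f p′∈)
    (trans (*-congˡ e) (solve 4 (λ q a t p → q :* (a :+ t :* p) := q :* a :+ t :* (q :* p)) refl q a t p′))

  poly-mono : ∀ {s s′} {S : Pred Carrier s} {S′ : Pred Carrier s′} {t n} →
    S ⊆ S′ → Poly S t n ⊆ Poly S′ t n
  poly-mono S⊆ (nil e)       = nil e
  poly-mono S⊆ (cons a p′ e) = cons (S⊆ a) (poly-mono S⊆ p′) e

  poly-0 : ∀ {s} {S : Pred Carrier s} {t n p} → (∀ {a} → a ∈ S → a ≈ 0#) → p ∈ Poly S t n → p ≈ 0#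
  poly-0 S≈0 (nil e) = e
  poly-0 {t = t} S≈0 (cons a∈S p′∈ e) =
    trans e (trans (+-cong (S≈0 a∈S) (trans (*-congˡ (poly-0 S≈0 p′∈)) (zeroʳ t))) (+-identityˡ 0#))

  module _ {f s} {F : Pred Carrier f} {S : Pred Carrier s} (isS : IsSubspace F S) where
    private module S = IsSubspace isS

    0∈poly : ∀ {t} n → 0# ∈ Poly S t n
    0∈poly zero    = nil refl
    0∈poly (suc n) = cons S.0∈ (0∈poly n) (sym (trans (+-identityˡ _) (zeroʳ _)))

    poly-≤ : ∀ {t m n} → m ℕ.≤ n → Poly S t m ⊆ Poly S t n
    poly-≤ z≤n       (nil e)       = poly-resp (sym e) (0∈poly _)
    poly-≤ (s≤s m≤n) (cons a p′ e) = cons a (poly-≤ m≤n p′) e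

    poly-+ : ∀ {t n p q} → p ∈ Poly S t n → q ∈ Poly S t n → p + q ∈ Poly S t n
    poly-+ (nil e) (nil e′) = nil (trans (+-cong e e′) (+-identityˡ 0#))
    poly-+ {t} (cons {a = a} {p} a∈ p∈ e) (cons {a = b} {q} b∈ q∈ e′) =
      cons (S.+∈ a∈ b∈) (poly-+ p∈ q∈) (trans (+-cong e e′)
        (solve 5 (λ a p b q t → a :+ t :* p :+ (b :+ t :* q) := a :+ b :+ t :* (p :+ q)) refl a p b q t))

    poly-isSubspace : ∀ {t n} → IsSubspace F (Poly S t n)
    poly-isSubspace {n = n} = record
      { resp∈ = poly-resp ; 0∈ = 0∈poly n ; +∈ = poly-+
      ; scale∈ = λ {a} a∈F → poly-map a (S.scale∈ a∈F) }

    poly-shift : ∀ {t n p} → p ∈ Poly S t n → t * p ∈ Poly S t (suc n)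
    poly-shift p∈ = cons S.0∈ p∈ (sym (+-identityˡ _))

    poly-const : ∀ {t n a} → a ∈ S → a ∈ Poly S t (suc n)
    poly-const {t} {n} {a} a∈ = cons a∈ (0∈poly n) (sym (trans (+-congˡ (zeroʳ t)) (+-identityʳ a)))

    poly-* : ∀ {t m n p q} → p ∈ Poly F t m → q ∈ Poly S t n → p * q ∈ Poly S t (m ℕ.+ n)
    poly-* {n = n} (nil e) q∈ = poly-resp (sym (trans (*-congʳ e) (zeroˡ _))) (0∈poly n)
    poly-* {t} {suc m} {n} {q = q} (cons {a = a} {p} a∈ p∈ e) q∈ = poly-resp
      (trans (solve 4 (λ a t p q → a :* q :+ t :* (p :* q) := (a :+ t :* p) :* q) refl a t p q) (*-congʳ (sym e)))
      (poly-+ (poly-≤ (ℕ.m≤n+m n (suc m)) (poly-map a (S.scale∈ a∈) q∈)) (poly-shift (poly-* p∈ q∈)))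

    poly-eval : ∀ {e} {E : Pred Carrier e} {t n} → IsSubspace F E → S ⊆ E →
      (∀ {x} → x ∈ E → t * x ∈ E) → Poly S t n ⊆ E
    poly-eval isE S⊆E t* (nil e) = IsSubspace.resp∈ isE (sym e) (IsSubspace.0∈ isE)
    poly-eval isE S⊆E t* (cons a∈ p∈ e) = IsSubspace.resp∈ isE (sym e)
      (IsSubspace.+∈ isE (S⊆E a∈) (t* (poly-eval isE S⊆E t* p∈)))

    polynomial-isSubspace : ∀ {t} → IsSubspace F (Polynomial S t)
    polynomial-isSubspace = record
      { resp∈ = λ x≈y (n , x∈) → n , poly-resp x≈y x∈
      ; 0∈ = 0 , nil refl
      ; +∈ = λ (m , x∈) (n , y∈) → m ℕ.+ n , poly-+ (poly-≤ (ℕ.m≤m+n m n) x∈) (poly-≤ (ℕ.m≤n+m n m) y∈)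
      ; scale∈ = λ {a} a∈ (n , x∈) → n , poly-map a (S.scale∈ a∈) x∈ }

    polynomial-* : ∀ {t p q} → p ∈ Polynomial F t → q ∈ Polynomial S t → p * q ∈ Polynomial S t
    polynomial-* (m , p∈) (n , q∈) = m ℕ.+ n , poly-* p∈ q∈

  -- For `S` = `F` this is the field F(t); in general it is the module S[t] with the nonzero
  -- elements of F[t] inverted.
  Fractional : ∀ {f s} → Pred Carrier f → Pred Carrier s → Carrier → Pred Carrier _
  Fractional F S t x = ∃[ q ] q ∈ Polynomial F t × q ≉ 0# × q * x ∈ Polynomial S t

  module _ {f} {F : Pred Carrier f} (isF : IsSubfield F) where
    open IsSubfield isF
    private
      F-subspace : IsSubspace F F
      F-subspace = subfield⇒subspace {F = F} id isF

    1∈polynomial : ∀ {t} → 1# ∈ Polynomial F t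
    1∈polynomial = 1 , poly-const F-subspace 1∈

    t∈polynomial : ∀ {t} → t ∈ Polynomial F t
    t∈polynomial {t} = 2 , poly-resp (*-identityʳ t) (poly-shift F-subspace (poly-const F-subspace 1∈))

    polynomial⊆fractional : ∀ {s} {S : Pred Carrier s} {t} → Polynomial S t ⊆ Fractional F S t
    polynomial⊆fractional (n , x∈) = 1# , 1∈polynomial , 1≉0 , n , poly-resp (sym (*-identityˡ _)) x∈

    module _ {s} {S : Pred Carrier s} (isS : IsSubspace F S) {t : Carrier} where
      private
        module P = IsSubspace (polynomial-isSubspace isS {t})

      fractional-+ : ∀ {x y} → x ∈ Fractional F S t → y ∈ Fractional F S t → x + y ∈ Fractional F S t
      fractional-+ {x} {y} (q , q∈ , q≉0 , qx∈) (r , r∈ , r≉0 , ry∈) =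
        q * r , polynomial-* F-subspace q∈ r∈ , *-≉0 q≉0 r≉0 ,
        P.resp∈ (solve 4 (λ q r x y → r :* (q :* x) :+ q :* (r :* y) := q :* r :* (x :+ y)) refl q r x y)
          (P.+∈ (polynomial-* isS r∈ qx∈) (polynomial-* isS q∈ ry∈))

      fractional-* : ∀ {a x} → a ∈ Fractional F F t → x ∈ Fractional F S t → a * x ∈ Fractional F S t
      fractional-* {a} {x} (q , q∈ , q≉0 , qa∈) (r , r∈ , r≉0 , rx∈) =
        q * r , polynomial-* F-subspace q∈ r∈ , *-≉0 q≉0 r≉0 ,
        P.resp∈ (solve 4 (λ q r a x → q :* a :* (r :* x) := q :* r :* (a :* x)) refl q r a x)
          (polynomial-* isS qa∈ rx∈)

      fractional-resp : ∀ {x y} → x ≈ y → x ∈ Fractional F S t → y ∈ Fractional F S t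
      fractional-resp x≈y (q , q∈ , q≉0 , qx∈) = q , q∈ , q≉0 , P.resp∈ (*-congˡ x≈y) qx∈

    fractional-isSubfield : ∀ {t} → IsSubfield (Fractional F F t)
    fractional-isSubfield {t} = record
      { resp∈ = fractional-resp F-subspace
      ; 0∈    = polynomial⊆fractional P.0∈
      ; 1∈    = polynomial⊆fractional 1∈polynomial
      ; +∈    = fractional-+ F-subspace
      ; neg∈  = λ {x} (q , q∈ , q≉0 , qx∈) → q , q∈ , q≉0 ,
          P.resp∈ (-‿distribʳ-* q x) (subspace-neg isF (polynomial-isSubspace F-subspace) qx∈)
      ; *∈    = fractional-* F-subspace
      ; ⁻¹∈   = λ {x} x≉0 (q , q∈ , q≉0 , qx∈) → q * x , qx∈ , *-≉0 q≉0 x≉0 ,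
          P.resp∈ (trans (sym (*-identityʳ q)) (trans (*-congˡ (sym (*-inverseʳ x x≉0))) (sym (*-assoc q x _)))) q∈ }
      where module P = IsSubspace (polynomial-isSubspace F-subspace {t})

    adjoin-isSubfield : ∀ {t} → IsSubfield (Adjoin L F t)
    adjoin-isSubfield = generated-isSubfield

    F⊆adjoin : ∀ {t} → F ⊆ Adjoin L F t
    F⊆adjoin a∈F = gen (inj₁ a∈F)

    t∈adjoin : ∀ {t} → t ∈ Adjoin L F t
    t∈adjoin = gen (inj₂ refl)

    polynomial⊆ : ∀ {e} {E : Pred Carrier e} {t} → IsSubfield E → F ⊆ E → t ∈ E → Polynomial F t ⊆ E
    polynomial⊆ isE F⊆E t∈E (n , p∈) =
      poly-eval F-subspace (subfield⇒subspace F⊆E isE) F⊆E (IsSubfield.*∈ isE t∈E) p∈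

    adjoin⊆fractional : ∀ {t} → Adjoin L F t ⊆ Fractional F F t
    adjoin⊆fractional {t} = generated-least fractional-isSubfield λ where
      (inj₁ a∈F) → polynomial⊆fractional (1 , poly-const F-subspace a∈F)
      (inj₂ x≈t) → polynomial⊆fractional (IsSubspace.resp∈ (polynomial-isSubspace F-subspace) (sym x≈t) t∈polynomial)

    -- A relation is split into its constant term d and the rest t p: nontriviality is
    -- then a statement about the values d and p instead of the coefficients.
    Trans : Carrier → Set _
    Trans t = ∀ {d n p} → d ∈ F → p ∈ Poly F t n → d + t * p ≈ 0# → d ≈ 0# × p ≈ 0#

    Alg : Carrier → Set _
    Alg t = ∃[ d ] ∃[ p ] d ∈ F × p ∈ Polynomial F t × d + t * p ≈ 0# × ¬ (d ≈ 0# × p ≈ 0#)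

    ¬trans⇒alg : ∀ {t} → ¬ Trans t → Alg t
    ¬trans⇒alg ¬tr = ¬¬-elim λ ¬alg → ¬tr λ d∈ p∈ eq → ¬¬-elim λ ≉0 → ¬alg (_ , _ , d∈ , (_ , p∈) , eq , ≉0)

    leading-term : ∀ {t n p} → p ∈ Poly F t n →
      p ≈ 0# ⊎ ∃[ m ] ∃[ a ] a ∈ F × a ≉ 0# × p - a * t ^ m ∈ Poly F t m
    leading-term (nil e) = inj₁ e
    leading-term {t} (cons {a = a} {p′} {p} a∈ p′∈ e) with leading-term p′∈
    ... | inj₂ (m , b , b∈ , b≉0 , r∈) = inj₂ (suc m , b , b∈ , b≉0 , cons a∈ r∈
            (trans (+-congʳ e) (solve 5 (λ a t p b u → a :+ t :* p :- b :* (t :* u) := a :+ t :* (p :- b :* u)) refl a t p′ b (t ^ m))))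
    ... | inj₁ p′≈0 with em {P = a ≈ 0#}
    ...   | yes a≈0 = inj₁ (trans e (trans (+-cong a≈0 (trans (*-congˡ p′≈0) (zeroʳ t))) (+-identityˡ 0#)))
    ...   | no  a≉0 = inj₂ (0 , a , a∈ , a≉0 , nil (trans (+-cong (trans e (trans (+-congˡ (trans (*-congˡ p′≈0) (zeroʳ t))) (+-identityʳ a))) (-‿cong (*-identityʳ a))) (-‿inverseʳ a)))

    -- Dividing d + t p = 0 by the leading coefficient of `p` gives a monic equation. Were `p` zero,
    -- `d` would vanish too.
    alg⇒integral : ∀ {t} → Alg t → ∃[ m ] t ^ m ∈ Poly F t m
    alg⇒integral {t} (d , p , d∈ , (n , p∈) , eq , ≉0) with leading-term p∈
    ... | inj₁ p≈0 = contradiction (trans (sym (trans (+-congˡ (trans (*-congˡ p≈0) (zeroʳ t))) (+-identityʳ d))) eq , p≈0) ≉0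
    ... | inj₂ (m , a , a∈ , a≉0 , r∈) = suc m , poly-resp
            (begin
              - (a ⁻¹) * (d + t * (p - a * t ^ m))
                ≈⟨ solve 6 (λ i d t p a u → (:- i) :* (d :+ t :* (p :- a :* u)) := (i :* a) :* (t :* u) :- i :* (d :+ t :* p)) refl (a ⁻¹) d t p a (t ^ m) ⟩
              a ⁻¹ * a * t ^ suc m - a ⁻¹ * (d + t * p)
                ≈⟨ +-cong (trans (*-congʳ (*-inverseˡ a≉0)) (*-identityˡ _)) (trans (-‿cong (trans (*-congˡ eq) (zeroʳ _))) -0#≈0#) ⟩
              t ^ suc m + 0#
                ≈⟨ +-identityʳ _ ⟩
              t ^ suc m ∎)
            (poly-map (- (a ⁻¹)) (*∈ (neg∈ (⁻¹∈ a≉0 a∈))) (cons d∈ r∈ refl))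

    split-top : ∀ {t} m {p} → p ∈ Poly F t (suc m) → ∃[ a ] a ∈ F × p - a * t ^ m ∈ Poly F t m
    split-top zero (cons {a = a} a∈ (nil e′) e) = a , a∈ , nil
      (trans (+-cong (trans e (trans (+-congˡ (trans (*-congˡ e′) (zeroʳ _))) (+-identityʳ a))) (-‿cong (*-identityʳ a))) (-‿inverseʳ a))
    split-top {t} (suc m) (cons {a = a} {p′} a∈ p′∈ e) =
      let b , b∈ , r∈ = split-top m p′∈
      in b , b∈ , cons a∈ r∈
            (trans (+-congʳ e) (solve 5 (λ a t p b u → a :+ t :* p :- b :* (t :* u) := a :+ t :* (p :- b :* u)) refl a t p′ b (t ^ m)))

    -- Multiplication by `t` creates one term of degree `m`, which the monic equation rewrites in
    -- lower degrees.
    integral⇒shift : ∀ {t m p} → t ^ m ∈ Poly F t m → p ∈ Poly F t m → t * p ∈ Poly F t m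
    integral⇒shift {t} {m} {p} int p∈ =
      let a , a∈ , r∈ = split-top m (poly-shift F-subspace p∈)
      in poly-resp (solve 2 (λ x y → x :- y :+ y := x) refl (t * p) (a * t ^ m))
           (poly-+ F-subspace r∈ (poly-map a (*∈ a∈) int))

    integral⇒polynomial⊆ : ∀ {t m} → t ^ m ∈ Poly F t m → Polynomial F t ⊆ Poly F t m
    integral⇒polynomial⊆ {t} {zero}  (nil 1≈0) = contradiction 1≈0 1≉0
    integral⇒polynomial⊆ {t} {suc m} int (n , p∈) =
      poly-eval F-subspace (poly-isSubspace F-subspace) (poly-const F-subspace) (integral⇒shift int) p∈

    powers : ∀ n → Carrier → Fin n → Carrier
    powers n t i = t ^ toℕ i

    lc-powers : ∀ {n} t (k : Fin (suc n) → Carrier) →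
      lc k (powers (suc n) t) ≈ k zero + t * lc (k ∘ suc) (powers n t)
    lc-powers {n} t k = +-cong (*-identityʳ _) (trans
      (sum-cong-≋ (λ i → solve 3 (λ k t u → k :* (t :* u) := t :* (k :* u)) refl (k (suc i)) t (t ^ toℕ i)))
      (sym (*-distribˡ-sum t (λ i → k (suc i) * t ^ toℕ i))))

    poly⊆span : ∀ {t n} → Poly F t n ⊆ Span F (powers n t)
    poly⊆span (nil e) = [] , (λ ()) , e
    poly⊆span {t} (cons {a = a} a∈ p∈ e) =
      let k , k∈ , p≈ = poly⊆span p∈
      in a ∷ k , (λ { zero → a∈ ; (suc i) → k∈ i }) ,
         trans e (trans (+-congˡ (*-congˡ p≈)) (sym (lc-powers t (a ∷ k))))

    lc-powers∈poly : ∀ {n t} (k : Fin n → Carrier) → (∀ i → k i ∈ F) → lc k (powers n t) ∈ Poly F t n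
    lc-powers∈poly {zero}  k k∈ = nil refl
    lc-powers∈poly {suc n} {t} k k∈ = cons (k∈ zero) (lc-powers∈poly (k ∘ suc) (k∈ ∘ suc)) (lc-powers t k)

    trans⇒powers-independent : ∀ {t} → Trans t → ∀ {n} → Independent isF (powers n t)
    trans⇒powers-independent {t} tr {suc n} k k∈ eq
      with k₀≈0 , rest≈0 ← tr (k∈ zero) (lc-powers∈poly (k ∘ suc) (k∈ ∘ suc)) (trans (sym (lc-powers t k)) eq) = λ where
      zero    → k₀≈0
      (suc i) → trans⇒powers-independent tr (k ∘ suc) (k∈ ∘ suc) rest≈0 i

    -- If `t` were transcendental, its first n + 1 powers would be independent inside the span of n
    -- elements.
    finite⇒alg : ∀ {n t} {b : Fin n → Carrier} → (∀ i → t ^ i ∈ Span F b) → Alg t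
    finite⇒alg {n} t^∈ = ¬trans⇒alg λ tr → contradiction
      (independent⇒≤ isF (trans⇒powers-independent tr {suc n}) (λ i → t^∈ (toℕ i))) ℕ.1+n≰n

    alg⇒⁻¹∈polynomial : ∀ {t} → t ≉ 0# → Alg t → t ⁻¹ ∈ Polynomial F t
    alg⇒⁻¹∈polynomial {t} t≉0 (d , p , d∈ , p∈ , eq , ≉0) =
      IsSubspace.resp∈ (polynomial-isSubspace F-subspace) (sym (⁻¹-unique (begin
        t * (- (d ⁻¹) * p)
          ≈⟨ solve 4 (λ t i p d → t :* ((:- i) :* p) := (i :* d) :- i :* (d :+ t :* p)) refl t (d ⁻¹) p d ⟩
        d ⁻¹ * d - d ⁻¹ * (d + t * p)
          ≈⟨ +-cong (*-inverseˡ d≉0) (trans (-‿cong (trans (*-congˡ eq) (zeroʳ _))) -0#≈0#) ⟩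
        1# + 0#
          ≈⟨ +-identityʳ 1# ⟩
        1# ∎)))
        (IsSubspace.scale∈ (polynomial-isSubspace F-subspace) (neg∈ (⁻¹∈ d≉0 d∈)) p∈)
      where
      -- Nontriviality concerns the values `d` and `p`: d = 0 forces t p = 0 and hence p = 0. No
      -- minimal polynomial has to be chosen.
      d≉0 : d ≉ 0#
      d≉0 d≈0 = ≉0 (d≈0 , x*y≈0⇒y≈0 t≉0 (trans (sym (trans (+-congʳ d≈0) (+-identityˡ _))) eq))

    -- F[t] is already a field: the powers of a nonzero x in it stay in a finite span, so x is
    -- algebraic and its inverse is a polynomial in x.
    adjoin-integral : ∀ {t m} → t ^ m ∈ Poly F t m → Adjoin L F t ⊆ Poly F t m
    adjoin-integral {t} {m} int = generated-least isV λ where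
        (inj₁ a∈F) → ⊆V (1 , poly-const F-subspace a∈F)
        (inj₂ x≈t) → poly-resp (sym x≈t) (⊆V t∈polynomial)
      where
      V = Poly F t m
      ⊆V : Polynomial F t ⊆ V
      ⊆V = integral⇒polynomial⊆ int
      V* : ∀ {x y} → x ∈ V → y ∈ V → x * y ∈ V
      V* x∈ y∈ = ⊆V (m ℕ.+ m , poly-* F-subspace x∈ y∈)
      V^ : ∀ {x} n → x ∈ V → x ^ n ∈ V
      V^ zero    x∈ = ⊆V 1∈polynomial
      V^ (suc n) x∈ = V* x∈ (V^ n x∈)
      isV : IsSubfield V
      isV = record
        { resp∈ = poly-resp ; 0∈ = 0∈poly F-subspace m ; 1∈ = ⊆V 1∈polynomial
        ; +∈ = poly-+ F-subspace ; neg∈ = subspace-neg isF (poly-isSubspace F-subspace) ; *∈ = V*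
        ; ⁻¹∈ = λ x≉0 x∈ →
            let n , x⁻¹∈ = alg⇒⁻¹∈polynomial x≉0 (finite⇒alg (λ i → poly⊆span (V^ i x∈)))
            in poly-eval F-subspace (poly-isSubspace F-subspace)
                 (λ a∈F → ⊆V (1 , poly-const F-subspace a∈F)) (V* x∈) x⁻¹∈ }

    adjoin-alg⊆span : ∀ {t} → Alg t → ∃[ n ] Σ[ b ∈ (Fin n → Carrier) ] Adjoin L F t ⊆ Span F b
    adjoin-alg⊆span {t} alg =
      let m , int = alg⇒integral alg
      in m , powers m t , λ x∈ → poly⊆span (adjoin-integral int x∈)

-- Finite sets, algebraic elements and the exchange property

module Algebraicity (em : ∀ {a} → ExcludedMiddle a) {c ℓ} (L : Field c ℓ) where
  open Field L hiding (zero)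
  open FieldTheory em L
  open Polynomials em L
  open SemiringMult semiring using (×-homo-+; ×1-homo-*; ×-congˡ)
  open import Relation.Binary.Reasoning.Setoid setoid

  -- Finite sets

  -- A covering list whose entries may repeat or lie outside `S`. This suffices for the pigeonhole
  -- principle and passes easily to spans and images.
  Finite : ∀ {s} → Pred Carrier s → Set _
  Finite S = ∃[ n ] Σ[ e ∈ (Fin n → Carrier) ] (∀ x → x ∈ S → ∃[ i ] e i ≈ x)

  finite-pigeonhole : ∀ {s} {S : Pred Carrier s} → Finite S → (f : ℕ → Carrier) → (∀ n → f n ∈ S) →
    ∃₂ λ i j → i ℕ.< j × f i ≈ f j
  finite-pigeonhole (n , e , cover) f f∈S =
    let g = λ (i : Fin (suc n)) → proj₁ (cover (f (toℕ i)) (f∈S _))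
        i , j , i<j , gi≡gj = Fin.pigeonhole (ℕ.n<1+n n) g
        eq = λ (i : Fin (suc n)) → proj₂ (cover (f (toℕ i)) (f∈S _))
    in toℕ i , toℕ j , i<j , trans (sym (eq i)) (trans (reflexive (≡.cong e gi≡gj)) (eq j))

  finite-map₂ : ∀ {s t u} {S : Pred Carrier s} {T : Pred Carrier t} {V : Pred Carrier u} →
    (f : Carrier → Carrier → Carrier) → (∀ {x x′ y y′} → x ≈ x′ → y ≈ y′ → f x y ≈ f x′ y′) →
    (∀ z → z ∈ V → ∃₂ λ x y → x ∈ S × y ∈ T × z ≈ f x y) → Finite S → Finite T → Finite V
  finite-map₂ f f-cong V⊆ (m , d , coverS) (n , e , coverT) =
    m ℕ.* n , (λ i → g (Fin.remQuot n i)) , λ z z∈V →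
      let x , y , x∈S , y∈T , z≈ = V⊆ z z∈V
          i , di≈x = coverS x x∈S
          j , ej≈y = coverT y y∈T
      in Fin.combine i j , trans (reflexive (≡.cong g (Fin.remQuot-combine i j)))
                                 (trans (f-cong di≈x ej≈y) (sym z≈))
    where
    g : Fin m × Fin n → Carrier
    g (i , j) = f (d i) (e j)

  finite-0 : ∀ {s} {S : Pred Carrier s} → (∀ x → x ∈ S → x ≈ 0#) → Finite S
  finite-0 S≈0 = 1 , (λ _ → 0#) , λ x x∈S → zero , sym (S≈0 x x∈S)

  finite-poly : ∀ {s} {S : Pred Carrier s} {t} → Finite S → ∀ n → Finite (Poly S t n)
  finite-poly fin zero = finite-0 λ { x (nil x≈0) → x≈0 }
  finite-poly {t = t} fin (suc n) = finite-map₂ (λ a p → a + t * p) (λ a≈ p≈ → +-cong a≈ (*-congˡ p≈))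
    (λ { z (cons a∈ p∈ e) → _ , _ , a∈ , p∈ , e }) fin (finite-poly fin n)

  finite-span : ∀ {f n} {F : Pred Carrier f} (b : Fin n → Carrier) → Finite F → Finite (Span F b)
  finite-span {n = zero} b fin = finite-0 λ x (_ , _ , x≈0) → x≈0
  finite-span {n = suc n} {F} b fin = finite-map₂ {S = F} {T = Span F (b ∘ suc)}
    (λ a x → a * b zero + x) (λ a≈ x≈ → +-cong (*-congʳ a≈) x≈)
    (λ z (k , k∈ , z≈) → k zero , lc (k ∘ suc) (b ∘ suc) , k∈ zero , (k ∘ suc , k∈ ∘ suc , refl) , z≈)
    fin (finite-span (b ∘ suc) fin)

  -- A directed family that covers a finite set pointwise has one member containing all of it. It
  -- serves to find a common bound for coordinates and a common denominator for the digits.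
  finite-uniform : ∀ {s i t} {S : Pred Carrier s} {I : Set i} (P : I → Pred Carrier t) → Finite S → I →
    (∀ i j → ∃[ k ] P i ⊆ P k × P j ⊆ P k) → (∀ {i x y} → x ≈ y → x ∈ P i → y ∈ P i) →
    (∀ {x} → x ∈ S → ∃[ i ] x ∈ P i) → ∃[ i ] S ⊆ P i
  finite-uniform {I = I} P (n , enum , cover) i₀ join resp∈ S⊆ =
    let i , all = go enum
    in i , λ {x} x∈ → let j , eq = cover x x∈ in
      resp∈ eq (all j (let i′ , x∈i′ = S⊆ x∈ in i′ , resp∈ (sym eq) x∈i′))
    where
    -- A listed element may lie outside `S` and hence in no `P i′`, so membership is required only
    -- of those that lie in some member of the family.
    go : ∀ {n} (enum : Fin n → Carrier) → ∃[ i ] ∀ j → ∃[ i′ ] enum j ∈ P i′ → enum j ∈ P i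
    go {zero} enum = i₀ , λ ()
    go {suc n} enum with go (enum ∘ suc) | em {P = ∃[ i′ ] enum zero ∈ P i′}
    ... | i , all | no none = i , λ { zero some → contradiction some none ; (suc j) → all j }
    ... | i , all | yes (i′ , in-i′) = let j , i⊆ , i′⊆ = join i i′
      in j , λ { zero _ → i′⊆ in-i′ ; (suc j) some → i⊆ (all j some) }

  finite-image : ∀ {s t r} {S : Pred Carrier s} {T : Pred Carrier t} (ρ : Carrier → Carrier → Set r) →
    (∀ {x x′ y} → x ≈ x′ → ρ x y → ρ x′ y) → (∀ {x y y′} → y ∈ T → y′ ∈ T → ρ x y → ρ x y′ → y ≈ y′) →
    (∀ {y} → y ∈ T → ∃[ x ] x ∈ S × ρ x y) → Finite S → Finite T
  finite-image {T = T} ρ ρ-resp ρ-unique onto (n , enum , cover) =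
    n , (λ i → choose i em) , λ y y∈ →
      let x , x∈ , ρxy = onto y∈
          i , eq = cover x x∈
      in i , chosen i em y∈ (ρ-resp (sym eq) ρxy)
    where
    choose : ∀ i → Dec (∃[ y ] y ∈ T × ρ (enum i) y) → Carrier
    choose i (yes (y , _)) = y
    choose i (no _)        = 0#
    chosen : ∀ i d {y} → y ∈ T → ρ (enum i) y → choose i d ≈ y
    chosen i (yes (_ , y′∈ , ρ′)) y∈ ρy = ρ-unique y′∈ y∈ ρ′ ρy
    chosen i (no none)            y∈ ρy = contradiction (_ , y∈ , ρy) none

  torsion : ∀ {s} {S : Pred Carrier s} → Finite S → ∀ {x} → (∀ n → x ^ n ∈ S) → x ≉ 0# →
    ∃[ n ] x ^ suc n ≈ 1#
  torsion fin {x} x^∈ x≉0 =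
    let i , j , i<j , eq = finite-pigeonhole fin (x ^_) x^∈
        d , i+1+d≡j = ℕ.m≤n⇒∃[o]m+o≡n i<j
    in d , *-cancelˡ (^-≉0 i x≉0) (begin
         x ^ i * x ^ suc d ≈⟨ sym (^-homo-* x i (suc d)) ⟩
         x ^ (i ℕ.+ suc d) ≈⟨ reflexive (≡.cong (x ^_) (≡.trans (ℕ.+-suc i d) i+1+d≡j)) ⟩
         x ^ j             ≈⟨ sym eq ⟩
         x ^ i             ≈⟨ sym (*-identityʳ _) ⟩
         x ^ i * 1#        ∎)

  primeField-isSubfield : ∀ p → .{{NonZero p}} → p · 1# ≈ 0# → IsSubfield (PrimeField L)
  primeField-isSubfield p@(suc p-1) p·1≈0 = record
    { resp∈ = P-resp
    ; 0∈ = 0 , refl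
    ; 1∈ = 1 , sym (+-identityʳ 1#)
    ; +∈ = λ (m , x≈) (n , y≈) → m ℕ.+ n , trans (+-cong x≈ y≈) (sym (×-homo-+ 1# m n))
    ; neg∈ = λ (n , x≈) → p-1 ℕ.* n , neg n x≈
    ; *∈ = mul
    -- A nonzero element has finite multiplicative order, so its inverse is one of its powers.
    ; ⁻¹∈ = λ {x} x≉0 x∈ → let n , eq = torsion finite (pow x∈) x≉0
                           in P-resp (sym (⁻¹-unique eq)) (pow x∈ n) }
    where
    P = PrimeField L
    P-resp : ∀ {x y} → x ≈ y → x ∈ P → y ∈ P
    P-resp x≈y (n , x≈) = n , trans (sym x≈y) x≈
    mul : ∀ {x y} → x ∈ P → y ∈ P → x * y ∈ P
    mul (m , x≈) (n , y≈) = m ℕ.* n , trans (*-cong x≈ y≈) (sym (×1-homo-* m n))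
    pow : ∀ {x} → x ∈ P → ∀ n → x ^ n ∈ P
    pow x∈ zero    = 1 , sym (+-identityʳ 1#)
    pow x∈ (suc n) = mul x∈ (pow x∈ n)
    p*n≈0 : ∀ n → (n ℕ.* p) · 1# ≈ 0#
    p*n≈0 n = trans (×1-homo-* n p) (trans (*-congˡ p·1≈0) (zeroʳ _))
    neg : ∀ n {x} → x ≈ n · 1# → - x ≈ (p-1 ℕ.* n) · 1#
    neg n {x} x≈ = sym (x-y≈0⇒x≈y _ _ (begin
      (p-1 ℕ.* n) · 1# - - x         ≈⟨ +-congˡ (trans (-‿involutive x) x≈) ⟩
      (p-1 ℕ.* n) · 1# + n · 1#      ≈⟨ sym (×-homo-+ 1# (p-1 ℕ.* n) n) ⟩
      (p-1 ℕ.* n ℕ.+ n) · 1#         ≈⟨ ×-congˡ (≡.trans (ℕ.+-comm (p-1 ℕ.* n) n) (ℕ.*-comm p n)) ⟩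
      (n ℕ.* p) · 1#                 ≈⟨ p*n≈0 n ⟩
      0#                             ∎))
    finite : Finite P
    finite = p , (λ i → toℕ i · 1#) , λ x (n , x≈) → Fin.fromℕ< (m%n<n n p) , (begin
      toℕ (Fin.fromℕ< (m%n<n n p)) · 1#      ≈⟨ ×-congˡ (Fin.toℕ-fromℕ< (m%n<n n p)) ⟩
      (n % p) · 1#                           ≈⟨ sym (+-identityʳ _) ⟩
      (n % p) · 1# + 0#                      ≈⟨ +-congˡ (sym (p*n≈0 (n / p))) ⟩
      (n % p) · 1# + (n / p ℕ.* p) · 1#      ≈⟨ sym (×-homo-+ 1# (n % p) (n / p ℕ.* p)) ⟩
      (n % p ℕ.+ n / p ℕ.* p) · 1#           ≈⟨ ×-congˡ (≡.sym (m≡m%n+[m/n]*n n p)) ⟩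
      n · 1#                                 ≈⟨ sym x≈ ⟩
      x                                      ∎)

  -- Algebraic elements

  module _ {f} {F : Pred Carrier f} (isF : IsSubfield F) where
    open IsSubfield isF

    -- A nonzero coefficient does not make the values nonzero. While the constant coefficient and
    -- the value of the rest both vanish, the rest is a shorter nontrivial equation and takes over.
    algebraic⇒alg : ∀ {x} → x ∈ Algebraic L F → Alg isF x
    algebraic⇒alg {x} (f , f∈ , f≢0 , eq) = go f f∈ f≢0 eq
      where
      eval∈ : ∀ g → All F g → eval L g x ∈ Polynomial F x
      eval∈ List.[]      All.[]        = 0 , nil refl
      eval∈ (a List.∷ g) (a∈ All.∷ g∈) = let n , p∈ = eval∈ g g∈ in suc n , cons a∈ p∈ refl
      go : ∀ f → All F f → Any (_≉ 0#) f → eval L f x ≈ 0# → Alg isF x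
      go (a List.∷ g) (a∈ All.∷ g∈) ≢0 eq with em {P = a ≈ 0# × eval L g x ≈ 0#} | ≢0
      ... | no ¬both0        | _           = a , eval L g x , a∈ , eval∈ g g∈ , eq , ¬both0
      ... | yes (a≈0 , _)    | here a≉0    = contradiction a≈0 a≉0
      ... | yes (_ , g≈0)    | there g≢0   = go g g∈ g≢0 g≈0

    alg⇒algebraic : ∀ {x} → Alg isF x → x ∈ Algebraic L F
    alg⇒algebraic {x} (d , p , d∈ , (_ , p∈) , eq , ≉0) =
      let f , f∈ , p≈ = coefficients p∈
      in d List.∷ f , d∈ All.∷ f∈ , nontrivial f p≈ , trans (+-congˡ (*-congˡ (sym p≈))) eq
      where
      coefficients : ∀ {n p} → p ∈ Poly F x n → ∃[ f ] All F f × p ≈ eval L f x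
      coefficients (nil e) = List.[] , All.[] , e
      coefficients (cons a∈ p∈ e) = let f , f∈ , p≈ = coefficients p∈
        in _ List.∷ f , a∈ All.∷ f∈ , trans e (+-congˡ (*-congˡ p≈))
      any-≉0 : ∀ f → eval L f x ≉ 0# → Any (_≉ 0#) f
      any-≉0 List.[] ≉0 = contradiction refl ≉0
      any-≉0 (a List.∷ f) ≉0 with em {P = a ≈ 0#}
      ... | no  a≉0 = here a≉0
      ... | yes a≈0 = there (any-≉0 f λ f≈0 → ≉0 (trans (+-cong a≈0 (trans (*-congˡ f≈0) (zeroʳ x))) (+-identityˡ 0#)))
      nontrivial : ∀ f → p ≈ eval L f x → Any (_≉ 0#) (d List.∷ f)
      nontrivial f p≈ with em {P = d ≈ 0#}
      ... | no  d≉0 = here d≉0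
      ... | yes d≈0 = there (any-≉0 f λ f≈0 → ≉0 (d≈0 , trans p≈ f≈0))

    -- F(x)(y) lies in a finite span over `F`, which contains all powers of each of its elements.
    -- Closure of the algebraic elements under the field operations follows.
    adjoin₂-algebraic : ∀ {x y} → x ∈ Algebraic L F → y ∈ Algebraic L F →
      Adjoin L (Adjoin L F x) y ⊆ Algebraic L F
    adjoin₂-algebraic {x} {y} x-alg y-alg z∈ =
      let m , u , F[x]⊆ = adjoin-alg⊆span isF (algebraic⇒alg x-alg)
          d , p , d∈ , (l , p∈) , eq , ≉0 = algebraic⇒alg y-alg
          n , w , F[x,y]⊆ = adjoin-alg⊆span (adjoin-isSubfield isF)
            (d , p , F⊆adjoin isF d∈ , (l , poly-mono (F⊆adjoin isF) p∈) , eq , ≉0)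
          r , b , ⊆b = tower {F = F} {E = Adjoin L F x} F[x]⊆ w
      in alg⇒algebraic (finite⇒alg isF {b = b} (λ i → ⊆b (F[x,y]⊆ (IsSubfield.^∈ generated-isSubfield i z∈))))

    F⊆algebraic : F ⊆ Algebraic L F
    F⊆algebraic {a} a∈ = alg⇒algebraic
        (- a , 1# , neg∈ a∈ , 1∈polynomial isF , trans (+-congˡ (*-identityʳ a)) (-‿inverseˡ a) , λ (_ , 1≈0) → 1≉0 1≈0)

    algebraic-isSubfield : IsSubfield (Algebraic L F)
    algebraic-isSubfield = record
      { resp∈ = λ x≈y x∈ → let _ , ∋x , _ = in₂ x∈ x∈ in adjoin₂-algebraic x∈ x∈ (resp x≈y ∋x)
      ; 0∈ = F⊆algebraic 0∈
      ; 1∈ = F⊆algebraic 1∈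
      ; +∈ = λ x∈ y∈ → let ⊆ , ∋x , ∋y = in₂ x∈ y∈ in ⊆ (+-closed ∋x ∋y)
      ; neg∈ = λ x∈ → let ⊆ , ∋x , _ = in₂ x∈ x∈ in ⊆ (neg-closed ∋x)
      ; *∈ = λ x∈ y∈ → let ⊆ , ∋x , ∋y = in₂ x∈ y∈ in ⊆ (*-closed ∋x ∋y)
      ; ⁻¹∈ = λ x≉0 x∈ → let ⊆ , ∋x , _ = in₂ x∈ x∈ in ⊆ (⁻¹-closed x≉0 ∋x) }
      where
      in₂ : ∀ {x y} → x ∈ Algebraic L F → y ∈ Algebraic L F →
        (Adjoin L (Adjoin L F x) y ⊆ Algebraic L F) ×
        x ∈ Adjoin L (Adjoin L F x) y × y ∈ Adjoin L (Adjoin L F x) y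
      in₂ x∈ y∈ = adjoin₂-algebraic x∈ y∈ , gen (inj₁ (gen (inj₂ refl))) , gen (inj₂ refl)

  module _ {f} {F : Pred Carrier f} (isF : IsSubfield F) where
    open IsSubfield isF
    private
      F-subspace : IsSubspace F F
      F-subspace = subfield⇒subspace {F = F} id isF

    -- Separates, in a polynomial in `s` over F[x], the part `u` free of `x`. This is the step by
    -- which the roles of the two variables are exchanged.
    poly-poly-split : ∀ {x s T n p} → p ∈ Poly (Poly F x (suc T)) s n →
      ∃₂ λ u w → u ∈ Poly F s n × w ∈ Poly (Poly F x T) s n × p ≈ u + x * w
    poly-poly-split {x} (nil e) = 0# , 0# , nil refl , nil refl ,
      trans e (sym (trans (+-identityˡ _) (zeroʳ x)))
    poly-poly-split {x} {s} (cons (cons {a = a} {a′} a∈ a′∈ e) p∈ e′) =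
      let u , w , u∈ , w∈ , eq = poly-poly-split p∈
      in a + s * u , a′ + s * w , cons a∈ u∈ refl , cons a′∈ w∈ refl ,
         trans e′ (trans (+-cong e (*-congˡ eq))
           (solve 6 (λ a x b s u w → a :+ x :* b :+ s :* (u :+ x :* w) := a :+ s :* u :+ x :* (b :+ s :* w)) refl a x a′ s u w))

    -- A polynomial in s over F[x] is also a polynomial in x over F[s].
    trans-swap : ∀ {x s} → Trans isF s → Trans (adjoin-isSubfield isF {s}) x →
      ∀ T {n d p} → d ∈ Poly F x T → p ∈ Poly (Poly F x T) s n → d + s * p ≈ 0# → d ≈ 0# × p ≈ 0#
    trans-swap tr-s tr-x zero (nil d≈0) p∈ eq = d≈0 , poly-0 (λ { (nil a≈0) → a≈0 }) p∈
    trans-swap {x} {s} tr-s tr-x (suc T) {d = d} {p} (cons {a = a} {d′} a∈ d′∈ e) p∈ eq =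
      let u , w , u∈ , w∈ , p≈ = poly-poly-split p∈
          a+su≈0 , d′+sw≈0 = tr-x {a + s * u} {T} {d′ + s * w}
            (+-closed (gen (inj₁ a∈)) (*-closed (gen (inj₂ refl))
              (polynomial⊆ isF generated-isSubfield (F⊆adjoin isF) (t∈adjoin isF) (_ , u∈))))
            (poly-+ V-F (poly-mono (F⊆adjoin isF) d′∈)
              (poly-map s (*-closed (gen (inj₂ refl))) (poly-eval V-T V (poly-mono (F⊆adjoin isF)) (poly-map s (*-closed (gen (inj₂ refl)))) w∈)))
            (trans (solve 6 (λ a s u x d w → a :+ s :* u :+ x :* (d :+ s :* w) := a :+ x :* d :+ s :* (u :+ x :* w)) refl a s u x d′ w)
              (trans (+-cong (sym e) (*-congˡ (sym p≈))) eq))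
          a≈0 , u≈0 = tr-s a∈ u∈ a+su≈0
          d′≈0 , w≈0 = trans-swap tr-s tr-x T d′∈ w∈ d′+sw≈0
      in trans e (zero-sum a≈0 d′≈0) , trans p≈ (zero-sum u≈0 w≈0)
      where
      V-F : IsSubspace F (Adjoin L F s)
      V-F = subfield⇒subspace (F⊆adjoin isF) generated-isSubfield
      V-T : IsSubspace F (Poly F x T)
      V-T = poly-isSubspace F-subspace
      V : IsSubspace F (Poly (Adjoin L F s) x T)
      V = poly-isSubspace V-F
      zero-sum : ∀ {y z} → y ≈ 0# → z ≈ 0# → y + x * z ≈ 0#
      zero-sum y≈0 z≈0 = trans (+-cong y≈0 (trans (*-congˡ z≈0) (zeroʳ x))) (+-identityˡ 0#)

    poly-poly-* : ∀ {x s m T n q p} → q ∈ Poly F x m → p ∈ Poly (Poly F x T) s n →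
      q * p ∈ Poly (Poly F x (m ℕ.+ T)) s n
    poly-poly-* q∈ = poly-map _ (poly-* F-subspace q∈)

    common-denominator : ∀ {x s n p} → p ∈ Poly (Adjoin L F x) s n →
      ∃[ q ] q ∈ Polynomial F x × q ≉ 0# × ∃[ T ] q * p ∈ Poly (Poly F x T) s n
    common-denominator (nil e) = 1# , 1∈polynomial isF , 1≉0 , 0 , nil (trans (*-congˡ e) (zeroʳ 1#))
    common-denominator {x} {s} (cons {a = a} {p′} {p} a∈ p′∈ e) =
      let q , (m , q∈) , q≉0 , T , qa∈ = adjoin⊆fractional isF a∈
          r , (n , r∈) , r≉0 , T′ , rp∈ = common-denominator p′∈
          N = (n ℕ.+ T) ℕ.+ (m ℕ.+ T′)
      in q * r , polynomial-* F-subspace (m , q∈) (n , r∈) , *-≉0 q≉0 r≉0 , N ,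
         cons (poly-≤ F-subspace (ℕ.m≤m+n (n ℕ.+ T) _) (poly-* F-subspace r∈ qa∈))
              (poly-mono (poly-≤ F-subspace (ℕ.m≤n+m (m ℕ.+ T′) (n ℕ.+ T))) (poly-poly-* q∈ rp∈))
              (trans (*-congˡ e) (solve 5 (λ q r a s p → q :* r :* (a :+ s :* p) := r :* (q :* a) :+ s :* (q :* (r :* p))) refl q r a s p′))

    -- Clearing the denominators in `x` reduces the relation to `trans-swap`; the nonzero
    -- denominators `q` and `r` are cancelled from its conclusion.
    trans-lift : ∀ {x s} → Trans isF s → Trans (adjoin-isSubfield isF {s}) x → Trans (adjoin-isSubfield isF {x}) s
    trans-lift {x} {s} tr-s tr-x {d} {n} {p} d∈ p∈ eq =
      let q , (m , q∈) , q≉0 , T , qd∈ = adjoin⊆fractional isF d∈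
          r , (m′ , r∈) , r≉0 , T′ , rp∈ = common-denominator p∈
          N = (m′ ℕ.+ T) ℕ.+ (m ℕ.+ T′)
          rqd≈0 , qrp≈0 = trans-swap tr-s tr-x N
            (poly-≤ F-subspace (ℕ.m≤m+n (m′ ℕ.+ T) _) (poly-* F-subspace r∈ qd∈))
            (poly-mono (poly-≤ F-subspace (ℕ.m≤n+m (m ℕ.+ T′) (m′ ℕ.+ T))) (poly-poly-* q∈ rp∈))
            (trans (solve 5 (λ q r d s p → r :* (q :* d) :+ s :* (q :* (r :* p)) := q :* r :* (d :+ s :* p)) refl q r d s p)
              (trans (*-congˡ eq) (zeroʳ _)))
      in x*y≈0⇒y≈0 q≉0 (x*y≈0⇒y≈0 r≉0 rqd≈0) , x*y≈0⇒y≈0 r≉0 (x*y≈0⇒y≈0 q≉0 qrp≈0)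

    alg-exchange : ∀ {x s} → Trans isF s → Alg (adjoin-isSubfield isF {x}) s → Alg (adjoin-isSubfield isF {s}) x
    alg-exchange {x} {s} tr-s (d , p , d∈ , (_ , p∈) , eq , ≉0) =
      ¬trans⇒alg (adjoin-isSubfield isF) λ tr-x → ≉0 (trans-lift tr-s tr-x d∈ p∈ eq)

    -- As `s` is algebraic over F(x) and transcendental over F, the element `x` is algebraic over
    -- F(s). Thus F(x) lies in F(s)(x), which is finite over F(s), and the tower argument reaches
    -- `E`.
    finite-over-exchange : ∀ {e n x s} {E : Pred Carrier e} {b : Fin n → Carrier} → IsSubfield E →
      E ⊆ Span (Adjoin L F x) b → s ∈ E → Trans isF s →
      ∃[ m ] Σ[ u ∈ (Fin m → Carrier) ] E ⊆ Span (Adjoin L F s) u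
    finite-over-exchange {x = x} {s} {E} {b} isE E⊆ s∈E tr-s =
      let alg-s = finite⇒alg (adjoin-isSubfield isF {x}) {b = b} (λ i → E⊆ (IsSubfield.^∈ isE i s∈E))
          m , w , F[s,x]⊆ = adjoin-alg⊆span (adjoin-isSubfield isF {s}) (alg-exchange tr-s alg-s)
          F[x]⊆ : Adjoin L F x ⊆ Span (Adjoin L F s) w
          F[x]⊆ y∈ = F[s,x]⊆ (generated-least {F = Adjoin L (Adjoin L F s) x} generated-isSubfield
            (λ { (inj₁ a∈F) → gen (inj₁ (gen (inj₁ a∈F))) ; (inj₂ y≈x) → gen (inj₂ y≈x) }) y∈)
          r , u , ⊆u = tower {F = Adjoin L F s} {E = Adjoin L F x} F[x]⊆ b
      in r , u , λ y∈E → ⊆u (E⊆ y∈E)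

-- Transport of subfields and linear combinations along a field embedding

module Embedding (em : ∀ {a} → ExcludedMiddle a) {c ℓ c′ ℓ′} (K : Field c ℓ) (L : Field c′ ℓ′)
  (ι : Field.Carrier K → Field.Carrier L)
  (ι-homo : IsRingHomomorphism (Field.rawRing K) (Field.rawRing L) ι)
  (ι-≉0 : ∀ {x} → Field._≉_ K x (Field.0# K) → Field._≉_ L (ι x) (Field.0# L)) where
  private
    module K = Field K
    module FK = FieldTheory em K
  open Field L hiding (zero)
  open FieldTheory em L
  open IsRingHomomorphism ι-homo

  Image : ∀ {s} → Pred K.Carrier s → Pred Carrier _
  Image S y = ∃[ x ] x ∈ S × ι x ≈ y

  ι-⁻¹ : ∀ {x} → x K.≉ K.0# → ι (x K.⁻¹) ≈ ι x ⁻¹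
  ι-⁻¹ {x} x≉0 = sym (⁻¹-unique (trans (sym (*-homo x _)) (trans (⟦⟧-cong (K.*-inverseʳ x x≉0)) 1#-homo)))

  image-isSubfield : ∀ {f} {F : Pred K.Carrier f} → FK.IsSubfield F → IsSubfield (Image F)
  image-isSubfield isF = record
    { resp∈ = λ y≈z (x , x∈ , ιx≈) → x , x∈ , trans ιx≈ y≈z
    ; 0∈ = _ , F.0∈ , 0#-homo
    ; 1∈ = _ , F.1∈ , 1#-homo
    ; +∈ = λ (x , x∈ , ιx≈) (y , y∈ , ιy≈) → _ , F.+∈ x∈ y∈ , trans (+-homo x y) (+-cong ιx≈ ιy≈)
    ; neg∈ = λ (x , x∈ , ιx≈) → _ , F.neg∈ x∈ , trans (-‿homo x) (-‿cong ιx≈)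
    ; *∈ = λ (x , x∈ , ιx≈) (y , y∈ , ιy≈) → _ , F.*∈ x∈ y∈ , trans (*-homo x y) (*-cong ιx≈ ιy≈)
    ; ⁻¹∈ = λ {y} y≉0 (x , x∈ , ιx≈) →
        let x≉0 = λ x≈0 → y≉0 (trans (sym ιx≈) (trans (⟦⟧-cong x≈0) 0#-homo))
        in _ , F.⁻¹∈ x≉0 x∈ , trans (ι-⁻¹ x≉0) (⁻¹-cong ιx≈) }
    where module F = FK.IsSubfield isF

  ι-generated : ∀ {s t} {S : Pred K.Carrier s} {T : Pred Carrier t} →
    (∀ {x} → x ∈ S → ι x ∈ T) → ∀ {x} → x ∈ Generated K S → ι x ∈ Generated L T
  ι-generated f (gen x∈)         = gen (f x∈)
  ι-generated f (resp x≈y g)     = resp (⟦⟧-cong x≈y) (ι-generated f g)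
  ι-generated f 0-closed         = resp (sym 0#-homo) 0-closed
  ι-generated f 1-closed         = resp (sym 1#-homo) 1-closed
  ι-generated f (+-closed g h)   = resp (sym (+-homo _ _)) (+-closed (ι-generated f g) (ι-generated f h))
  ι-generated f (neg-closed g)   = resp (sym (-‿homo _)) (neg-closed (ι-generated f g))
  ι-generated f (*-closed g h)   = resp (sym (*-homo _ _)) (*-closed (ι-generated f g) (ι-generated f h))
  ι-generated f (⁻¹-closed ≉0 g) = resp (sym (ι-⁻¹ ≉0)) (⁻¹-closed (ι-≉0 ≉0) (ι-generated f g))

  ι-lc : ∀ {n} (k b : Fin n → K.Carrier) → ι (FK.lc k b) ≈ lc (ι ∘ k) (ι ∘ b)
  ι-lc {zero}  k b = 0#-homo
  ι-lc {suc n} k b = trans (+-homo _ _) (+-cong (*-homo _ _) (ι-lc (k ∘ suc) (b ∘ suc)))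

-- Valuations, balls and closures of subfields

module Valued (em : ∀ {a} → ExcludedMiddle a) {c ℓ} (L : Field c ℓ) (v : Valuation L) where
  open Field L hiding (zero)
  open FieldTheory em L
  open Polynomials em L
  open Algebraicity em L
  open Valuation v
  open AddSupremum ℤ._≤_ using ([_]; _≤⊤⁺; [≤]-injective)
  open GroupProps (AbelianGroup.group ℤ.+-0-abelianGroup) using () renaming (∙-cancelˡ to ℤ-cancelˡ)
  private module ℤS = +-*-Solver

  Ball : ℤ → Pred Carrier _
  Ball M x = [ M ] ≤⁺ val x

  []-injective : ∀ {i j : ℤ} → _≡_ {A = ℤ ⁺} [ i ] [ j ] → i ≡ j
  []-injective ≡.refl = ≡.refl

  val-0 : val 0# ≡ ⊤⁺
  val-0 = Equivalence.from (val-∞ 0#) refl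

  val-1 : val 1# ≡ [ + 0 ]
  val-1 with val 1# in eq | ≡.trans (≡.sym (val-cong (*-identityʳ 1#))) (val-* 1# 1#)
  ... | ⊤⁺    | _  = contradiction (Equivalence.to (val-∞ 1#) eq) 1≉0
  ... | [ w ] | w≡ = ≡.cong [_] (half w ([]-injective w≡))
    where
    half : ∀ w → w ≡ w ℤ.+ w → w ≡ + 0
    half w eq = ℤ-cancelˡ w w (+ 0) (≡.trans (≡.sym eq) (≡.sym (ℤ.+-identityʳ w)))

  val-finite : ∀ {x} → x ≉ 0# → ∃[ w ] val x ≡ [ w ]
  val-finite {x} x≉0 with val x in eq
  ... | [ w ] = w , ≡.refl
  ... | ⊤⁺    = contradiction (Equivalence.to (val-∞ x) eq) x≉0

  ball-resp : ∀ {M x y} → x ≈ y → x ∈ Ball M → y ∈ Ball M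
  ball-resp {M} x≈y = ≡.subst ([ M ] ≤⁺_) (val-cong x≈y)

  ball-0 : ∀ {M} → 0# ∈ Ball M
  ball-0 {M} = ≡.subst ([ M ] ≤⁺_) (≡.sym val-0) (_ ≤⊤⁺)

  ball-≤ : ∀ {M N x} → M ℤ.≤ N → x ∈ Ball N → x ∈ Ball M
  ball-≤ M≤N x∈ = AddSupremum.≤⁺-trans ℤ._≤_ ℤ.≤-trans [ M≤N ] x∈

  ball-+ : ∀ {M x y} → x ∈ Ball M → y ∈ Ball M → x + y ∈ Ball M
  ball-+ {M} {x} {y} x∈ y∈ = AddSupremum.≤⁺-trans ℤ._≤_ ℤ.≤-trans (go x∈ y∈) (val-+ x y)
    where
    go : ∀ {s t} → [ M ] ≤⁺ s → [ M ] ≤⁺ t → [ M ] ≤⁺ s ⊓⁺ t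
    go [ p ]   [ q ]   = [ ℤ.⊓-glb p q ]
    go [ p ]   (_ ≤⊤⁺) = [ p ]
    go (_ ≤⊤⁺) q       = q

  ball-* : ∀ {M N x y} → x ∈ Ball M → y ∈ Ball N → x * y ∈ Ball (M ℤ.+ N)
  ball-* {M} {N} {x} {y} x∈ y∈ = ≡.subst ([ M ℤ.+ N ] ≤⁺_) (≡.sym (val-* x y)) (go x∈ y∈)
    where
    go : ∀ {s t} → [ M ] ≤⁺ s → [ N ] ≤⁺ t → [ M ℤ.+ N ] ≤⁺ s +⁺ t
    go [ p ]   [ q ]   = [ ℤ.+-mono-≤ p q ]
    go [ p ]   (_ ≤⊤⁺) = _ ≤⊤⁺
    go (_ ≤⊤⁺) q       = _ ≤⊤⁺

  val⇒ball : ∀ {w x} → val x ≡ [ w ] → x ∈ Ball w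
  val⇒ball {w} eq = ≡.subst ([ w ] ≤⁺_) (≡.sym eq) [ ℤ.≤-refl ]

  val⇒≤ : ∀ {w M x} → val x ≡ [ w ] → x ∈ Ball M → M ℤ.≤ w
  val⇒≤ eq x∈ = [≤]-injective (≡.subst ([ _ ] ≤⁺_) eq x∈)

  val⇒≉0 : ∀ {w x} → val x ≡ [ w ] → x ≉ 0#
  val⇒≉0 {x = x} eq x≈0 with () ← ≡.trans (≡.sym eq) (Equivalence.from (val-∞ x) x≈0)

  val-*-≡ : ∀ {x y w u} → val x ≡ [ w ] → val y ≡ [ u ] → val (x * y) ≡ [ w ℤ.+ u ]
  val-*-≡ {x} {y} ex ey = ≡.trans (val-* x y) (≡.cong₂ _+⁺_ ex ey)

  val-^ : ∀ {x w} n → val x ≡ [ w ] → val (x ^ n) ≡ [ + n ℤ.* w ]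
  val-^ {w = w} zero    ex = ≡.trans val-1 (≡.cong [_] (≡.sym (ℤ.*-zeroˡ w)))
  val-^ {w = w} (suc n) ex = ≡.trans (val-*-≡ ex (val-^ n ex)) (≡.cong [_] (≡.sym (ℤ.suc-* (+ n) w)))

  val-torsion : ∀ {x} n → x ^ suc n ≈ 1# → val x ≡ [ + 0 ]
  val-torsion {x} n eq =
    let w , ex = val-finite {x} (λ x≈0 → 1≉0 (trans (sym eq) (trans (*-congʳ x≈0) (zeroˡ _))))
        nw≡0 = []-injective (≡.trans (≡.sym (val-^ (suc n) ex)) (≡.trans (val-cong eq) val-1))
    in ≡.trans ex (≡.cong [_] (ℤ.*-cancelˡ-≡ (+ suc n) w (+ 0) (≡.trans nw≡0 (≡.sym (ℤ.*-zeroʳ (+ suc n))))))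

  val-⁻¹ : ∀ {x w} → val x ≡ [ w ] → val (x ⁻¹) ≡ [ ℤ.- w ]
  val-⁻¹ {x} {w} ex =
    let x≉0 = val⇒≉0 ex
        u , ey = val-finite (⁻¹-≉0 x≉0)
        w+u≡0 = []-injective (≡.trans (≡.sym (val-*-≡ ex ey)) (≡.trans (val-cong (*-inverseʳ x x≉0)) val-1))
    in ≡.trans ey (≡.cong [_] (ℤ-cancelˡ w u (ℤ.- w) (≡.trans w+u≡0 (≡.sym (ℤ.+-inverseʳ w)))))

  ball-neg : ∀ {M x} → x ∈ Ball M → - x ∈ Ball M
  ball-neg {M} {x} x∈ = ball-resp (trans (sym (-‿distribˡ-* 1# x)) (-‿cong (*-identityˡ x)))
    (≡.subst (λ N → - 1# * x ∈ Ball N) (ℤ.+-identityˡ M) (ball-* (val⇒ball val--1) x∈))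
    where
    val--1 : val (- 1#) ≡ [ + 0 ]
    -- The square of -1 is 1, and elements of finite order have valuation 0.
    val--1 = val-torsion 1 (trans (*-congˡ (*-identityʳ _)) (trans (solve 1 (λ o → (:- o) :* (:- o) := o :* o) refl 1#) (*-identityʳ 1#)))

  ball-- : ∀ {M x y} → x ∈ Ball M → y ∈ Ball M → x - y ∈ Ball M
  ball-- x∈ y∈ = ball-+ x∈ (ball-neg y∈)

  ball-cancel : ∀ {M w x y} → val x ≡ [ w ] → x * y ∈ Ball (w ℤ.+ M) → y ∈ Ball M
  ball-cancel {M} {w} {x} {y} ex xy∈ = ball-resp
    (trans (sym (*-assoc _ _ _)) (trans (*-congʳ (*-inverseˡ (val⇒≉0 ex))) (*-identityˡ y)))
    (≡.subst (λ N → x ⁻¹ * (x * y) ∈ Ball N) (ℤS.solve 2 (λ w M → ℤS.:- w ℤS.:+ (w ℤS.:+ M) ℤS.:= M) ≡.refl w M)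
      (ball-* (val⇒ball (val-⁻¹ ex)) xy∈))

  in-some-ball : ∀ x → ∃[ M ] x ∈ Ball M
  in-some-ball x with val x
  ... | [ w ] = w , [ ℤ.≤-refl ]
  ... | ⊤⁺    = + 0 , (_ ≤⊤⁺)

  in-all-balls⇒0 : ∀ {x} → (∀ M → x ∈ Ball M) → x ≈ 0#
  in-all-balls⇒0 {x} x∈ = ¬¬-elim λ x≉0 →
    let w , ex = val-finite x≉0
    in ℤ.i≮i (ℤ.suc[i]≤j⇒i<j (val⇒≤ ex (x∈ (ℤ.suc w))))

  val-unit-+ : ∀ {x y e} → + 0 ℤ.< e → val x ≡ [ + 0 ] → y ∈ Ball e → val (x + y) ≡ [ + 0 ]
  val-unit-+ {x} {y} {e} 0<e ex y∈ = go (val-finite x+y≉0)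
    where
    -- Since x = (x + y) - y, a lower bound for v(x + y) of at most `e` is one for v(x) = 0. This
    -- rules out both x + y = 0 and a positive valuation.
    back : ∀ {M} → M ℤ.≤ e → x + y ∈ Ball M → M ℤ.≤ + 0
    back M≤e x+y∈ = val⇒≤ ex (ball-resp (solve 2 (λ x y → x :+ y :- y := x) refl x y) (ball-- x+y∈ (ball-≤ M≤e y∈)))
    x+y≉0 : x + y ≉ 0#
    x+y≉0 x+y≈0 = ℤ.<⇒≱ 0<e (back ℤ.≤-refl (ball-resp (sym x+y≈0) ball-0))
    go : ∃[ w ] val (x + y) ≡ [ w ] → val (x + y) ≡ [ + 0 ]
    go (w , eq) with ℤ.<-cmp w (+ 0)
    ... | tri≈ _ w≡0 _ = ≡.trans eq (≡.cong [_] w≡0)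
    ... | tri< w<0 _ _ = contradiction (val⇒≤ eq (ball-+ (val⇒ball ex) (ball-≤ (ℤ.<⇒≤ 0<e) y∈))) (ℤ.<⇒≱ w<0)
    ... | tri> _ _ 0<w with ℤ.≤-total w e
    ...   | inj₁ w≤e = contradiction (back w≤e (val⇒ball eq)) (ℤ.<⇒≱ 0<w)
    ...   | inj₂ e≤w = contradiction (back ℤ.≤-refl (ball-≤ e≤w (val⇒ball eq))) (ℤ.<⇒≱ 0<e)

  ≤+∣∣ : ∀ i → i ℤ.≤ + ℤ.∣ i ∣
  ≤+∣∣ (+ n)    = ℤ.≤-refl
  ≤+∣∣ -[1+ n ] = ℤ.-≤+

  ∃-bound : ∀ {n} (M : Fin n → ℤ) → ∃[ N ] ∀ i → N ℤ.≤ M i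
  ∃-bound {zero}  M = + 0 , λ ()
  ∃-bound {suc n} M =
    let N , N≤ = ∃-bound (M ∘ suc)
    in M zero ℤ.⊓ N , λ { zero → ℤ.i⊓j≤i (M zero) N ; (suc i) → ℤ.≤-trans (ℤ.i⊓j≤j (M zero) N) (N≤ i) }

  family-bound : ∀ {n} (x : Fin n → Carrier) → ∃[ N ] ∀ i → x i ∈ Ball N
  family-bound x =
    let N , N≤ = ∃-bound (λ i → proj₁ (in-some-ball (x i)))
    in N , λ i → ball-≤ (N≤ i) (proj₂ (in-some-ball (x i)))

  lc-ball : ∀ {n M N} {k b : Fin n → Carrier} → (∀ i → k i ∈ Ball M) → (∀ i → b i ∈ Ball N) →
    lc k b ∈ Ball (M ℤ.+ N)
  lc-ball {zero}  k∈ b∈ = ball-0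
  lc-ball {suc n} k∈ b∈ = ball-+ (ball-* (k∈ zero) (b∈ zero)) (lc-ball (k∈ ∘ suc) (b∈ ∘ suc))

  minimal-valuation : ∀ {n} (k : Fin n → Carrier) →
    (∀ i → k i ≈ 0#) ⊎ ∃[ j ] ∃[ w ] val (k j) ≡ [ w ] × ∀ i → k i ∈ Ball w
  minimal-valuation {zero} k = inj₁ λ ()
  minimal-valuation {suc n} k with em {P = k zero ≈ 0#} | minimal-valuation (k ∘ suc)
  ... | yes k₀≈0 | inj₁ all0 = inj₁ λ { zero → k₀≈0 ; (suc i) → all0 i }
  ... | yes k₀≈0 | inj₂ (j , w , ej , min) = inj₂ (suc j , w , ej , λ
    { zero → ball-resp (sym k₀≈0) ball-0 ; (suc i) → min i })
  ... | no k₀≉0 | inj₁ all0 = let w , e₀ = val-finite k₀≉0 in inj₂ (zero , w , e₀ , λ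
    { zero → val⇒ball e₀ ; (suc i) → ball-resp (sym (all0 i)) ball-0 })
  ... | no k₀≉0 | inj₂ (j , w , ej , min) with u , e₀ ← val-finite k₀≉0 with ℤ.≤-total u w
  ...   | inj₁ u≤w = inj₂ (zero , u , e₀ , λ { zero → val⇒ball e₀ ; (suc i) → ball-≤ u≤w (min i) })
  ...   | inj₂ w≤u = inj₂ (suc j , w , ej , λ { zero → ball-≤ w≤u (val⇒ball e₀) ; (suc i) → min i })

  -- Nonzero elements of a finite field are roots of unity; applied to the constants, this makes the
  -- valuation trivial on them.
  finite-subfield-units : ∀ {f} {F : Pred Carrier f} → IsSubfield F → Finite F →
    ∀ {x} → x ∈ F → x ≉ 0# → val x ≡ [ + 0 ]
  finite-subfield-units isF fin x∈ x≉0 =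
    let n , eq = torsion fin (λ n → IsSubfield.^∈ isF n x∈) x≉0 in val-torsion n eq

  module _ {f} {F : Pred Carrier f} (isF : IsSubfield F) where
    open IsSubfield isF

    closure-isSubfield : IsSubfield (Closure F)
    closure-isSubfield = record
      { resp∈ = λ x≈y x∈ M → let z , z∈ , p = x∈ M in z , z∈ , ball-resp (+-congʳ x≈y) p
      ; 0∈ = base 0∈
      ; 1∈ = base 1∈
      ; +∈ = λ {x} {y} x∈ y∈ M → let x′ , x′∈ , p = x∈ M ; y′ , y′∈ , q = y∈ M in x′ + y′ , +∈ x′∈ y′∈ ,
          ball-resp (solve 4 (λ x y x′ y′ → x :- x′ :+ (y :- y′) := x :+ y :- (x′ :+ y′)) refl x y x′ y′) (ball-+ p q)
      ; neg∈ = λ {x} x∈ M → let x′ , x′∈ , p = x∈ M in - x′ , neg∈ x′∈ ,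
          ball-resp (solve 2 (λ x x′ → :- (x :- x′) := :- x :- :- x′) refl x x′) (ball-neg p)
      ; *∈ = mul
      ; ⁻¹∈ = inv }
      where
      base : F ⊆ Closure F
      base {x} x∈ M = x , x∈ , ball-resp (sym (-‿inverseʳ x)) ball-0
      mul : ∀ {x y} → x ∈ Closure F → y ∈ Closure F → x * y ∈ Closure F
      mul {x} {y} x∈ y∈ M =
        let m , x∈m = in-some-ball x
            y′ , y′∈ , q = y∈ (M ℤ.- m)
            n , y′∈n = in-some-ball y′
            x′ , x′∈ , p = x∈ (M ℤ.- n)
        in x′ * y′ , *∈ x′∈ y′∈ , ball-resp
             (solve 4 (λ x y x′ y′ → x :* (y :- y′) :+ (x :- x′) :* y′ := x :* y :- x′ :* y′) refl x y x′ y′)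
             (ball-+ (≡.subst (λ N → x * (y - y′) ∈ Ball N) (ℤS.solve 2 (λ M m → m ℤS.:+ (M ℤS.:- m) ℤS.:= M) ≡.refl M m) (ball-* x∈m q))
                     (≡.subst (λ N → (x - x′) * y′ ∈ Ball N) (ℤS.solve 2 (λ M n → (M ℤS.:- n) ℤS.:+ n ℤS.:= M) ≡.refl M n) (ball-* p y′∈n)))
      inv : ∀ {x} → x ≉ 0# → x ∈ Closure F → x ⁻¹ ∈ Closure F
      inv {x} x≉0 x∈ M =
        let w , ex = val-finite x≉0
            N = M ℤ.+ w
            -- The bound 1 makes `1# - t` a unit, so v(y) = w. The bound `N` is for the inverses: y
            -- (x⁻¹ - y⁻¹) = -t, hence v(x⁻¹ - y⁻¹) ≥ N - w = M.
            y , y∈ , p = x∈ (w ℤ.+ ((+ 1) ℤ.⊔ N))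
            -- y = x (1 - t) with t = x⁻¹ (x - y) of positive valuation
            t = x ⁻¹ * (x - y)
            xt≈ : x * t ≈ x - y
            xt≈ = trans (sym (*-assoc _ _ _)) (trans (*-congʳ (*-inverseʳ x x≉0)) (*-identityˡ _))
            t∈ = ball-cancel {M = (+ 1) ℤ.⊔ N} ex (ball-resp (sym xt≈) p)
            1-t = val-unit-+ (ℤ.+<+ (s≤s z≤n)) val-1 (ball-neg (ball-≤ (ℤ.i≤i⊔j (+ 1) N) t∈))
            y≈ : x * (1# - t) ≈ y
            y≈ = trans (solve 3 (λ x o t → x :* (o :- t) := x :* o :- x :* t) refl x 1# t)
                   (trans (+-cong (*-identityʳ x) (-‿cong xt≈)) (solve 2 (λ x y → x :- (x :- y) := y) refl x y))
            ey = ≡.trans (≡.sym (val-cong y≈)) (≡.trans (val-*-≡ ex 1-t) (≡.cong [_] (ℤ.+-identityʳ w)))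
            y≉0 = val⇒≉0 ey
        in y ⁻¹ , ⁻¹∈ y≉0 y∈ , ball-cancel ey (ball-resp
             (trans (-‿cong (sym (*-identityʳ t))) (trans (-‿cong (*-congˡ (sym (*-inverseʳ x x≉0))))
               (trans (-‿cong (trans (solve 3 (λ t x i → t :* (x :* i) := i :* (x :* t)) refl t x (x ⁻¹)) (*-congˡ xt≈)))
                 (trans (solve 3 (λ x i y → :- (i :* (x :- y)) := y :* i :- x :* i) refl x (x ⁻¹) y)
                   (trans (+-congˡ (-‿cong (trans (*-inverseʳ x x≉0) (sym (*-inverseʳ y y≉0)))))
                     (solve 3 (λ y i j → y :* i :- y :* j := y :* (i :- j)) refl y (x ⁻¹) (y ⁻¹)))))))
             (ball-neg (ball-≤ (ℤ.≤-trans (ℤ.≤-reflexive (ℤ.+-comm w M)) (ℤ.i≤j⊔i (+ 1) N)) t∈)))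

-- From bases over a subfield to bases over its closure

module CompleteBasis (em : ∀ {a} → ExcludedMiddle a) {c ℓ} (L : Field c ℓ) (v : Valuation L) where
  open Field L hiding (zero)
  open FieldTheory em L
  open Valuation v
  open Valued em L v
  private module ℤS = +-*-Solver

  ContinuousCoordinates : ∀ {f n} → Pred Carrier f → (Fin n → Carrier) → Set _
  ContinuousCoordinates {n = n} F b = ∀ M → ∃[ N ] ∀ (k : Fin n → Carrier) → (∀ i → k i ∈ F) →
    lc k b ∈ Ball N → ∀ i → k i ∈ Ball M

  DenseSpan : ∀ {f n} → Pred Carrier f → (Fin n → Carrier) → Set _
  DenseSpan {n = n} F b = ∀ x M → Σ[ k ∈ (Fin n → Carrier) ] ((∀ i → k i ∈ F) × x - lc k b ∈ Ball M)

  ∃-upper-bound : ∀ {n} (f : Fin n → ℕ) → ∃[ N ] ∀ i → f i ℕ.≤ N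
  ∃-upper-bound {zero}  f = 0 , λ ()
  ∃-upper-bound {suc n} f =
    let N , ≤N = ∃-upper-bound (f ∘ suc)
    in f zero ℕ.+ N , λ { zero → ℕ.m≤m+n _ N ; (suc i) → ℕ.≤-trans (≤N i) (ℕ.m≤n+m N _) }

  -- For independence, approximate the coefficients of a vanishing combination by elements of `F`:
  -- their combination is small, so by continuity they are small, and the coefficients lie in every
  -- ball. For spanning, the coordinates of approximants of x are Cauchy by continuity, and their
  -- limits are coordinates of x.
  closure-basis : ∀ {f n} {F : Pred Carrier f} {b : Fin n → Carrier} →
    (∀ s → Cauchy s → ∃[ y ] Converges s y) → IsSubfield F →
    ContinuousCoordinates F b → DenseSpan F b → IsBasis L U (Closure F) b
  closure-basis {n = n} {F} {b} complete isF cont dense = (λ _ → _) , independent , λ x _ → spans x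
    where
    open IsSubfield isF
    m = proj₁ (family-bound b)
    b∈ = proj₂ (family-bound b)
    independent : ∀ (k : Fin n → Carrier) → (∀ i → k i ∈ Closure F) → lc k b ≈ 0# → ∀ i → k i ≈ 0#
    independent k k∈ eq j = in-all-balls⇒0 λ M →
      let N , bounded = cont M
          -- `M` controls the differences `k i - p i` themselves; `N - m`, where `m` bounds the
          -- valuations of `b` from below, puts their combination into `Ball N`.
          M′ = M ℤ.⊔ (N ℤ.- m)
          p = λ i → proj₁ (k∈ i M′)
          p∈ = λ i → proj₁ (proj₂ (k∈ i M′))
          k-p∈ = λ i → proj₂ (proj₂ (k∈ i M′))
          diff∈ = ≡.subst (λ N → lc (λ i → k i - p i) b ∈ Ball N) (ℤS.solve 2 (λ N m → (N ℤS.:- m) ℤS.:+ m ℤS.:= N) ≡.refl N m)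
                    (lc-ball {b = b} (λ i → ball-≤ (ℤ.i≤j⊔i M (N ℤ.- m)) (k-p∈ i)) b∈)
          p-small = bounded p p∈ (ball-resp
            (trans (-‿cong (trans (lc-- k p b) (trans (+-congʳ eq) (+-identityˡ _)))) (-‿involutive _)) (ball-neg diff∈))
      in ball-resp (solve 2 (λ k p → k :- p :+ p := k) refl (k j) (p j))
           (ball-+ (ball-≤ (ℤ.i≤i⊔j M (N ℤ.- m)) (k-p∈ j)) (p-small j))
    spans : ∀ x → Span (Closure F) b x
    spans x = y , y∈ , x-y≈0⇒x≈y _ _ (in-all-balls⇒0 limit)
      where
      k : ℕ → Fin n → Carrier
      k i = proj₁ (dense x (+ i))
      k∈ : ∀ i j → k i j ∈ F
      k∈ i = proj₁ (proj₂ (dense x (+ i)))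
      x-k∈ : ∀ i → x - lc (k i) b ∈ Ball (+ i)
      x-k∈ i = proj₂ (proj₂ (dense x (+ i)))
      cauchy : ∀ j → Cauchy (λ i → k i j)
      cauchy j M =
        let N , bounded = cont M
        in ℤ.∣ N ∣ , λ i i′ i≥ i′≥ → bounded (λ j → k i j - k i′ j) (λ j → -∈ (k∈ i j) (k∈ i′ j))
             (ball-resp (trans (solve 3 (λ x s t → x :- t :- (x :- s) := s :- t) refl x (lc (k i) b) (lc (k i′) b)) (sym (lc-- (k i) (k i′) b)))
               (ball-- (ball-≤ (ℤ.≤-trans (≤+∣∣ N) (ℤ.+≤+ i′≥)) (x-k∈ i′)) (ball-≤ (ℤ.≤-trans (≤+∣∣ N) (ℤ.+≤+ i≥)) (x-k∈ i)))) j
      y : Fin n → Carrier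
      y j = proj₁ (complete _ (cauchy j))
      conv : ∀ j → Converges (λ i → k i j) (y j)
      conv j = proj₂ (complete _ (cauchy j))
      y∈ : ∀ j → y j ∈ Closure F
      y∈ j M = let i , near = conv j M
               in k i j , k∈ i j , ball-resp (solve 2 (λ k y → :- (k :- y) := y :- k) refl (k i j) (y j)) (ball-neg (near i ℕ.≤-refl))
      limit : ∀ M → x - lc y b ∈ Ball M
      limit M =
        let N , N≥ = ∃-upper-bound (λ j → proj₁ (conv j (M ℤ.- m)))
            i = ℤ.∣ M ∣ ℕ.+ N
            near = λ j → proj₂ (conv j (M ℤ.- m)) i (ℕ.≤-trans (N≥ j) (ℕ.m≤n+m N _))
            diff∈ = ≡.subst (λ N → lc (λ j → k i j - y j) b ∈ Ball N) (ℤS.solve 2 (λ N m → (N ℤS.:- m) ℤS.:+ m ℤS.:= N) ≡.refl M m)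
                      (lc-ball {b = b} near b∈)
        in ball-resp (trans (+-congˡ (lc-- (k i) y b)) (solve 3 (λ x s t → x :- s :+ (s :- t) := x :- t) refl x (lc (k i) b) (lc y b)))
             (ball-+ (ball-≤ (ℤ.≤-trans (≤+∣∣ M) (ℤ.+≤+ (ℕ.m≤m+n _ N))) (x-k∈ i)) diff∈)

-- Reduction modulo π and coordinates over k(π)

module Place (em : ∀ {a} → ExcludedMiddle a) {c ℓ} (L : Field c ℓ) (v : Valuation L)
  (π : Field.Carrier L) (e : ℤ) (0<e : + 0 ℤ.< e) (val-π : Valuation.val v π ≡ [ e ])
  {f} (k : Pred (Field.Carrier L) f) (isk : FieldTheory.IsSubfield em L k)
  (k-units : ∀ {a} → a ∈ k → Field._≉_ L a (Field.0# L) → Valuation.val v a ≡ [ + 0 ]) where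
  open Field L hiding (zero)
  open FieldTheory em L
  open Polynomials em L
  open Algebraicity em L
  open Valuation v
  open Valued em L v
  open CompleteBasis em L v
  private
    module ℤS = +-*-Solver
    module k = IsSubfield isk
  open import Relation.Binary.Reasoning.Setoid setoid

  𝔸 : Pred Carrier _
  𝔸 = ValuationRing

  k⟨π⟩ : Pred Carrier _
  k⟨π⟩ = Adjoin L k π

  isk⟨π⟩ : IsSubfield k⟨π⟩
  isk⟨π⟩ = adjoin-isSubfield isk

  module F = IsSubfield isk⟨π⟩

  k-subspace : IsSubspace k k
  k-subspace = subfield⇒subspace {F = k} id isk

  π≉0 : π ≉ 0#
  π≉0 = val⇒≉0 val-π

  π∈k⟨π⟩ : π ∈ k⟨π⟩
  π∈k⟨π⟩ = t∈adjoin isk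

  π∈𝔸 : π ∈ 𝔸
  π∈𝔸 = ball-≤ (ℤ.<⇒≤ 0<e) (val⇒ball val-π)

  1∈𝔸 : 1# ∈ 𝔸
  1∈𝔸 = val⇒ball val-1

  k⊆𝔸 : k ⊆ 𝔸
  k⊆𝔸 {a} a∈ with em {P = a ≈ 0#}
  ... | yes a≈0 = ball-resp (sym a≈0) ball-0
  ... | no  a≉0 = val⇒ball (k-units a∈ a≉0)

  ball-isSubspace : ∀ M → IsSubspace k (Ball M)
  ball-isSubspace M = record
    { resp∈ = ball-resp ; 0∈ = ball-0 ; +∈ = ball-+
    ; scale∈ = λ {a} {x} a∈ x∈ → ≡.subst (λ N → a * x ∈ Ball N) (ℤ.+-identityˡ M) (ball-* (k⊆𝔸 a∈) x∈) }

  π*∈ : ∀ {x} → x ∈ 𝔸 → π * x ∈ Ball e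
  π*∈ {x} x∈ = ≡.subst (λ N → π * x ∈ Ball N) (ℤ.+-identityʳ e) (ball-* (val⇒ball val-π) x∈)

  π^∈ : ∀ n → π ^ n ∈ Ball (+ n)
  π^∈ zero    = 1∈𝔸
  π^∈ (suc n) = ball-* (ball-≤ (ℤ.i<j⇒suc[i]≤j 0<e) (val⇒ball val-π)) (π^∈ n)

  π^*∈ : ∀ n {x} → x ∈ 𝔸 → π ^ n * x ∈ Ball (+ n)
  π^*∈ n {x} x∈ = ≡.subst (λ N → π ^ n * x ∈ Ball N) (ℤ.+-identityʳ (+ n)) (ball-* (π^∈ n) x∈)

  π-divides : ∀ {x} → x ∈ Ball e → ∃[ z ] z ∈ 𝔸 × x ≈ π * z
  π-divides {x} x∈ = π ⁻¹ * x , ball-cancel val-π (ball-resp (sym π[π⁻¹x]≈x)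
      (≡.subst (λ N → x ∈ Ball N) (≡.sym (ℤ.+-identityʳ e)) x∈)) , sym π[π⁻¹x]≈x
    where
    π[π⁻¹x]≈x : π * (π ⁻¹ * x) ≈ x
    π[π⁻¹x]≈x = trans (sym (*-assoc _ _ _)) (trans (*-congʳ (*-inverseʳ π π≉0)) (*-identityˡ x))

  small-constant : ∀ {a} → a ∈ k → a ∈ Ball e → a ≈ 0#
  small-constant a∈ a∈e = ¬¬-elim λ a≉0 → ℤ.<⇒≱ 0<e (val⇒≤ (k-units a∈ a≉0) a∈e)

  -- Such an `S` embeds in 𝔸/π𝔸, because `Ball e` is π𝔸. Elements of S[π] then behave like formal
  -- polynomials as far as divisibility by π is concerned. The instances are `k` and the span of ω
  -- over `k`.
  record Discrete {s} (S : Pred Carrier s) : Set (c ⊔ ℓ ⊔ f ⊔ s) where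
    field
      isSubspace : IsSubspace k S
      integral   : S ⊆ 𝔸
      small⇒0    : ∀ {a} → a ∈ S → a ∈ Ball e → a ≈ 0#

    poly-integral : ∀ {n} → Poly S π n ⊆ 𝔸
    poly-integral = poly-eval isSubspace (ball-isSubspace (+ 0)) integral (λ x∈ → ball-≤ (ℤ.<⇒≤ 0<e) (π*∈ x∈))

    -- The constant coefficient differs from `y` by a multiple of π, so it lies in S ∩ π𝔸 and
    -- vanishes. The length bound is kept, so that repeated division stays inside one set.
    poly-divide : ∀ {n y} → y ∈ Poly S π n → y ∈ Ball e → ∃[ z ] z ∈ Poly S π n × y ≈ π * z
    poly-divide (nil y≈0) y∈ = 0# , nil refl , trans y≈0 (sym (zeroʳ π))
    poly-divide (cons {a = a} {z} {y} a∈ z∈ eq) y∈ =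
      let a≈0 = small⇒0 a∈ (ball-resp (trans (+-congʳ eq) (solve 2 (λ a t → a :+ t :- t := a) refl a (π * z)))
                  (ball-- y∈ (π*∈ (poly-integral z∈))))
      in z , poly-≤ isSubspace (ℕ.n≤1+n _) z∈ , trans eq (trans (+-congʳ a≈0) (+-identityˡ _))

    poly-divide-power : ∀ {n z} j → π ^ j * z ∈ Poly S π n → z ∈ 𝔸 → z ∈ Poly S π n
    poly-divide-power zero    y∈ z∈ = poly-resp (*-identityˡ _) y∈
    poly-divide-power {n} {z} (suc j) y∈ z∈ =
      let w , w∈ , eq = poly-divide (poly-resp (*-assoc _ _ _) y∈) (π*∈ (ball-≤ (ℤ.+≤+ z≤n) (π^*∈ j z∈)))
      in poly-divide-power j (poly-resp (sym (*-cancelˡ π≉0 eq)) w∈) z∈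

  k-discrete : Discrete k
  k-discrete = record { isSubspace = k-subspace ; integral = k⊆𝔸 ; small⇒0 = small-constant }

  -- Reduction modulo π kills `d`, since a nonzero constant has valuation 0; then π cancels.
  π-transcendental : Trans isk π
  π-transcendental {d} {n} {p} d∈ p∈ eq = d≈0 , x*y≈0⇒y≈0 π≉0 (trans (sym (trans (+-congʳ d≈0) (+-identityˡ _))) eq)
    where
    d≈0 : d ≈ 0#
    d≈0 = small-constant d∈ (ball-resp (trans (solve 2 (λ d t → :- t := d :- (d :+ t)) refl d (π * p))
        (trans (+-congˡ (trans (-‿cong eq) -0#≈0#)) (+-identityʳ d)))
      (ball-neg (π*∈ (Discrete.poly-integral k-discrete p∈))))

  Unit : Pred Carrier _
  Unit u = u ∈ Polynomial k π × val u ≡ [ + 0 ]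

  factor-π : ∀ {n q} → q ∈ Poly k π n → q ≉ 0# → ∃₂ λ j u → u ∈ Unit × q ≈ π ^ j * u
  factor-π (nil q≈0) q≉0 = contradiction q≈0 q≉0
  factor-π (cons {a = a} {p} {q} a∈ p∈ eq) q≉0 with em {P = a ≈ 0#}
  ... | no a≉0 = 0 , q , ((_ , cons a∈ p∈ eq) , ≡.trans (val-cong eq)
          (val-unit-+ 0<e (k-units a∈ a≉0) (π*∈ (Discrete.poly-integral k-discrete p∈)))) , sym (*-identityˡ q)
  ... | yes a≈0 =
    let q≈πp = trans eq (trans (+-congʳ a≈0) (+-identityˡ _))
        j , u , u∈ , p≈ = factor-π p∈ (λ p≈0 → q≉0 (trans q≈πp (trans (*-congˡ p≈0) (zeroʳ π))))
    in suc j , u , u∈ , trans q≈πp (trans (*-congˡ p≈) (sym (*-assoc _ _ _)))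

  -- The denominator is πʲ u with `u` a unit. The numerator is πʲ (u x) with u x integral, so the
  -- factor πʲ divides out coefficientwise.
  fractional-integral : ∀ {s} {S : Pred Carrier s} → Discrete S → ∀ {x} →
    x ∈ Fractional k S π → x ∈ 𝔸 → ∃[ u ] u ∈ Unit × u * x ∈ Polynomial S π
  fractional-integral D {x} (q , (_ , q∈) , q≉0 , (n , qx∈)) x∈ =
    let j , u , (u∈ , val-u) , q≈ = factor-π q∈ q≉0
    in u , (u∈ , val-u) , n , Discrete.poly-divide-power D j
         (poly-resp (trans (*-congʳ q≈) (*-assoc _ _ _)) qx∈) (ball-* (val⇒ball val-u) x∈)

  -- With a unit denominator `u`, let a and b be the constant terms of u and u x. Then a is nonzero
  -- and x is congruent to b/a modulo π.
  residue : ∀ {x} → x ∈ k⟨π⟩ → x ∈ 𝔸 → ∃[ a ] a ∈ k × x - a ∈ Ball e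
  residue {x} x∈F x∈𝔸 =
    let u , ((_ , u∈) , val-u) , (_ , ux∈) = fractional-integral k-discrete (adjoin⊆fractional isk x∈F) x∈𝔸
        a , a∈ , r , r∈ , u≈ = constant-term u∈
        b , b∈ , s , s∈ , ux≈ = constant-term ux∈
        a≉0 : a ≉ 0#
        a≉0 = λ a≈0 → ℤ.<⇒≱ 0<e (val⇒≤ val-u (ball-resp (sym (trans u≈ (trans (+-congʳ a≈0) (+-identityˡ _)))) (π*∈ r∈)))
        t = a ⁻¹ * b
        t∈ = k.*∈ (k.⁻¹∈ a≉0 a∈) b∈
        at≈b = trans (sym (*-assoc _ _ _)) (trans (*-congʳ (*-inverseʳ a a≉0)) (*-identityˡ b))
    in t , t∈ , ball-cancel val-u (≡.subst (λ N → u * (x - t) ∈ Ball N) (≡.sym (ℤ.+-identityˡ e)) (ball-resp (begin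
         π * (s - r * t)                     ≈⟨ solve 5 (λ b a t s r → s :* (r :- a :* t) := b :+ s :* r :- (b :+ s :* (a :* t))) refl b r t π s ⟩
         b + π * s - (b + π * (r * t))       ≈⟨ +-congˡ (-‿cong (+-congʳ (sym at≈b))) ⟩
         b + π * s - (a * t + π * (r * t))   ≈⟨ +-cong (sym ux≈) (-‿cong (trans (solve 4 (λ a t π r → a :* t :+ π :* (r :* t) := (a :+ π :* r) :* t) refl a t π r) (*-congʳ (sym u≈)))) ⟩
         u * x - u * t                       ≈⟨ solve 3 (λ u x t → u :* x :- u :* t := u :* (x :- t)) refl u x t ⟩
         u * (x - t)                         ∎)
       (π*∈ (ball-- s∈ (ball-* r∈ (k⊆𝔸 t∈))))))
    where
    constant-term : ∀ {n p} → p ∈ Poly k π n → ∃[ a ] a ∈ k × ∃[ r ] r ∈ 𝔸 × p ≈ a + π * r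
    constant-term (nil p≈0)       = 0# , k.0∈ , 0# , ball-0 , trans p≈0 (sym (trans (+-identityˡ _) (zeroʳ π)))
    constant-term (cons a∈ r∈ eq) = _ , a∈ , _ , Discrete.poly-integral k-discrete r∈ , eq

  module _ {r} {ω : Fin r → Carrier} (ω∈𝔸 : ∀ i → ω i ∈ 𝔸) (ω-ind : IndependentMod isk (Ball e) ω) where

    -- If the least valuation w = v(x j) were below `M`, dividing by `x j` would leave the
    -- combination in `Ball e`. The new coefficients are integral, and their residues in `k` would
    -- form a relation modulo π whose j-th coefficient is congruent to 1.
    bounded-coordinates : ∀ M (x : Fin r → Carrier) → (∀ i → x i ∈ k⟨π⟩) →
      lc x ω ∈ Ball (M ℤ.+ e) → ∀ i → x i ∈ Ball M
    bounded-coordinates M x x∈ lc∈ with minimal-valuation x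
    ... | inj₁ all0 = λ i → ball-resp (sym (all0 i)) ball-0
    ... | inj₂ (j , w , val-xj , min) with M ℤ.≤? w
    ...   | yes M≤w = λ i → ball-≤ M≤w (min i)
    ...   | no  M≰w = contradiction (ω-ind a a∈ lc-a∈ j) aj≉0
      where
      xj≉0 = val⇒≉0 val-xj
      i⁻ = x j ⁻¹
      val-i = val-⁻¹ val-xj
      y : Fin r → Carrier
      y i = i⁻ * x i
      y∈ : ∀ i → y i ∈ k⟨π⟩
      y∈ i = F.*∈ (F.⁻¹∈ xj≉0 (x∈ j)) (x∈ i)
      y∈𝔸 : ∀ i → y i ∈ 𝔸
      y∈𝔸 i = ≡.subst (λ N → y i ∈ Ball N) (ℤ.+-inverseˡ w) (ball-* (val⇒ball val-i) (min i))
      a : Fin r → Carrier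
      a i = proj₁ (residue (y∈ i) (y∈𝔸 i))
      a∈ : ∀ i → a i ∈ k
      a∈ i = proj₁ (proj₂ (residue (y∈ i) (y∈𝔸 i)))
      y-a∈ : ∀ i → y i - a i ∈ Ball e
      y-a∈ i = proj₂ (proj₂ (residue (y∈ i) (y∈𝔸 i)))
      lc-y∈ : lc y ω ∈ Ball e
      lc-y∈ = ball-resp (sym (lc-scale i⁻ x ω)) (ball-≤ e≤ (ball-* (val⇒ball val-i) lc∈))
        where
        e≤ : e ℤ.≤ ℤ.- w ℤ.+ (M ℤ.+ e)
        e≤ = ≡.subst₂ ℤ._≤_ (ℤS.solve 2 (λ w e → ℤS.:- w ℤS.:+ (w ℤS.:+ e) ℤS.:= e) ≡.refl w e) ≡.refl
               (ℤ.+-monoʳ-≤ (ℤ.- w) (ℤ.+-monoˡ-≤ e (ℤ.<⇒≤ (ℤ.≰⇒> M≰w))))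
      lc-a∈ : lc a ω ∈ Ball e
      lc-a∈ = ball-resp (trans (+-congˡ (-‿cong (lc-- y a ω))) (solve 2 (λ s t → s :- (s :- t) := t) refl (lc y ω) (lc a ω)))
        (ball-- lc-y∈ (≡.subst (λ N → lc (λ i → y i - a i) ω ∈ Ball N) (ℤ.+-identityʳ e) (lc-ball {b = ω} y-a∈ ω∈𝔸)))
      aj≉0 : a j ≉ 0#
      aj≉0 aj≈0 = ℤ.<⇒≱ 0<e (val⇒≤ val-1 (ball-resp
        (trans (+-cong (*-inverseˡ xj≉0) (trans (-‿cong aj≈0) -0#≈0#)) (+-identityʳ 1#)) (y-a∈ j)))

    continuous-coordinates : ContinuousCoordinates k⟨π⟩ ω
    continuous-coordinates M = M ℤ.+ e , bounded-coordinates M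

    ω-independent : Independent isk⟨π⟩ ω
    ω-independent x x∈ eq i = in-all-balls⇒0 λ M → bounded-coordinates M x x∈ (ball-resp (sym eq) ball-0) i

    Ω-discrete : Discrete (Span k ω)
    Ω-discrete = record
      { isSubspace = span-isSubspace isk ω
      ; integral = λ (a , a∈ , x≈) → ball-resp (sym x≈) (lc-ball {b = ω} (λ i → k⊆𝔸 (a∈ i)) ω∈𝔸)
      ; small⇒0 = λ (a , a∈ , x≈) x∈ → trans x≈ (lc-0 ω (ω-ind a a∈ (ball-resp x≈ x∈))) }

    span⊆fractional : Span k⟨π⟩ ω ⊆ Fractional k (Span k ω) π
    span⊆fractional (x , x∈ , y≈) = fractional-resp isk isΩ (sym y≈) (go ω (basis∈span isk) x x∈)
      where
      isΩ = span-isSubspace isk ω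
      -- The induction shortens a family `b` inside the span; shortening ω itself would shrink the
      -- target as well.
      go : ∀ {n} (b : Fin n → Carrier) → (∀ i → b i ∈ Span k ω) → (x : Fin n → Carrier) →
        (∀ i → x i ∈ k⟨π⟩) → lc x b ∈ Fractional k (Span k ω) π
      go {zero}  b b∈ x x∈ = polynomial⊆fractional isk (0 , nil refl)
      go {suc n} b b∈ x x∈ = fractional-+ isk isΩ
        (fractional-* isk isΩ (adjoin⊆fractional isk (x∈ zero))
          (polynomial⊆fractional isk (1 , poly-const isΩ (b∈ zero))))
        (go (b ∘ suc) (b∈ ∘ suc) (x ∘ suc) (x∈ ∘ suc))

    module _ (ω-spans : 𝔸 ⊆ SpanMod isk (Ball e) ω) where

      -- Expands x to n places with digits from the span of ω over `k`. Sorting the digits by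
      -- members of ω yields coefficients that are polynomials in π.
      approximation : ∀ n {x} → x ∈ 𝔸 →
        Σ[ y ∈ (Fin r → Carrier) ] ((∀ i → y i ∈ k⟨π⟩) × ∃[ z ] z ∈ 𝔸 × x ≈ lc y ω + π ^ n * z)
      approximation zero {x} x∈ = (λ _ → 0#) , (λ _ → F.0∈) , x , x∈ ,
        sym (trans (+-cong (lc-0 ω (λ _ → refl)) (*-identityˡ x)) (+-identityˡ x))
      approximation (suc n) {x} x∈ =
        let a , a∈ , x-a∈ = ω-spans x∈
            x′ , x′∈ , eq = π-divides x-a∈
            y , y∈ , z , z∈ , x′≈ = approximation n x′∈
        in (λ i → a i + π * y i) , (λ i → F.+∈ (F⊆adjoin isk (a∈ i)) (F.*∈ π∈k⟨π⟩ (y∈ i))) , z , z∈ , (begin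
             x                                         ≈⟨ solve 2 (λ x s → x := s :+ (x :- s)) refl x (lc a ω) ⟩
             lc a ω + (x - lc a ω)                     ≈⟨ +-congˡ (trans eq (*-congˡ x′≈)) ⟩
             lc a ω + π * (lc y ω + π ^ n * z)         ≈⟨ solve 5 (λ s π t u z → s :+ π :* (t :+ u :* z) := s :+ π :* t :+ π :* u :* z) refl (lc a ω) π (lc y ω) (π ^ n) z ⟩
             lc a ω + π * lc y ω + π * π ^ n * z       ≈⟨ +-congʳ (sym (trans (lc-+ a (λ i → π * y i) ω) (+-congˡ (lc-scale π y ω)))) ⟩
             lc (λ i → a i + π * y i) ω + π ^ suc n * z ∎)

      dense-span : DenseSpan k⟨π⟩ ω
      dense-span x M =
        let m , x∈m = in-some-ball x
            -- Since v(π) ≥ 1, multiplication by πˢ makes x integral. The approximation has `s`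
            -- extra places to pay for dividing by πˢ afterwards.
            s = ℤ.∣ ℤ.- m ∣
            N = ℤ.∣ M ∣
            πˢ = π ^ s
            πˢ≉0 = ^-≉0 s π≉0
            πˢx∈ = ball-≤ (≡.subst (ℤ._≤ + s ℤ.+ m) (ℤ.+-inverseˡ m) (ℤ.+-monoˡ-≤ m (≤+∣∣ (ℤ.- m)))) (ball-* (π^∈ s) x∈m)
            y , y∈ , z , z∈ , eq = approximation (s ℕ.+ N) πˢx∈
        in (λ i → πˢ ⁻¹ * y i) , (λ i → F.*∈ (F.⁻¹∈ πˢ≉0 (F.^∈ s π∈k⟨π⟩)) (y∈ i)) ,
           ball-≤ (≤+∣∣ M) (ball-resp (*-cancelˡ πˢ≉0 (begin
             πˢ * (π ^ N * z)                    ≈⟨ trans (sym (*-assoc _ _ _)) (*-congʳ (sym (^-homo-* π s N))) ⟩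
             π ^ (s ℕ.+ N) * z                   ≈⟨ solve 2 (λ s t → t := s :+ t :- s) refl (lc y ω) _ ⟩
             lc y ω + π ^ (s ℕ.+ N) * z - lc y ω ≈⟨ +-cong (sym eq) (-‿cong (trans (sym (*-identityˡ _)) (*-congʳ (sym (*-inverseʳ πˢ πˢ≉0))))) ⟩
             πˢ * x - πˢ * πˢ ⁻¹ * lc y ω        ≈⟨ solve 4 (λ p x i s → p :* x :- p :* i :* s := p :* (x :- i :* s)) refl πˢ x (πˢ ⁻¹) (lc y ω) ⟩
             πˢ * (x - πˢ ⁻¹ * lc y ω)           ≈⟨ *-congˡ (+-congˡ (-‿cong (sym (lc-scale (πˢ ⁻¹) y ω)))) ⟩
             πˢ * (x - lc (λ i → πˢ ⁻¹ * y i) ω) ∎)) (π^*∈ N z∈))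

-- Expansions, their tails and periodicity

module Expansions (em : ∀ {a} → ExcludedMiddle a) {c ℓ} (L : Field c ℓ) (v : Valuation L)
  (π : Field.Carrier L) (e : ℤ) (0<e : + 0 ℤ.< e) (val-π : Valuation.val v π ≡ [ e ])
  {f} (k : Pred (Field.Carrier L) f) (isk : FieldTheory.IsSubfield em L k)
  (k-units : ∀ {a} → a ∈ k → Field._≉_ L a (Field.0# L) → Valuation.val v a ≡ [ + 0 ])
  {g} (Γ : Pred (Field.Carrier L) g) (Γ-reps : Valuation.IsCompleteRepresentatives v Γ π) where
  open Field L hiding (zero)
  open FieldTheory em L
  open Valuation v
  open Valued em L v
  open Place em L v π e 0<e val-π k isk k-units
  open IsCompleteRepresentatives Γ-reps
  open Sum semiring using (sum-cong-≋)
  private module ℤS = +-*-Solver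
  open import Relation.Binary.Reasoning.Setoid setoid

  -- r n is the tail Σ_{i ≥ 0} a (n + i) πⁱ of the expansion with digits a.
  Tails : (a r : ℕ → Carrier) → Set _
  Tails a r = ∀ n → r n ≈ a n + π * r (suc n)

  shift : ∀ {x} {X : Set x} → ℕ → (ℕ → X) → ℕ → X
  shift N a n = a (N ℕ.+ n)

  tails-shift : ∀ {a r} N → Tails a r → Tails (shift N a) (shift N r)
  tails-shift {a} {r} N t n = trans (t (N ℕ.+ n))
    (+-congˡ (*-congˡ (reflexive (≡.cong r (≡.sym (ℕ.+-suc N n))))))

  horner : (ℕ → Carrier) → ℕ → Carrier
  horner a zero    = 0#
  horner a (suc l) = a 0 + π * horner (a ∘ suc) l

  tails-unfold : ∀ {a r} l → Tails a r → r 0 ≈ horner a l + π ^ l * r l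
  tails-unfold {r = r} zero t = sym (trans (+-identityˡ _) (*-identityˡ (r 0)))
  tails-unfold {a} {r} (suc l) t = begin
    r 0                                                        ≈⟨ t 0 ⟩
    a 0 + π * r 1                                              ≈⟨ +-congˡ (*-congˡ (tails-unfold l (t ∘ suc))) ⟩
    a 0 + π * (horner (a ∘ suc) l + π ^ l * r (suc l))         ≈⟨ solve 5 (λ a π h u r → a :+ π :* (h :+ u :* r) := a :+ π :* h :+ π :* u :* r) refl (a 0) π _ (π ^ l) (r (suc l)) ⟩
    a 0 + π * horner (a ∘ suc) l + π * π ^ l * r (suc l)       ∎

  -- The factor `p` absorbs one π in each induction step; for an expansion that starts at m it is π
  -- to the power m.
  horner-sum : ∀ p a l → sum {l} (λ i → a (toℕ i) * (p * π ^ toℕ i)) ≈ p * horner a l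
  horner-sum p a zero = sym (zeroʳ p)
  horner-sum p a (suc l) = begin
    a 0 * (p * 1#) + sum {l} (λ i → a (suc (toℕ i)) * (p * (π * π ^ toℕ i)))
      ≈⟨ +-cong (*-congˡ (*-identityʳ p)) (sum-cong-≋ {l} (λ i → *-congˡ (sym (*-assoc p π (π ^ toℕ i))))) ⟩
    a 0 * p + sum {l} (λ i → a (suc (toℕ i)) * (p * π * π ^ toℕ i))
      ≈⟨ +-congˡ (horner-sum (p * π) (a ∘ suc) l) ⟩
    a 0 * p + p * π * horner (a ∘ suc) l
      ≈⟨ solve 4 (λ a p π h → a :* p :+ p :* π :* h := p :* (a :+ π :* h)) refl (a 0) p π _ ⟩
    p * (a 0 + π * horner (a ∘ suc) l) ∎

  horner-integral : ∀ {a} l → (∀ n → a n ∈ 𝔸) → horner a l ∈ 𝔸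
  horner-integral zero    a∈ = ball-0
  horner-integral (suc l) a∈ = ball-+ (a∈ 0) (ball-* π∈𝔸 (horner-integral l (a∈ ∘ suc)))

  -- Unfolding equal digits on both sides shows that the difference is divisible by every power of
  -- π.
  tails-unique : ∀ {a r b s} → Tails a r → Tails b s → (∀ n → r n ∈ 𝔸) → (∀ n → s n ∈ 𝔸) →
    (∀ n → a n ≈ b n) → r 0 ≈ s 0
  tails-unique {a} {r} {b} {s} t u r∈ s∈ a≈b = x-y≈0⇒x≈y _ _ (in-all-balls⇒0 λ M →
      ball-≤ (≤+∣∣ M) (ball-resp (sym (diff ℤ.∣ M ∣ t u a≈b)) (π^*∈ ℤ.∣ M ∣ (ball-- (r∈ _) (s∈ _)))))
    where
    diff : ∀ {a r b s} i → Tails a r → Tails b s → (∀ n → a n ≈ b n) → r 0 - s 0 ≈ π ^ i * (r i - s i)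
    diff zero t u a≈b = sym (*-identityˡ _)
    diff {a} {r} {b} {s} (suc i) t u a≈b = begin
      r 0 - s 0                             ≈⟨ +-cong (t 0) (-‿cong (trans (u 0) (+-congʳ (sym (a≈b 0))))) ⟩
      a 0 + π * r 1 - (a 0 + π * s 1)       ≈⟨ solve 4 (λ a π r s → a :+ π :* r :- (a :+ π :* s) := π :* (r :- s)) refl (a 0) π (r 1) (s 1) ⟩
      π * (r 1 - s 1)                       ≈⟨ *-congˡ (diff i (t ∘ suc) (u ∘ suc) (a≈b ∘ suc)) ⟩
      π * (π ^ i * (r (suc i) - s (suc i))) ≈⟨ sym (*-assoc _ _ _) ⟩
      π * π ^ i * (r (suc i) - s (suc i))   ∎

  tails⇒expansion : ∀ {a r} → Tails a r → (∀ n → r n ∈ 𝔸) → (∀ n → a n ∈ Γ) →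
    IsExpansion Γ π (r 0) (+ 0) (a ∘ ℤ.∣_∣)
  tails⇒expansion {a} {r} t r∈ a∈ = (λ n _ → a∈ ℤ.∣ n ∣) , λ M → ℤ.∣ M ∣ , λ n n≥ →
    ball-resp (begin
        - (π ^ n * r n)                          ≈⟨ solve 2 (λ h x → :- x := h :- (h :+ x)) refl (horner a n) _ ⟩
        horner a n - (horner a n + π ^ n * r n)  ≈⟨ +-cong (sym (trans (sum-cong-≋ {n} (λ i → *-congˡ (sym (*-identityˡ _)))) (trans (horner-sum 1# a n) (*-identityˡ _)))) (-‿cong (sym (tails-unfold n t))) ⟩
        sum {n} (λ i → a (toℕ i) * π ^ toℕ i) - r 0 ∎)
      (ball-neg (ball-≤ (ℤ.≤-trans (≤+∣∣ M) (ℤ.+≤+ n≥)) (π^*∈ n (r∈ n))))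

  ^ℤ-suc : ∀ m → π ^ℤ (m ℤ.+ + 1) ≈ π ^ℤ m * π
  ^ℤ-suc (+ n) = trans (^-homo-* π n 1) (*-congˡ (*-identityʳ π))
  ^ℤ-suc -[1+ zero ] = sym (trans (*-congʳ (*-identityʳ _)) (*-inverseˡ π≉0))
  ^ℤ-suc -[1+ suc n ] = sym (trans (solve 3 (λ i u π → i :* u :* π := i :* π :* u) refl (π ⁻¹) ((π ⁻¹) ^ suc n) π)
    (trans (*-congʳ (*-inverseˡ π≉0)) (*-identityˡ _)))

  ^ℤ-+ : ∀ m n → π ^ℤ (m ℤ.+ + n) ≈ π ^ℤ m * π ^ n
  ^ℤ-+ m zero = trans (reflexive (≡.cong (π ^ℤ_) (ℤ.+-identityʳ m))) (sym (*-identityʳ _))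
  ^ℤ-+ m (suc n) = begin
    π ^ℤ (m ℤ.+ + suc n)         ≡⟨ ≡.cong (π ^ℤ_) (≡.sym (ℤ.+-assoc m (+ 1) (+ n))) ⟩
    π ^ℤ (m ℤ.+ + 1 ℤ.+ + n)     ≈⟨ ^ℤ-+ (m ℤ.+ + 1) n ⟩
    π ^ℤ (m ℤ.+ + 1) * π ^ n     ≈⟨ *-congʳ (^ℤ-suc m) ⟩
    π ^ℤ m * π * π ^ n           ≈⟨ *-assoc _ _ _ ⟩
    π ^ℤ m * (π * π ^ n)         ∎

  ^ℤ-≉0 : ∀ m → π ^ℤ m ≉ 0#
  ^ℤ-≉0 (+ n)    = ^-≉0 n π≉0
  ^ℤ-≉0 -[1+ n ] = ^-≉0 (suc n) (⁻¹-≉0 π≉0)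

  -- The recursion (r n - a n)/π determines the tails by algebra alone; convergence of the series is
  -- what makes them integral.
  expansion⇒tails : ∀ {x m} {a : ℤ → Carrier} → IsExpansion Γ π x m a →
    ∃[ r ] Tails (λ n → a (m ℤ.+ + n)) r × (∀ n → r n ∈ 𝔸) × π ^ℤ m * r 0 ≈ x
  expansion⇒tails {x} {m} {a} (a∈ , conv) = r , tails , r∈ , pr₀≈x
    where
    p = π ^ℤ m
    p≉0 = ^ℤ-≉0 m
    a′ : ℕ → Carrier
    a′ n = a (m ℤ.+ + n)
    a′∈ : ∀ n → a′ n ∈ Γ
    a′∈ n = a∈ _ (ℤ.≤-trans (ℤ.≤-reflexive (≡.sym (ℤ.+-identityʳ m))) (ℤ.+-monoʳ-≤ m (ℤ.+≤+ z≤n)))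
    r : ℕ → Carrier
    r zero    = p ⁻¹ * x
    r (suc n) = π ⁻¹ * (r n - a′ n)
    tails : Tails a′ r
    tails n = sym (trans (+-congˡ (trans (sym (*-assoc _ _ _)) (trans (*-congʳ (*-inverseʳ π π≉0)) (*-identityˡ _))))
      (solve 2 (λ a r → a :+ (r :- a) := r) refl (a′ n) (r n)))
    pr₀≈x : p * r 0 ≈ x
    pr₀≈x = trans (sym (*-assoc _ _ _)) (trans (*-congʳ (*-inverseʳ p p≉0)) (*-identityˡ x))
    r∈ : ∀ n → r n ∈ 𝔸
    r∈ N =
      -- With `u` the valuation of p πᴺ, a partial sum of N + i digits correct to precision `u` has
      -- error p πᴺ times πⁱ r (N + i), so the last factor is integral. The digits from N on add an
      -- integral sum.
      let u , val-pπᴺ = val-finite (*-≉0 p≉0 (^-≉0 N π≉0))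
          i , near = conv u
          tailᵢ = ball-cancel {M = + 0} val-pπᴺ (≡.subst (λ M → p * π ^ N * (π ^ i * r (N ℕ.+ i)) ∈ Ball M) (≡.sym (ℤ.+-identityʳ u))
            (ball-resp (begin
              - (sum {N ℕ.+ i} (λ j → a (m ℤ.+ + toℕ j) * π ^ℤ (m ℤ.+ + toℕ j)) - x)
                ≈⟨ -‿cong (+-cong (trans (sum-cong-≋ {N ℕ.+ i} (λ j → *-congˡ (^ℤ-+ m (toℕ j)))) (horner-sum p a′ (N ℕ.+ i)))
                                  (-‿cong (trans (sym pr₀≈x) (*-congˡ (tails-unfold (N ℕ.+ i) tails))))) ⟩
              - (p * horner a′ (N ℕ.+ i) - p * (horner a′ (N ℕ.+ i) + π ^ (N ℕ.+ i) * r (N ℕ.+ i)))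
                ≈⟨ solve 4 (λ p h u r → :- (p :* h :- p :* (h :+ u :* r)) := p :* u :* r) refl p (horner a′ (N ℕ.+ i)) (π ^ (N ℕ.+ i)) (r (N ℕ.+ i)) ⟩
              p * π ^ (N ℕ.+ i) * r (N ℕ.+ i)
                ≈⟨ *-congʳ (*-congˡ (^-homo-* π N i)) ⟩
              p * (π ^ N * π ^ i) * r (N ℕ.+ i)
                ≈⟨ solve 4 (λ p s t r → p :* (s :* t) :* r := p :* s :* (t :* r)) refl p (π ^ N) (π ^ i) (r (N ℕ.+ i)) ⟩
              p * π ^ N * (π ^ i * r (N ℕ.+ i)) ∎)
            (ball-neg (near (N ℕ.+ i) (ℕ.m≤n+m i N)))))
      in ball-resp (sym (trans (reflexive (≡.cong r (≡.sym (ℕ.+-identityʳ N)))) (tails-unfold i (tails-shift N tails))))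
           (ball-+ (horner-integral i (λ n → integral (a′∈ (N ℕ.+ n)))) tailᵢ)

  -- Both γ and γ′ represent the residue class of the same element.
  digit-unique : ∀ {γ γ′ z z′} → γ ∈ Γ → γ′ ∈ Γ → z ∈ 𝔸 → z′ ∈ 𝔸 → γ + π * z ≈ γ′ + π * z′ → γ ≈ γ′ × z ≈ z′
  digit-unique {γ} {γ′} {z} {z′} γ∈ γ′∈ z∈ z′∈ eq = γ≈γ′ ,
      *-cancelˡ π≉0 (trans (solve 2 (λ γ t → t := γ :+ t :- γ) refl γ _)
        (trans (+-cong eq (-‿cong γ≈γ′)) (solve 2 (λ γ t → γ :+ t :- γ := t) refl γ′ _)))
    where
    rep = representative (γ + π * z) (ball-+ (integral γ∈) (ball-* π∈𝔸 z∈))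
    unique = proj₂ (proj₂ rep)
    γ≈γ′ : γ ≈ γ′
    γ≈γ′ = trans (sym (unique (γ∈ , z , z∈ , solve 2 (λ γ t → γ :+ t :- γ := t) refl γ (π * z))))
      (unique (γ′∈ , z′ , z′∈ , trans (+-congʳ eq) (solve 2 (λ γ t → γ :+ t :- γ := t) refl γ′ (π * z′))))

  tails-determine-digits : ∀ {a r b s} → Tails a r → Tails b s → (∀ n → r n ∈ 𝔸) → (∀ n → s n ∈ 𝔸) →
    (∀ n → a n ∈ Γ) → (∀ n → b n ∈ Γ) → r 0 ≈ s 0 → ∀ n → a n ≈ b n
  tails-determine-digits t u r∈ s∈ a∈ b∈ r≈s n
    with a≈b , r₁≈s₁ ← digit-unique (a∈ 0) (b∈ 0) (r∈ 1) (s∈ 1) (trans (sym (t 0)) (trans r≈s (u 0))) with n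
  ... | zero  = a≈b
  ... | suc n = tails-determine-digits (t ∘ suc) (u ∘ suc) (r∈ ∘ suc) (s∈ ∘ suc) (a∈ ∘ suc) (b∈ ∘ suc) r₁≈s₁ n

  tails-exist : ∀ {x} → x ∈ 𝔸 → ∃₂ λ a r → Tails a r × (∀ n → r n ∈ 𝔸) × (∀ n → a n ∈ Γ) × r 0 ≈ x
  tails-exist {x} x∈ = (λ n → digit (state n)) , (λ n → proj₁ (state n)) ,
      (λ n → next-eq (state n)) , (λ n → proj₂ (state n)) , (λ n → digit∈ (state n)) , refl
    where
    State = Σ[ y ∈ Carrier ] y ∈ 𝔸
    digit : State → Carrier
    digit (y , y∈) = proj₁ (representative y y∈)
    digit∈ : ∀ s → digit s ∈ Γ
    digit∈ (y , y∈) = proj₁ (proj₁ (proj₂ (representative y y∈)))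
    next : State → State
    next (y , y∈) = let _ , (_ , z , z∈ , _) , _ = representative y y∈ in z , z∈
    next-eq : ∀ s → proj₁ s ≈ digit s + π * proj₁ (next s)
    next-eq (y , y∈) = let γ , (_ , z , _ , eq) , _ = representative y y∈
      in trans (solve 2 (λ y γ → y := γ :+ (y :- γ)) refl y γ) (+-congˡ eq)
    state : ℕ → State
    state zero    = x , x∈
    state (suc n) = next (state n)

  Periodic : (ℕ → Carrier) → Set _
  Periodic a = ∃₂ λ N l → ∀ n → shift (suc l) (shift N a) n ≈ shift N a n

  ultimatelyPeriodic⇒periodic : ∀ {m a} → UltimatelyPeriodic m a → Periodic (λ n → a (m ℤ.+ + n))
  ultimatelyPeriodic⇒periodic {m} {a} (N′ , ℤ.+[1+ l ] , m≤N′ , _ , per) =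
    N , l , λ n → trans (reflexive (≡.cong a (shifted n))) (trans (per _ (N′≤ n)) (reflexive (≡.cong a (from-N n))))
    where
    N = ℤ.∣ N′ ℤ.- m ∣
    m+N : m ℤ.+ + N ≡ N′
    m+N = ≡.trans (≡.cong (λ z → m ℤ.+ z) (ℤ.0≤i⇒+∣i∣≡i (ℤ.i≤j⇒0≤j-i m≤N′)))
      (ℤS.solve 2 (λ m n → m ℤS.:+ (n ℤS.:- m) ℤS.:= n) ≡.refl m N′)
    from-N : ∀ n → N′ ℤ.+ + n ≡ m ℤ.+ + (N ℕ.+ n)
    from-N n = ≡.trans (≡.cong (ℤ._+ + n) (≡.sym m+N)) (ℤ.+-assoc m (+ N) (+ n))
    N′≤ : ∀ n → N′ ℤ.≤ N′ ℤ.+ + n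
    N′≤ n = ℤ.≤-trans (ℤ.≤-reflexive (≡.sym (ℤ.+-identityʳ N′))) (ℤ.+-monoʳ-≤ N′ (ℤ.+≤+ z≤n))
    shifted : ∀ n → m ℤ.+ + (N ℕ.+ (suc l ℕ.+ n)) ≡ N′ ℤ.+ + n ℤ.+ + suc l
    shifted n = ≡.trans (≡.sym (from-N (suc l ℕ.+ n))) (≡.trans (≡.cong (λ z → N′ ℤ.+ + z) (ℕ.+-comm (suc l) n)) (≡.sym (ℤ.+-assoc N′ (+ n) (+ suc l))))
  ultimatelyPeriodic⇒periodic (_ , + 0 , _ , ℤ.+<+ () , _)
  ultimatelyPeriodic⇒periodic (_ , -[1+ _ ] , _ , () , _)

  periodic⇒ultimatelyPeriodic : ∀ {m a} → Periodic (λ n → a (m ℤ.+ + n)) → UltimatelyPeriodic m a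
  periodic⇒ultimatelyPeriodic {m} {a} (N , l , per) = m ℤ.+ + N , + suc l ,
    ℤ.≤-trans (ℤ.≤-reflexive (≡.sym (ℤ.+-identityʳ m))) (ℤ.+-monoʳ-≤ m (ℤ.+≤+ z≤n)) ,
    ℤ.+<+ (s≤s z≤n) , λ i ≤i →
      let n = ℤ.∣ i ℤ.- (m ℤ.+ + N) ∣
          i≡ : m ℤ.+ + (N ℕ.+ n) ≡ i
          i≡ = ≡.trans (≡.cong (λ z → m ℤ.+ (+ N ℤ.+ z)) (ℤ.0≤i⇒+∣i∣≡i (ℤ.i≤j⇒0≤j-i ≤i)))
                 (ℤS.solve 3 (λ m n i → m ℤS.:+ (n ℤS.:+ (i ℤS.:- (m ℤS.:+ n))) ℤS.:= i) ≡.refl m (+ N) i)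
          i+l≡ : m ℤ.+ + (N ℕ.+ (suc l ℕ.+ n)) ≡ i ℤ.+ + suc l
          i+l≡ = ≡.trans (≡.cong (λ z → m ℤ.+ + z) (≡.trans (≡.cong (N ℕ.+_) (ℕ.+-comm (suc l) n)) (≡.sym (ℕ.+-assoc N n (suc l)))))
                   (≡.trans (≡.sym (ℤ.+-assoc m (+ (N ℕ.+ n)) (+ suc l))) (≡.cong (ℤ._+ + suc l) i≡))
      in trans (reflexive (≡.cong a (≡.sym i+l≡))) (trans (per n) (reflexive (≡.cong a i≡)))

  O : Pred Carrier _
  O x = x ∈ k⟨π⟩ × x ∈ 𝔸

  1-π^-unit : ∀ l → val (1# - π ^ suc l) ≡ [ + 0 ]
  1-π^-unit l = val-unit-+ (ℤ.+<+ (s≤s z≤n)) val-1 (ball-neg (ball-≤ (ℤ.+≤+ (s≤s z≤n)) (π^∈ (suc l))))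

  -- Once the digits repeat, the tail `y` satisfies (1 - π^(l+1)) y = h with `h` built from digits,
  -- and 1 - π^(l+1) is a unit of `O`. Hence only an `O`-module containing Γ is required: it is
  -- `Rational` in one direction and the elements with bounded coordinates in the other.
  periodic⇒∈ : ∀ {s a r} {E : Pred Carrier s} → IsSubspace O E → Γ ⊆ E → Tails a r → (∀ n → r n ∈ 𝔸) →
    (∀ n → a n ∈ Γ) → Periodic a → r 0 ∈ E
  periodic⇒∈ {a = a} {r} {E} isE Γ⊆E t r∈ a∈ (N , l , per) =
    resp∈ (sym (tails-unfold N t)) (+∈ (horner∈ N a∈) (π^*E N (resp∈ (trans (sym solved) (reflexive (≡.cong r (ℕ.+-identityʳ N))))
      (scale∈ (F.⁻¹∈ (val⇒≉0 (1-π^-unit l)) (F.-∈ F.1∈ (F.^∈ (suc l) π∈k⟨π⟩)) , val⇒ball (val-⁻¹ (1-π^-unit l)))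
        (horner∈ (suc l) (λ n → a∈ (N ℕ.+ n)))))))
    where
    open IsSubspace isE
    π*E : ∀ {x} → x ∈ E → π * x ∈ E
    π*E = scale∈ (π∈k⟨π⟩ , π∈𝔸)
    π^*E : ∀ n {x} → x ∈ E → π ^ n * x ∈ E
    π^*E zero    x∈ = resp∈ (sym (*-identityˡ _)) x∈
    π^*E (suc n) x∈ = resp∈ (sym (*-assoc _ _ _)) (π*E (π^*E n x∈))
    horner∈ : ∀ {a} n → (∀ n → a n ∈ Γ) → horner a n ∈ E
    horner∈ zero    a∈ = 0∈
    horner∈ (suc n) a∈ = +∈ (Γ⊆E (a∈ 0)) (π*E (horner∈ n (a∈ ∘ suc)))
    q = 1# - π ^ suc l
    q≉0 = val⇒≉0 (1-π^-unit l)
    tN = tails-shift N t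
    y = r (N ℕ.+ 0)
    h = horner (shift N a) (suc l)
    wraps : r (N ℕ.+ suc l) ≈ y
    wraps = trans (reflexive (≡.cong (λ i → r (N ℕ.+ i)) (≡.sym (ℕ.+-identityʳ (suc l)))))
      (tails-unique (tails-shift (suc l) tN) tN (λ n → r∈ _) (λ n → r∈ _) per)
    solved : y ≈ q ⁻¹ * h
    solved = *-cancelˡ q≉0 (begin
      q * y                          ≈⟨ solve 3 (λ o u y → (o :- u) :* y := o :* y :- u :* y) refl 1# (π ^ suc l) y ⟩
      1# * y - π ^ suc l * y         ≈⟨ +-congʳ (trans (*-identityˡ y) (trans (tails-unfold (suc l) tN) (+-congˡ (*-congˡ wraps)))) ⟩
      h + π ^ suc l * y - π ^ suc l * y ≈⟨ solve 2 (λ h t → h :+ t :- t := h) refl h _ ⟩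
      h                              ≈⟨ sym (trans (sym (*-assoc _ _ _)) (trans (*-congʳ (*-inverseʳ q q≉0)) (*-identityˡ h))) ⟩
      q * (q ⁻¹ * h)                 ∎)

-- The global function field and property A

module PropertyACriterion (em : ∀ {a} → ExcludedMiddle a) {c ℓ c′ ℓ′ g} (p q : ℕ) (K : Field c ℓ)
  (gff : IsGlobalFunctionField K p) (card : HasCardinality K (ConstantField K) q)
  (v : Valuation K) (Kᵥ : Completion v c′ ℓ′)
  (π : Field.Carrier (Completion.K̂ Kᵥ)) (e : ℤ) (0<e : + 0 < e)
  (val-π : Valuation.val (Completion.v̂ Kᵥ) π ≡ [ e ])
  (Γ : Pred (Field.Carrier (Completion.K̂ Kᵥ)) g)
  (Γ-reps : Valuation.IsCompleteRepresentatives (Completion.v̂ Kᵥ) Γ π) where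
  open Completion Kᵥ
  open Field K̂ hiding (zero)
  open FieldTheory em K̂
  open Polynomials em K̂
  open Algebraicity em K̂
  open Valuation v̂
  open Valued em K̂ v̂
  open CompleteBasis em K̂ v̂
  private
    module K = Field K
    module FK = FieldTheory em K
    module AK = Algebraicity em K
    module ℤS = +-*-Solver
  open IsGlobalFunctionField gff
  open import Relation.Binary.Reasoning.Setoid setoid

  ι-≉0 : ∀ {x} → x K.≉ K.0# → ι x ≉ 0#
  ι-≉0 {x} x≉0 ιx≈0 = x≉0 (Equivalence.to (Valuation.val-∞ v x)
    (≡.trans (≡.sym (ι-val x)) (Equivalence.from (val-∞ (ι x)) ιx≈0)))

  open Embedding em K K̂ ι ι-homomorphism ι-≉0 using (image-isSubfield; ι-generated; ι-lc)

  prime-isSubfield : FK.IsSubfield (PrimeField K)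
  prime-isSubfield = AK.primeField-isSubfield p {{prime⇒nonZero p-prime}} characteristic

  k : Pred Carrier _
  k = Image (ConstantField K)

  isk : IsSubfield k
  isk = image-isSubfield (AK.algebraic-isSubfield prime-isSubfield)

  k-finite : Finite k
  k-finite = let enum , _ , _ , cover = card in q , ι ∘ enum , λ y (x , x∈ , ιx≈y) →
    let i , eq = cover x x∈ in i , trans (ι.⟦⟧-cong eq) ιx≈y
    where module ι = IsRingHomomorphism ι-homomorphism

  k-units : ∀ {a} → a ∈ k → a ≉ 0# → val a ≡ [ + 0 ]
  k-units = finite-subfield-units isk k-finite

  open Place em K̂ v̂ π e 0<e val-π k isk k-units
  open Expansions em K̂ v̂ π e 0<e val-π k isk k-units Γ Γ-reps
  open IsCompleteRepresentatives Γ-reps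

  isR : IsSubfield Rational
  isR = image-isSubfield (record
    { resp∈ = λ _ _ → _ ; 0∈ = _ ; 1∈ = _ ; +∈ = λ _ _ → _ ; neg∈ = λ _ → _ ; *∈ = λ _ _ → _ ; ⁻¹∈ = λ _ _ → _ })

  private module R = IsSubfield isR

  k⊆R : k ⊆ Rational
  k⊆R (x , _ , eq) = x , _ , eq

  -- A basis of K over 𝔽ₚ(x) still spans over the larger field k(x), because 𝔽ₚ consists of
  -- constants.
  rational-span : ∃[ x ] ∃[ n ] Σ[ b ∈ (Fin n → Carrier) ] Rational ⊆ Span (Adjoin K̂ k x) b
  rational-span =
    let x , _ , n , b , _ , _ , spans = finite-over-rational
    in ι x , n , ι ∘ b , λ (z , _ , ιz≈y) →
      let a , a∈ , z≈ = spans z _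
      in ι ∘ a , (λ i → ι-generated (λ
           { (inj₁ w∈P) → inj₁ (_ , AK.F⊆algebraic prime-isSubfield w∈P , refl)
           ; (inj₂ w≈x) → inj₂ (ι.⟦⟧-cong w≈x) }) (a∈ i)) ,
         trans (sym ιz≈y) (trans (ι.⟦⟧-cong z≈) (ι-lc a b))
    where module ι = IsRingHomomorphism ι-homomorphism

  module _ (π∈R : π ∈ Rational) where

    k⟨π⟩⊆R : k⟨π⟩ ⊆ Rational
    k⟨π⟩⊆R = generated-least isR λ where
      (inj₁ a∈k) → k⊆R a∈k
      (inj₂ x≈π) → R.resp∈ (sym x≈π) π∈R

    rational-basis : ∃[ n ] Σ[ b ∈ (Fin n → Carrier) ] IsBasis K̂ Rational k⟨π⟩ b
    rational-basis =
      let x , n , b , R⊆ = rational-span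
          m , u , R⊆′ = finite-over-exchange isk {x = x} {E = Rational} isR R⊆ π∈R π-transcendental
      in basis-exists isk⟨π⟩ {E = Rational} R⊆′

    ResidueBasis : ∀ {r} → (Fin r → Carrier) → Set _
    ResidueBasis ω = (∀ i → ω i ∈ Rational) × (∀ i → ω i ∈ 𝔸) ×
      IndependentMod isk (Ball e) ω × 𝔸 ⊆ SpanMod isk (Ball e) ω

    -- Independence modulo π lifts to independence over k(π), so the degree of K bounds the size of
    -- the family and a maximal one exists.
    residue-basis : ∃[ r ] Σ[ ω ∈ (Fin r → Carrier) ] ResidueBasis ω
    residue-basis =
      let n , b , _ , _ , spans = rational-basis
          r , ω , ω∈ , ω-ind , R∩𝔸⊆ = maximal-independent isk {E = λ x → x ∈ Rational × x ∈ 𝔸} (ball-isSubspace e) n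
            (λ ω ω∈ ω-ind → independent⇒≤ isk⟨π⟩ (ω-independent (proj₂ ∘ ω∈) ω-ind) (λ i → spans _ (proj₁ (ω∈ i))))
      in r , ω , proj₁ ∘ ω∈ , proj₂ ∘ ω∈ , ω-ind , λ {x} x∈ →
           -- Maximality speaks of K ∩ 𝔸 only. By density each residue class of 𝔸 meets K.
           let y , y∈R , x-y∈ = dense x e
               a , a∈ , y-∈ = R∩𝔸⊆ {y} (y∈R , ball-resp (solve 2 (λ x y → x :- (x :- y) := y) refl x y) (ball-- x∈ (ball-≤ (ℤ.<⇒≤ 0<e) x-y∈)))
           in a , a∈ , ball-resp (solve 3 (λ x y s → x :- y :+ (y :- s) := x :- s) refl x y (lc a ω)) (ball-+ x-y∈ y-∈)

    -- Every digit is congruent modulo π to an element of the finite set `Span k ω`, and no two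
    -- digits are congruent.
    Γ-finite : Finite Γ
    Γ-finite =
      let r , ω , _ , _ , _ , 𝔸⊆ = residue-basis
      in finite-image {S = Span k ω} (λ x γ → ∃[ z ] z ∈ 𝔸 × x ≈ γ + π * z)
           (λ x≈x′ (z , z∈ , eq) → z , z∈ , trans (sym x≈x′) eq)
           (λ γ∈ γ′∈ (z , z∈ , eq) (z′ , z′∈ , eq′) → proj₁ (digit-unique γ∈ γ′∈ z∈ z′∈ (trans (sym eq) eq′)))
           (λ {γ} γ∈ →
             let a , a∈ , γ-∈ = 𝔸⊆ (integral γ∈)
                 z , z∈ , eq = π-divides γ-∈
             in lc a ω , (a , a∈ , refl) , - z , ball-neg z∈ , (begin
                  lc a ω           ≈⟨ solve 2 (λ γ s → s := γ :- (γ :- s)) refl γ (lc a ω) ⟩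
                  γ - (γ - lc a ω) ≈⟨ +-congˡ (trans (-‿cong eq) (-‿distribʳ-* π z)) ⟩
                  γ + π * - z      ∎))
           (finite-span ω k-finite)

  -- Property A implies (i) and (ii)

  module _ (A : PropertyA Γ π) where

    rational⇔periodic : ∀ {a r} → Tails a r → (∀ n → r n ∈ 𝔸) → (∀ n → a n ∈ Γ) →
      r 0 ∈ Rational ⇔ UltimatelyPeriodic (+ 0) (a ∘ ℤ.∣_∣)
    rational⇔periodic t r∈ a∈ = A _ _ _ (tails⇒expansion t r∈ a∈)

    periodic⇒rational : ∀ {a r} → Tails a r → (∀ n → r n ∈ 𝔸) → (∀ n → a n ∈ Γ) → Periodic a → r 0 ∈ Rational
    periodic⇒rational t r∈ a∈ per = Equivalence.from (rational⇔periodic t r∈ a∈) (periodic⇒ultimatelyPeriodic per)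

    private
      s = (1# - π) ⁻¹
      val-1-π = val-unit-+ 0<e val-1 (ball-neg (val⇒ball val-π))
      1-π≉0 = val⇒≉0 val-1-π
      s∈𝔸 : s ∈ 𝔸
      s∈𝔸 = val⇒ball (val-⁻¹ val-1-π)

      constant-tail : ∀ γ → γ * s ≈ γ + π * (γ * s)
      constant-tail γ = sym (begin
        γ + π * (γ * s)                     ≈⟨ +-congʳ (trans (sym (*-identityʳ γ)) (*-congˡ (sym (*-inverseʳ _ 1-π≉0)))) ⟩
        γ * ((1# - π) * s) + π * (γ * s)    ≈⟨ solve 4 (λ γ o π s → γ :* ((o :- π) :* s) :+ π :* (γ :* s) := o :* (γ :* s)) refl γ 1# π s ⟩
        1# * (γ * s)                        ≈⟨ *-identityˡ _ ⟩
        γ * s                               ∎)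

      γs∈R : ∀ {γ} → γ ∈ Γ → γ * s ∈ Rational
      γs∈R {γ} γ∈ = periodic⇒rational {λ _ → γ} {λ _ → γ * s} (λ _ → constant-tail γ)
        (λ _ → ball-* (integral γ∈) s∈𝔸) (λ _ → γ∈) (0 , 0 , λ _ → refl)

      γ+πγ′s∈R : ∀ {γ γ′} → γ ∈ Γ → γ′ ∈ Γ → γ + π * (γ′ * s) ∈ Rational
      γ+πγ′s∈R {γ} {γ′} γ∈ γ′∈ = periodic⇒rational
        {λ { zero → γ ; (suc _) → γ′ }} {λ { zero → γ + π * (γ′ * s) ; (suc _) → γ′ * s }}
        (λ { zero → refl ; (suc _) → constant-tail γ′ })
        (λ { zero → ball-+ (integral γ∈) (ball-* π∈𝔸 γ′s∈𝔸) ; (suc _) → γ′s∈𝔸 })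
        (λ { zero → γ∈ ; (suc _) → γ′∈ }) (1 , 0 , λ _ → refl)
        where γ′s∈𝔸 = ball-* (integral γ′∈) s∈𝔸

      γ-γ′∈R : ∀ {γ γ′} → γ ∈ Γ → γ′ ∈ Γ → γ - γ′ ∈ Rational
      γ-γ′∈R {γ} {γ′} γ∈ γ′∈ = R.resp∈
        (trans (+-congˡ (-‿cong (constant-tail γ′))) (solve 3 (λ γ t γ′ → γ :+ t :- (γ′ :+ t) := γ :- γ′) refl γ _ γ′))
        (R.-∈ (γ+πγ′s∈R γ∈ γ′∈) (γs∈R γ′∈))

    1-π∈R : 1# - π ∈ Rational
    1-π∈R =
      -- Two distinct digits are required. The representatives of 0 and 1 differ, since otherwise π
      -- would divide 1. With δ = γ - γ′, the quotient of δ by δ s is 1 - π.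
      let γ , (γ∈ , z , z∈ , eq) , _ = representative 0# ball-0
          γ′ , (γ′∈ , z′ , z′∈ , eq′) , _ = representative 1# 1∈𝔸
          δ≉0 : γ - γ′ ≉ 0#
          δ≉0 = λ δ≈0 → ℤ.<⇒≱ 0<e (val⇒≤ val-1 (ball-resp (begin
            π * (z′ - z)                 ≈⟨ solve 3 (λ π z′ z → π :* (z′ :- z) := π :* z′ :- π :* z) refl π z′ z ⟩
            π * z′ - π * z               ≈⟨ +-cong (sym eq′) (-‿cong (sym eq)) ⟩
            1# - γ′ - (0# - γ)           ≈⟨ solve 4 (λ o γ′ n γ → o :- γ′ :- (n :- γ) := o :- n :+ (γ :- γ′)) refl 1# γ′ 0# γ ⟩
            1# - 0# + (γ - γ′)           ≈⟨ +-cong (trans (+-congˡ -0#≈0#) (+-identityʳ 1#)) δ≈0 ⟩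
            1# + 0#                      ≈⟨ +-identityʳ 1# ⟩
            1#                           ∎) (π*∈ (ball-- z′∈ z∈))))
          δs∈R = R.resp∈ (solve 3 (λ γ γ′ s → γ :* s :- γ′ :* s := (γ :- γ′) :* s) refl γ γ′ s) (R.-∈ (γs∈R γ∈) (γs∈R γ′∈))
          δs≉0 = *-≉0 δ≉0 (⁻¹-≉0 1-π≉0)
      in R.resp∈ (*-cancelˡ δs≉0 (begin
           (γ - γ′) * s * ((γ - γ′) * ((γ - γ′) * s) ⁻¹)
             ≈⟨ solve 3 (λ t d i → t :* (d :* i) := d :* (t :* i)) refl ((γ - γ′) * s) (γ - γ′) (((γ - γ′) * s) ⁻¹) ⟩
           (γ - γ′) * ((γ - γ′) * s * ((γ - γ′) * s) ⁻¹)
             ≈⟨ *-congˡ (trans (*-inverseʳ _ δs≉0) (sym (*-inverseˡ 1-π≉0))) ⟩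
           (γ - γ′) * (s * (1# - π))
             ≈⟨ sym (*-assoc _ _ _) ⟩
           (γ - γ′) * s * (1# - π) ∎))
         (R.*∈ (γ-γ′∈R γ∈ γ′∈) (R.⁻¹∈ δs≉0 δs∈R))

    π∈R : π ∈ Rational
    π∈R = R.resp∈ (solve 2 (λ o π → o :- (o :- π) := π) refl 1# π) (R.-∈ R.1∈ 1-π∈R)

    Γ⊆R : Γ ⊆ Rational
    Γ⊆R {γ} γ∈ = R.resp∈ (trans (*-assoc _ _ _) (trans (*-congˡ (*-inverseˡ 1-π≉0)) (*-identityʳ γ)))
      (R.*∈ (γs∈R γ∈) 1-π∈R)

    -- One bound `C` holds for all coordinates. It survives scaling by `O`, though not by k(π),
    -- which is why `periodic⇒∈` is stated for `O`-modules.
    Bounded : ∀ {n} → (Fin n → Carrier) → ℤ → Pred Carrier _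
    Bounded b C = Span (λ x → x ∈ k⟨π⟩ × x ∈ Ball C) b

    bounded-isSubspace : ∀ {n} (b : Fin n → Carrier) C → IsSubspace O (Bounded b C)
    bounded-isSubspace b C = record
      { resp∈ = λ x≈y (a , a∈ , x≈) → a , a∈ , trans (sym x≈y) x≈
      ; 0∈ = (λ _ → 0#) , (λ _ → F.0∈ , ball-0) , sym (lc-0 b (λ _ → refl))
      ; +∈ = λ (a , a∈ , x≈) (a′ , a′∈ , y≈) → (λ i → a i + a′ i) ,
          (λ i → F.+∈ (proj₁ (a∈ i)) (proj₁ (a′∈ i)) , ball-+ (proj₂ (a∈ i)) (proj₂ (a′∈ i))) ,
          trans (+-cong x≈ y≈) (sym (lc-+ a a′ b))
      ; scale∈ = λ {u} (u∈F , u∈𝔸) (a , a∈ , x≈) → (λ i → u * a i) ,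
          (λ i → F.*∈ u∈F (proj₁ (a∈ i)) , ≡.subst (λ N → u * a i ∈ Ball N) (ℤ.+-identityˡ C) (ball-* u∈𝔸 (proj₂ (a∈ i)))) ,
          trans (*-congˡ x≈) (sym (lc-scale u a b)) }

    Γ-bounded : ∀ {n} {b : Fin n → Carrier} → Rational ⊆ Span k⟨π⟩ b → ∃[ C ] Γ ⊆ Bounded b C
    Γ-bounded {b = b} R⊆ = finite-uniform (Bounded b) (Γ-finite π∈R) (+ 0)
      (λ M N → M ℤ.⊓ N , lower (ℤ.i⊓j≤i M N) , lower (ℤ.i⊓j≤j M N))
      (λ {C} → IsSubspace.resp∈ (bounded-isSubspace b C))
      (λ γ∈ → let a , a∈ , γ≈ = R⊆ (Γ⊆R γ∈) ; C , a∈C = family-bound a in C , a , (λ i → a∈ i , a∈C i) , γ≈)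
      where
      lower : ∀ {M N} → M ℤ.≤ N → Bounded b N ⊆ Bounded b M
      lower M≤N (a , a∈ , x≈) = a , (λ i → proj₁ (a∈ i) , ball-≤ M≤N (proj₂ (a∈ i))) , x≈

    module _ {n} {b : Fin n → Carrier} (basis : IsBasis K̂ Rational k⟨π⟩ b) where
      private
        b∈ = proj₁ basis
        ind = proj₁ (proj₂ basis)
        Γ-bound = Γ-bounded {b = b} (proj₂ (proj₂ basis) _)
        C : ℤ
        C = proj₁ Γ-bound

      lc∈R : ∀ {x} → (∀ i → x i ∈ k⟨π⟩) → lc x b ∈ Rational
      lc∈R x∈ = R.sum∈ (λ i → R.*∈ (k⟨π⟩⊆R π∈R (x∈ i)) (b∈ i))

      -- Property A makes the digits of `z` periodic, and summing a periodic expansion preserves the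
      -- bound on the digits. The constant `C` thus depends on Γ and `b`, but not on `z`.
      integral-rational-bounded : ∀ {z} → z ∈ Rational → z ∈ 𝔸 → z ∈ Bounded b C
      integral-rational-bounded z∈R z∈𝔸 =
        let a , r , t , r∈ , a∈ , r₀≈z = tails-exist z∈𝔸
            per = Equivalence.to (rational⇔periodic t r∈ a∈) (R.resp∈ (sym r₀≈z) z∈R)
        in IsSubspace.resp∈ (bounded-isSubspace b C) r₀≈z
             (periodic⇒∈ (bounded-isSubspace b C) (proj₂ Γ-bound) t r∈ a∈ (ultimatelyPeriodic⇒periodic per))

      -- Division by πᴺ, of valuation N e, leaves an integral element of K with coordinates in
      -- `Ball C`. Coordinates are unique, so those of the original are πᴺ times these, and v(πᴺ) ≥
      -- N.
      scaled-bounded : ∀ N {x} → (∀ i → x i ∈ k⟨π⟩) → lc x b ∈ Ball (+ N ℤ.* e) → ∀ i → x i ∈ Ball (+ N ℤ.+ C)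
      scaled-bounded N {x} x∈ lc∈ = conclude (integral-rational-bounded z∈R z∈𝔸)
        where
        y = lc x b
        πᴺ = π ^ N
        val-πᴺ : val πᴺ ≡ [ + N ℤ.* e ]
        val-πᴺ = val-^ N val-π
        πᴺ≉0 = val⇒≉0 val-πᴺ
        z = πᴺ ⁻¹ * y
        πᴺz≈y : πᴺ * z ≈ y
        πᴺz≈y = trans (sym (*-assoc _ _ _)) (trans (*-congʳ (*-inverseʳ _ πᴺ≉0)) (*-identityˡ y))
        z∈𝔸 : z ∈ 𝔸
        z∈𝔸 = ball-cancel {M = + 0} val-πᴺ (ball-resp (sym πᴺz≈y) (≡.subst (λ N → y ∈ Ball N) (≡.sym (ℤ.+-identityʳ (+ N ℤ.* e))) lc∈))
        z∈R : z ∈ Rational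
        z∈R = R.*∈ (R.⁻¹∈ πᴺ≉0 (R.^∈ N π∈R)) (lc∈R x∈)
        conclude : z ∈ Bounded b C → ∀ i → x i ∈ Ball (+ N ℤ.+ C)
        conclude (d , d∈ , z≈) i = ball-resp (sym (x-y≈0⇒x≈y _ _ (x-πᴺd≈0 i))) (ball-* (π^∈ N) (proj₂ (d∈ i)))
          where
          x-πᴺd≈0 : ∀ i → x i - πᴺ * d i ≈ 0#
          x-πᴺd≈0 = ind (λ i → x i - πᴺ * d i) (λ i → F.-∈ (x∈ i) (F.*∈ (F.^∈ N π∈k⟨π⟩) (proj₁ (d∈ i)))) (begin
            lc (λ i → x i - πᴺ * d i) b   ≈⟨ lc-- x (λ i → πᴺ * d i) b ⟩
            y - lc (λ i → πᴺ * d i) b     ≈⟨ +-congˡ (-‿cong (trans (lc-scale πᴺ d b) (*-congˡ (sym z≈)))) ⟩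
            y - πᴺ * z                    ≈⟨ x≈y⇒x-y≈0 (sym πᴺz≈y) ⟩
            0#                            ∎)

      basis-continuous : ContinuousCoordinates k⟨π⟩ b
      basis-continuous M = + N ℤ.* e , λ x x∈ lc∈ i → ball-≤ M≤N+C (scaled-bounded N x∈ lc∈ i)
        where
        N = ℤ.∣ M ℤ.- C ∣
        M≤N+C : M ℤ.≤ + N ℤ.+ C
        M≤N+C = ≡.subst (ℤ._≤ + N ℤ.+ C) (ℤS.solve 2 (λ M C → M ℤS.:- C ℤS.:+ C ℤS.:= M) ≡.refl M C)
                  (ℤ.+-monoˡ-≤ C (≤+∣∣ (M ℤ.- C)))

    -- The same family `b` is a basis at both levels. Its span is dense because it contains K.
    equal-degrees : ∃[ d ] HasDegree K̂ Rational 𝔽q⟨ π ⟩ d × HasDegree K̂ U 𝔽q⟪ π ⟫ d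
    equal-degrees =
      let n , b , basis@(_ , _ , spans) = rational-basis π∈R
      in [ n ] , (b , basis) , b , closure-basis complete isk⟨π⟩ (basis-continuous basis) λ x M →
           let y , y∈R , x-y∈ = dense x M
               a , a∈ , y≈ = spans y y∈R
           in a , a∈ , ball-resp (+-congˡ (-‿cong y≈)) x-y∈

  -- (i) and (ii) imply property A

  module _ (π∈R : π ∈ Rational) (Γ⊆R : Γ ⊆ Rational) {d : ℕ ⁺}
    (R-degree : HasDegree K̂ Rational 𝔽q⟨ π ⟩ d) (K̂-degree : HasDegree K̂ U 𝔽q⟪ π ⟫ d) where

    module _ {r} {ω : Fin r → Carrier} (ω-basis : ResidueBasis π∈R ω) where
      private
        ω∈R = proj₁ ω-basis
        ω∈𝔸 = proj₁ (proj₂ ω-basis)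
        ω-ind = proj₁ (proj₂ (proj₂ ω-basis))
        ω-spans = proj₂ (proj₂ (proj₂ ω-basis))

      ω-closure-basis : IsBasis K̂ U 𝔽q⟪ π ⟫ ω
      ω-closure-basis = closure-basis complete isk⟨π⟩ (continuous-coordinates ω∈𝔸 ω-ind) (dense-span ω∈𝔸 ω-ind ω-spans)

      degree≤ : ∀ {n} {b : Fin n → Carrier} → IsBasis K̂ U 𝔽q⟪ π ⟫ b → n ℕ.≤ r
      degree≤ {b = b} (_ , b-ind , _) =
        independent⇒≤ (closure-isSubfield isk⟨π⟩) {b = ω} b-ind (λ i → proj₂ (proj₂ ω-closure-basis) (b i) _)

      -- Here the equality of degrees enters: it turns the bound `r` for K_v over the closure of
      -- k(π) into a bound for K over k(π).
      rational-independent≤ : ∀ {m} {y : Fin m → Carrier} → Independent isk⟨π⟩ y → (∀ i → y i ∈ Rational) → m ℕ.≤ r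
      rational-independent≤ {y = y} y-ind y∈ = go d R-degree K̂-degree
        where
        go : ∀ d → HasDegree K̂ Rational 𝔽q⟨ π ⟩ d → HasDegree K̂ U 𝔽q⟪ π ⟫ d → _
        -- The common degree cannot be infinite, because K has a finite basis over k(π).
        go ⊤⁺ infinite _ = let n , basis = rational-basis π∈R in contradiction basis (infinite n)
        go [ n ] (b , _ , _ , spans) (b̂ , b̂-basis) =
          ℕ.≤-trans (independent⇒≤ isk⟨π⟩ {b = b} y-ind (λ i → spans (y i) (y∈ i))) (degree≤ b̂-basis)

      -- An element of K outside the span would extend ω to r + 1 independent elements of K.
      rational⊆span : Rational ⊆ Span k⟨π⟩ ω
      rational⊆span {x} x∈R = conclude (span-or-extend isk⟨π⟩ (0-isSubspace isk⟨π⟩) (ω-independent ω∈𝔸 ω-ind) x)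
        where
        conclude : SpanMod isk⟨π⟩ (_≈ 0#) ω x ⊎ Independent isk⟨π⟩ (x ∷ ω) → Span k⟨π⟩ ω x
        conclude (inj₁ (a , a∈ , eq)) = a , a∈ , x-y≈0⇒x≈y _ _ eq
        conclude (inj₂ ext) = contradiction (rational-independent≤ {y = x ∷ ω} ext λ { zero → x∈R ; (suc i) → ω∈R i }) ℕ.1+n≰n

      -- The unit `u` is paired with a length bound for the numerators, so that the sets `Cleared`
      -- form a directed family.
      Denominator : Set _
      Denominator = ∃[ u ] u ∈ Unit × ℕ

      Cleared : Denominator → Pred Carrier _
      Cleared (u , _ , T) x = u * x ∈ Poly (Span k ω) π T

      cleared-resp : ∀ {D x y} → x ≈ y → x ∈ Cleared D → y ∈ Cleared D
      cleared-resp x≈y = poly-resp (*-congˡ x≈y)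

      clear : ∀ {x} → x ∈ Rational → x ∈ 𝔸 → ∃[ D ] x ∈ Cleared D
      clear {x} x∈R x∈𝔸 =
        let u , u∈ , T , ux∈ = fractional-integral (Ω-discrete ω∈𝔸 ω-ind) (span⊆fractional ω∈𝔸 ω-ind (rational⊆span x∈R)) x∈𝔸
        in (u , u∈ , T) , ux∈

      -- The product of the two units serves both sides; each numerator is multiplied by the other
      -- unit, and the new length bound leaves room for either result.
      clear-join : ∀ D D′ → ∃[ E ] Cleared D ⊆ Cleared E × Cleared D′ ⊆ Cleared E
      clear-join (u , ((m , u∈) , val-u) , T) (w , ((n , w∈) , val-w) , T′) =
        (u * w , (polynomial-* k-subspace (m , u∈) (n , w∈) , val-*-≡ val-u val-w) , (n ℕ.+ T) ℕ.+ (m ℕ.+ T′)) ,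
        (λ {x} ux∈ → poly-resp (solve 3 (λ u w x → w :* (u :* x) := u :* w :* x) refl u w x)
          (poly-≤ isΩ (ℕ.m≤m+n (n ℕ.+ T) (m ℕ.+ T′)) (poly-* isΩ w∈ ux∈))) ,
        (λ {x} wx∈ → poly-resp (sym (*-assoc u w x))
          (poly-≤ isΩ (ℕ.m≤n+m (m ℕ.+ T′) (n ℕ.+ T)) (poly-* isΩ u∈ wx∈)))
        where isΩ = span-isSubspace isk ω

      Γ-cleared : ∃[ D ] Γ ⊆ Cleared D
      Γ-cleared = finite-uniform Cleared (Γ-finite π∈R)
        (1# , (1∈polynomial isk , val-1) , 0) clear-join (λ {D} → cleared-resp {D})
        (λ γ∈ → clear (Γ⊆R γ∈) (integral γ∈))

      -- Multiplied by a common denominator, all tails are polynomials of bounded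
      -- degree with coefficients in a finite set, so two of them agree.
      rational⇒periodic : ∀ {a r} → Tails a r → (∀ n → r n ∈ 𝔸) → (∀ n → a n ∈ Γ) → r 0 ∈ Rational → Periodic a
      rational⇒periodic {a} {r} t r∈ a∈ r₀∈R = conclude (finite-pigeonhole (finite-poly (finite-span ω k-finite) T) (λ n → u * r n) cleared)
        where
        r₀-cleared = clear r₀∈R (r∈ 0)
        common = clear-join (proj₁ Γ-cleared) (proj₁ r₀-cleared)
        D = proj₁ common
        u = proj₁ D
        T = proj₂ (proj₂ D)
        val-u : val u ≡ [ + 0 ]
        val-u = proj₂ (proj₁ (proj₂ D))
        isP : IsSubspace k (Poly (Span k ω) π T)
        isP = poly-isSubspace (span-isSubspace isk ω)
        cleared : ∀ n → r n ∈ Cleared D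
        cleared zero    = proj₂ (proj₂ common) (proj₂ r₀-cleared)
        cleared (suc n) = Discrete.poly-divide-power (Ω-discrete ω∈𝔸 ω-ind) 1 (IsSubspace.resp∈ isP (begin
            u * r n - u * a n                    ≈⟨ +-congʳ (*-congˡ (t n)) ⟩
            u * (a n + π * r (suc n)) - u * a n  ≈⟨ solve 4 (λ u a π r → u :* (a :+ π :* r) :- u :* a := π :* (u :* r)) refl u (a n) π (r (suc n)) ⟩
            π * (u * r (suc n))                  ≈⟨ *-congʳ (sym (*-identityʳ π)) ⟩
            π ^ 1 * (u * r (suc n))              ∎)
          (IsSubspace.+∈ isP (cleared n) (subspace-neg isk isP (proj₁ (proj₂ common) (proj₂ Γ-cleared (a∈ n))))))
          (ball-* (val⇒ball val-u) (r∈ (suc n)))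
        conclude : ∃₂ (λ i j → i ℕ.< j × u * r i ≈ u * r j) → Periodic a
        conclude (i , j , i<j , eq) = i , l , tails-determine-digits
            (tails-shift (suc l) (tails-shift i t)) (tails-shift i t) (λ _ → r∈ _) (λ _ → r∈ _) (λ _ → a∈ _) (λ _ → a∈ _)
            (trans (reflexive (≡.cong r i+l+1≡j)) (trans (*-cancelˡ (val⇒≉0 val-u) (sym eq)) (reflexive (≡.cong r (≡.sym (ℕ.+-identityʳ i))))))
          where
          l = proj₁ (ℕ.m≤n⇒∃[o]m+o≡n i<j)
          i+l+1≡j : i ℕ.+ (suc l ℕ.+ 0) ≡ j
          i+l+1≡j = ≡.trans (≡.cong (i ℕ.+_) (ℕ.+-identityʳ (suc l)))
            (≡.trans (ℕ.+-suc i l) (proj₂ (ℕ.m≤n⇒∃[o]m+o≡n i<j)))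

    R-subspace : IsSubspace O Rational
    R-subspace = subfield⇒subspace (λ (x∈ , _) → k⟨π⟩⊆R π∈R x∈) isR

    π^ℤ∈R : ∀ m → π ^ℤ m ∈ Rational
    π^ℤ∈R (+ n)    = R.^∈ n π∈R
    π^ℤ∈R -[1+ n ] = R.^∈ (suc n) (R.⁻¹∈ π≉0 π∈R)

    propertyA : PropertyA Γ π
    propertyA x m a expansion =
      -- Since π to the power m is a nonzero element of K, rationality of x and of its integral tail
      -- `r 0` are equivalent.
      let r , t , r∈ , pr₀≈x = expansion⇒tails expansion
      in mk⇔
        (λ x∈R → periodic⇒ultimatelyPeriodic (rational⇒periodic (proj₂ (proj₂ (residue-basis π∈R))) t r∈ a′∈
          (R.resp∈ (trans (*-congˡ (sym pr₀≈x)) (trans (sym (*-assoc _ _ _)) (trans (*-congʳ (*-inverseˡ (^ℤ-≉0 m))) (*-identityˡ _))))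
            (R.*∈ (R.⁻¹∈ (^ℤ-≉0 m) (π^ℤ∈R m)) x∈R))))
        (λ per → R.resp∈ pr₀≈x (R.*∈ (π^ℤ∈R m)
          (periodic⇒∈ R-subspace Γ⊆R t r∈ a′∈ (ultimatelyPeriodic⇒periodic per))))
      where
      a′∈ : ∀ n → a (m ℤ.+ + n) ∈ Γ
      a′∈ n = proj₁ expansion _ (ℤ.≤-trans (ℤ.≤-reflexive (≡.sym (ℤ.+-identityʳ m))) (ℤ.+-monoʳ-≤ m (ℤ.+≤+ z≤n)))

theorem1p1 :
    (∀ {a} → ExcludedMiddle a) →
    ∀ {c ℓ c′ ℓ′ g} (p q : ℕ) (K : Field c ℓ) →
    IsGlobalFunctionField K p →
    HasCardinality K (ConstantField K) q →
    (v : Valuation K) → Valuation.Normalized v → Valuation.Nontrivial v →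
    (Kᵥ : Completion v c′ ℓ′) →
    let open Completion Kᵥ
        open Field K̂ using (Carrier)
    in
    (π : Carrier) → (∃[ n ] + 0 < n × Valuation.val v̂ π ≡ [ n ]) →
    (Γ : Pred Carrier g) → Valuation.IsCompleteRepresentatives v̂ Γ π →
    PropertyA Γ π
      ⇔ ((π ∈ Rational × Γ ⊆ Rational)
         × (∃[ d ] HasDegree K̂ Rational 𝔽q⟨ π ⟩ d × HasDegree K̂ U 𝔽q⟪ π ⟫ d))
theorem1p1 em p q K gff card v _ _ Kᵥ π (e , 0<e , val-π) Γ Γ-reps = mk⇔
    (λ A → ((π∈R A) , (λ {γ} → Γ⊆R A {γ})) , equal-degrees A)
    (λ ((π∈ , Γ⊆) , d , R-degree , K̂-degree) → propertyA π∈ Γ⊆ {d} R-degree K̂-degree)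
  where open PropertyACriterion em p q K gff card v Kᵥ π e 0<e val-π Γ Γ-reps
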